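{- Let $n \ge 1$ be an integer and let $t$ be a positive integer. For any distinct real numbers $0 < \epsilon_1, \dots, \epsilon_n < 1$, $$H_n(t) = \frac{1}{(2\pi i)^n} \int_{|z_1| = \epsilon_1} \cdots \int_{|z_n| = \epsilon_n} (z_1 \cdots z_n)^{ -t-1} \left( \sum_{k=1}^n \frac{z_k^{t+n-1}}{\prod_{j \neq k} (z_k - z_j)} \right)^n dz_n \cdots dz_1 ,$$ where in the product $j$ ranges over $\{1,\dots,n\}\setminus\{k\}$.
   Context: The $n$-th Birkhoff polytope $\mathcal{B}_n \subset \mathbb{R}^{n^2}$ is the set of all real $n \times n$ matrices $(x_{jk})$ with $x_{jk} \ge 0$ for all $j,k$ and with every row sum and every column sum equal to $1$. Its Ehrhart counting function is $H_n(t) = \#\left(t\mathcal{B}_n \cap \mathbb{Z}^{n^2}\right)$, i.e. the number of $n \times n$ matrices with nonnegative integer entries in which every row and every column sums to $t$. Each integral $\int_{|z_k| = \epsilon_k}$ is a complex contour integral over the circle of radius $\epsilon_k$ centered at $0$, traversed once counterclockwise. -}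

module Defs where

open import Algebra.Apartness.Bundles using (HeytingField; HeytingCommutativeRing)
open import Algebra.Bundles using (CommutativeRing; RawRing)
import Algebra.Definitions
import Algebra.Definitions.RawSemiring
import Algebra.Apartness.Properties.HeytingCommutativeRing
import Algebra.Properties.Monoid.Mult
import Algebra.Properties.Semiring.Exp
import Algebra.Properties.Semiring.Mult
import Algebra.Properties.Ring
import Algebra.Properties.CommutativeSemigroup as CS
import Algebra.Solver.Ring
open import Algebra.Solver.Ring.AlmostCommutativeRing
  using (AlmostCommutativeRing; fromCommutativeRing; _-Raw-AlmostCommutative⟶_)
open import Data.Bool.Base using (if_then_else_)
open import Data.Empty using (⊥-elim)
open import Data.Fin.Base using (Fin; zero; suc; toℕ; inject₁; fromℕ)
import Data.Fin.Properties as Fin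
open import Data.Integer.Base as ℤ using (ℤ; +_; -[1+_])
import Data.Integer.Properties as ℤ
open import Data.Maybe.Base using (Maybe; map)
open import Data.Nat.Base as ℕ using (ℕ; zero; suc)
import Data.Nat.Properties as ℕ
open import Data.Product.Base using (Σ-syntax; ∃-syntax; _×_; _,_; proj₁; proj₂)
open import Data.Sum.Base using (_⊎_; inj₁; inj₂; [_,_]′)
open import Data.Vec.Functional using (Vector; tail)
open import Function.Base using (_∘_)
open import Function.Bundles using (Inverse)
open import Level using (Level; Lift; _⊔_; 0ℓ) renaming (suc to lsuc)
open import Relation.Binary.Bundles using (Setoid)
open import Relation.Binary.Consequences using (dec⇒weaklyDec)
open import Relation.Binary.Core using (Rel)
open import Relation.Binary.PropositionalEquality.Core as ≡ using (_≡_; _≢_)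
import Relation.Binary.PropositionalEquality.Properties as ≡
import Relation.Binary.Reasoning.Setoid
open import Relation.Binary.Structures using (IsEquivalence; IsStrictPartialOrder)
open import Relation.Nullary.Decidable.Core using (does; yes; no)
open import Relation.Nullary.Negation.Core using (¬_)

private
  variable
    n : ℕ


-- The real numbers, axiomatised as a Cauchy-complete Archimedean ordered
-- field.  Apartness `_#_` is the positive form of ≠.  The Bishop reals are a
-- model; classically these axioms determine ℝ up to unique isomorphism.

record RealNumbers c ℓ₁ ℓ₂ : Set (lsuc (c ⊔ ℓ₁ ⊔ ℓ₂)) where
  field
    heytingField : HeytingField c ℓ₁ ℓ₂

  open HeytingField heytingField public hiding (zero) renaming (Carrier to ℝ)

  commutativeRing : CommutativeRing c ℓ₁
  commutativeRing = HeytingCommutativeRing.commutativeRing heytingCommutativeRing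

  open CommutativeRing commutativeRing public using (rawRing; ring; semiring)
  open Algebra.Definitions.RawSemiring (RawRing.rawSemiring rawRing) public
    using () renaming (sum to ∑; _^_ to _^ʳ_; _×_ to _·_)

  ofℕ : ℕ → ℝ
  ofℕ m = m · 1#

  infix 4 _<_ _≤_
  field
    _<_                  : Rel ℝ ℓ₂
    isStrictPartialOrder : IsStrictPartialOrder _≈_ _<_
    #⇒<⊎>                : ∀ {x y} → x # y → x < y ⊎ y < x
    <⇒#                  : ∀ {x y} → x < y → x # y
    +-monoˡ-<            : ∀ z {x y} → x < y → x + z < y + z
    *-pos                : ∀ {x y} → 0# < x → 0# < y → 0# < x * y
    archimedean          : ∀ x → ∃[ m ] x < ofℕ m

  _≤_ : Rel ℝ ℓ₂
  x ≤ y = ¬ (y < x)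

  ∣_∣<_ : ℝ → ℝ → Set ℓ₂
  ∣ x ∣< δ = (- δ < x) × (x < δ)

  IsCauchy : (ℕ → ℝ) → Set (c ⊔ ℓ₂)
  IsCauchy a = ∀ δ → 0# < δ → ∃[ N ] (∀ j k → N ℕ.≤ j → N ℕ.≤ k → ∣ a j - a k ∣< δ)

  _⟶_ : (ℕ → ℝ) → ℝ → Set (c ⊔ ℓ₂)
  a ⟶ l = ∀ δ → 0# < δ → ∃[ N ] (∀ k → N ℕ.≤ k → ∣ a k - l ∣< δ)

  field
    complete : ∀ a → IsCauchy a → ∃[ l ] a ⟶ l

  ofℤ : ℤ → ℝ
  ofℤ (+ m)    = ofℕ m
  ofℤ -[1+ m ] = - ofℕ (suc m)


module Analysis {c ℓ₁ ℓ₂ : Level} (reals : RealNumbers c ℓ₁ ℓ₂) where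

  open RealNumbers reals public
  open IsStrictPartialOrder isStrictPartialOrder
    using (<-respʳ-≈; <-respˡ-≈) renaming (trans to <-trans; irrefl to <-irrefl)

  private
    module AP = Algebra.Apartness.Properties.HeytingCommutativeRing heytingCommutativeRing
    module RP = Algebra.Properties.Ring ring
    module MP = Algebra.Properties.Monoid.Mult (CommutativeRing.+-monoid commutativeRing)
    module EP = Algebra.Properties.Semiring.Exp semiring
    module SP = Algebra.Properties.Semiring.Mult semiring
    module ≈R = Relation.Binary.Reasoning.Setoid setoid

  abstract
    ofℤ-neg : ∀ i → ofℤ (ℤ.- i) ≈ - ofℤ i
    ofℤ-neg (+ zero)  = sym RP.-0#≈0#
    ofℤ-neg (+ suc m) = refl
    ofℤ-neg -[1+ m ]  = sym (RP.-‿involutive _)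

    cancel-1+ : ∀ x y → (1# + x) - (1# + y) ≈ x - y
    cancel-1+ x y = begin
      (1# + x) + - (1# + y)      ≈⟨ +-congˡ (RP.-‿+-comm 1# y) ⟨
      (1# + x) + (- 1# + - y)    ≈⟨ +-congʳ (+-comm 1# x) ⟩
      (x + 1#) + (- 1# + - y)    ≈⟨ +-assoc x 1# _ ⟩
      x + (1# + (- 1# + - y))    ≈⟨ +-congˡ (+-assoc 1# (- 1#) (- y)) ⟨
      x + ((1# + - 1#) + - y)    ≈⟨ +-congˡ (+-congʳ (-‿inverseʳ 1#)) ⟩
      x + (0# + - y)             ≈⟨ +-congˡ (+-identityˡ (- y)) ⟩
      x - y                      ∎
      where open ≈R

    ofℤ-⊖ : ∀ m k → ofℤ (m ℤ.⊖ k) ≈ ofℕ m - ofℕ k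
    ofℤ-⊖ m zero = sym (AP.x-0≈x _)
    ofℤ-⊖ zero (suc k) = sym (+-identityˡ _)
    ofℤ-⊖ (suc m) (suc k) = trans (reflexive (≡.cong ofℤ (ℤ.[1+m]⊖[1+n]≡m⊖n m k)))
      (trans (ofℤ-⊖ m k) (sym (cancel-1+ (ofℕ m) (ofℕ k))))

    ofℤ-+ : ∀ i j → ofℤ (i ℤ.+ j) ≈ ofℤ i + ofℤ j
    ofℤ-+ (+ m)    (+ k)    = MP.×-homo-+ 1# m k
    ofℤ-+ (+ m)    -[1+ k ] = ofℤ-⊖ m (suc k)
    ofℤ-+ -[1+ m ] (+ k)    = trans (ofℤ-⊖ k (suc m)) (+-comm _ _)
    ofℤ-+ -[1+ m ] -[1+ k ] = trans
      (-‿cong (trans (reflexive (≡.cong ofℕ (≡.sym (ℕ.+-suc (suc m) k)))) (MP.×-homo-+ 1# (suc m) (suc k))))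
      (sym (RP.-‿+-comm _ _))

    ofℤ-*⁺ : ∀ i k → ofℤ (i ℤ.* + k) ≈ ofℤ i * ofℕ k
    ofℤ-*⁺ (+ m) k = trans (reflexive (≡.cong ofℤ (≡.sym (ℤ.pos-* m k)))) (SP.×1-homo-* m k)
    ofℤ-*⁺ -[1+ m ] k = begin
      ofℤ (-[1+ m ] ℤ.* + k)         ≡⟨ ≡.cong ofℤ (ℤ.neg-distribˡ-* (+ suc m) (+ k)) ⟨
      ofℤ (ℤ.- (+ suc m ℤ.* + k))    ≈⟨ ofℤ-neg (+ suc m ℤ.* + k) ⟩
      - ofℤ (+ suc m ℤ.* + k)        ≡⟨ ≡.cong (-_ ∘ ofℤ) (ℤ.pos-* (suc m) k) ⟨
      - ofℕ (suc m ℕ.* k)            ≈⟨ -‿cong (SP.×1-homo-* (suc m) k) ⟩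
      - (ofℕ (suc m) * ofℕ k)        ≈⟨ RP.-‿distribˡ-* _ _ ⟩
      - ofℕ (suc m) * ofℕ k          ∎
      where open ≈R

    ofℤ-* : ∀ i j → ofℤ (i ℤ.* j) ≈ ofℤ i * ofℤ j
    ofℤ-* i (+ k)    = ofℤ-*⁺ i k
    ofℤ-* i -[1+ k ] = begin
      ofℤ (i ℤ.* -[1+ k ])           ≡⟨ ≡.cong ofℤ (ℤ.neg-distribʳ-* i (+ suc k)) ⟨
      ofℤ (ℤ.- (i ℤ.* + suc k))      ≈⟨ ofℤ-neg (i ℤ.* + suc k) ⟩
      - ofℤ (i ℤ.* + suc k)          ≈⟨ -‿cong (ofℤ-*⁺ i (suc k)) ⟩
      - (ofℤ i * ofℕ (suc k))        ≈⟨ RP.-‿distribʳ-* _ _ ⟩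
      ofℤ i * - ofℕ (suc k)          ∎
      where open ≈R

  private
    ACR : AlmostCommutativeRing c ℓ₁
    ACR = fromCommutativeRing commutativeRing

    ofℤ-morphism : ℤ.+-*-rawRing -Raw-AlmostCommutative⟶ ACR
    ofℤ-morphism = record
      { ⟦_⟧    = ofℤ
      ; +-homo = ofℤ-+
      ; *-homo = ofℤ-*
      ; -‿homo = ofℤ-neg
      ; 0-homo = refl
      ; 1-homo = +-identityʳ 1#
      }

    ofℤ-≟ : ∀ i j → Maybe (ofℤ i ≈ ofℤ j)
    ofℤ-≟ i j = map (reflexive ∘ ≡.cong ofℤ) (dec⇒weaklyDec ℤ._≟_ i j)

  module Solver = Algebra.Solver.Ring ℤ.+-*-rawRing ACR ofℤ-morphism ofℤ-≟

  open Solver using (solve; con; _:=_; _:+_; _:*_; _:-_; :-_)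

  private
    :0 : ∀ {k} → Solver.Polynomial k
    :0 = con ℤ.0ℤ

  abstract
    <-cotrans : ∀ {x y} → x < y → ∀ z → x < z ⊎ z < y
    <-cotrans {x} {y} x<y z with #-cotrans (<⇒# x<y) z
    ... | inj₁ x#z = [ inj₁ , (λ z<x → inj₂ (<-trans z<x x<y)) ]′ (#⇒<⊎> x#z)
    ... | inj₂ z#y = [ inj₂ , (λ y<z → inj₁ (<-trans x<y y<z)) ]′ (#⇒<⊎> z#y)

    <-≤-trans : ∀ {x y z} → x < y → y ≤ z → x < z
    <-≤-trans {z = z} x<y y≤z = [ (λ x<z → x<z) , (λ z<y → ⊥-elim (y≤z z<y)) ]′ (<-cotrans x<y z)

    ≤-<-trans : ∀ {x y z} → x ≤ y → y < z → x < z
    ≤-<-trans {x} x≤y y<z = [ (λ y<x → ⊥-elim (x≤y y<x)) , (λ x<z → x<z) ]′ (<-cotrans y<z x)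

    <⇒≤ : ∀ {x y} → x < y → x ≤ y
    <⇒≤ x<y y<x = <-irrefl refl (<-trans x<y y<x)

    +-pos : ∀ {x y} → 0# < x → 0# ≤ y → 0# < x + y
    +-pos {x} {y} 0<x 0≤y = ≤-<-trans 0≤y
      (<-respˡ-≈ (+-identityˡ y) (+-monoˡ-< y 0<x))

    <⇒0<- : ∀ {x y} → x < y → 0# < y - x
    <⇒0<- {x} x<y = <-respˡ-≈ (-‿inverseʳ x) (+-monoˡ-< (- x) x<y)

    0<-⇒< : ∀ {x y} → 0# < y - x → x < y
    0<-⇒< {x} {y} p = <-respˡ-≈ (+-identityˡ x)
      (<-respʳ-≈ (solve 2 (λ x y → (y :- x) :+ x := y) refl x y) (+-monoˡ-< x p))

    neg-pos : ∀ {x} → x < 0# → 0# < - x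
    neg-pos {x} x<0 = <-respʳ-≈ (+-identityˡ (- x)) (<⇒0<- x<0)

    pos-neg : ∀ {x} → 0# < x → - x < 0#
    pos-neg {x} 0<x = 0<-⇒< (<-respʳ-≈ (solve 1 (λ x → x := :0 :- (:- x)) refl x) 0<x)

    *-monoʳ-< : ∀ {x y z} → 0# < z → x < y → x * z < y * z
    *-monoʳ-< {x} {y} {z} 0<z x<y = 0<-⇒<
      (<-respʳ-≈ (solve 3 (λ x y z → (y :- x) :* z := y :* z :- x :* z) refl x y z) (*-pos (<⇒0<- x<y) 0<z))

    #⇒sq-pos : ∀ {x} → x # 0# → 0# < x * x
    #⇒sq-pos {x} x#0 with #⇒<⊎> x#0
    ... | inj₁ x<0 = <-respʳ-≈ (solve 1 (λ x → (:- x) :* (:- x) := x :* x) refl x)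
                       (*-pos (neg-pos x<0) (neg-pos x<0))
    ... | inj₂ 0<x = *-pos 0<x 0<x

    #-factorˡ : ∀ {x y} → x * y # 0# → x # 0#
    #-factorˡ {x} {y} xy#0 with #⇒invertible xy#0
    ... | u , _ , e = AP.invertibleʳ⇒# (y * u , trans (solve 3 (λ x y u → (x :- :0) :* (y :* u) := (x :* y :- :0) :* u) refl x y u) e)

    sq-nonneg : ∀ x → 0# ≤ x * x
    sq-nonneg x x²<0 = <⇒≤ (#⇒sq-pos (#-factorˡ (<⇒# x²<0))) x²<0

    0<1 : 0# < 1#
    0<1 = <-respʳ-≈ (*-identityˡ 1#) (#⇒sq-pos AP.1#0)

    +-#⇒ : ∀ {x y} → x + y # 0# → x # 0# ⊎ y # 0#
    +-#⇒ {x} {y} x+y#0 with #-cotrans x+y#0 y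
    ... | inj₂ y#0 = inj₂ y#0
    ... | inj₁ x+y#y with #⇒invertible x+y#y
    ...   | u , _ , e = inj₁ (AP.invertibleʳ⇒# (u , trans (*-congʳ (solve 2 (λ x y → x :- :0 := (x :+ y) :- y) refl x y)) e))

  abstract
    0<ofℕ-suc : ∀ m → 0# < ofℕ (suc m)
    0<ofℕ-suc zero    = <-respʳ-≈ (sym (+-identityʳ 1#)) 0<1
    0<ofℕ-suc (suc m) = +-pos 0<1 (<⇒≤ (0<ofℕ-suc m))

  inv : (x : ℝ) → x # 0# → ℝ
  inv x x#0 = proj₁ (#⇒invertible x#0)

  inv-inverseʳ : ∀ x (x#0 : x # 0#) → x * inv x x#0 ≈ 1#
  inv-inverseʳ x x#0 = trans (*-congʳ (sym (AP.x-0≈x x))) (proj₂ (proj₂ (#⇒invertible x#0)))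

  abstract
    inverse-pos : ∀ {x u} → 0# < x → x * u ≈ 1# → 0# < u
    inverse-pos {x} {u} 0<x xu≈1 = [ (λ u<0 → ⊥-elim (<⇒≤ 0<1 (1<0 u<0))) , (λ 0<u → 0<u) ]′ (#⇒<⊎> u#0)
      where
      ux≈1 : u * x ≈ 1#
      ux≈1 = trans (*-comm u x) xu≈1
      u#0 : u # 0#
      u#0 = #-factorˡ (AP.#-congʳ (sym ux≈1) AP.1#0)
      1<0 : u < 0# → 1# < 0#
      1<0 u<0 = <-respˡ-≈ ux≈1 (<-respʳ-≈ (zeroˡ x) (*-monoʳ-< 0<x u<0))

  unitFraction : ℕ → ℝ
  unitFraction m = inv (ofℕ (suc m)) (#-sym (<⇒# (0<ofℕ-suc m)))

  -- leibniz m = 1 − 1/3 + 1/5 − ⋯  (m terms)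
  leibniz : ℕ → ℝ
  leibniz zero    = 0#
  leibniz (suc m) = leibniz m + (- 1#) ^ʳ m * unitFraction (2 ℕ.* m)

  abstract
    inverse-anti : ∀ {x y u v} → 0# < u → 0# < v → x * u ≈ 1# → y * v ≈ 1# → x < y → v < u
    inverse-anti {x} {y} {u} {v} 0<u 0<v xu≈1 yv≈1 x<y =
      <-respˡ-≈ (trans (sym (*-assoc x u v)) (trans (*-congʳ xu≈1) (*-identityˡ v)))
        (<-respʳ-≈ (trans (solve 3 (λ y u v → y :* (u :* v) := (y :* v) :* u) refl y u v)
                     (trans (*-congʳ yv≈1) (*-identityˡ u)))
          (*-monoʳ-< (*-pos 0<u 0<v) x<y))

    ofℕ-mono-< : ∀ {j k} → j ℕ.< k → ofℕ j < ofℕ k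
    ofℕ-mono-< {j} {k} j<k = <-respʳ-≈ eq (<-respˡ-≈ (+-identityˡ (ofℕ j)) (+-monoˡ-< (ofℕ j) (0<ofℕ-suc (k ℕ.∸ suc j))))
      where
      eq : ofℕ (suc (k ℕ.∸ suc j)) + ofℕ j ≈ ofℕ k
      eq = trans (sym (MP.×-homo-+ 1# (suc (k ℕ.∸ suc j)) j))
        (reflexive (≡.cong ofℕ (≡.trans (≡.sym (ℕ.+-suc (k ℕ.∸ suc j) j)) (ℕ.m∸n+n≡m j<k))))

  private abstract
    term : ℕ → ℝ
    term m = unitFraction (2 ℕ.* m)

    term-inverse : ∀ m → ofℕ (suc (2 ℕ.* m)) * term m ≈ 1#
    term-inverse m = inv-inverseʳ (ofℕ (suc (2 ℕ.* m))) (#-sym (<⇒# (0<ofℕ-suc (2 ℕ.* m))))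

    term-pos : ∀ m → 0# < term m
    term-pos m = inverse-pos {x = ofℕ (suc (2 ℕ.* m))} (0<ofℕ-suc (2 ℕ.* m)) (term-inverse m)

    term-anti : ∀ m → term (suc m) < term m
    term-anti m = inverse-anti {x = ofℕ (suc (2 ℕ.* m))} {y = ofℕ (suc (2 ℕ.* suc m))}
      (term-pos m) (term-pos (suc m)) (term-inverse m) (term-inverse (suc m))
      (ofℕ-mono-< (ℕ.s<s (ℕ.*-monoʳ-< 2 (ℕ.n<1+n m))))

    term-small : ∀ δ → 0# < δ → ∃[ N ] (∀ m → N ℕ.≤ m → term m < δ)
    term-small δ 0<δ = N , small
      where
      δ#0 : δ # 0#
      δ#0 = #-sym (<⇒# 0<δ)
      N : ℕ
      N = proj₁ (archimedean (inv δ δ#0))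
      small : ∀ m → N ℕ.≤ m → term m < δ
      small m N≤m = inverse-anti {x = inv δ δ#0} {y = ofℕ (suc (2 ℕ.* m))}
        0<δ (term-pos m) (trans (*-comm _ δ) (inv-inverseʳ δ δ#0)) (term-inverse m)
        (<-trans (proj₂ (archimedean (inv δ δ#0))) (ofℕ-mono-< (ℕ.s≤s (ℕ.≤-trans N≤m (ℕ.m≤n*m m 2)))))

    alt : ℕ → ℕ → ℝ
    alt m zero    = 0#
    alt m (suc d) = term m - alt (suc m) d

    ≤⇒0≤- : ∀ {x y} → x ≤ y → 0# ≤ y - x
    ≤⇒0≤- {x} {y} x≤y y-x<0 = x≤y (0<-⇒< (<-respʳ-≈ (solve 2 (λ x y → :- (y :- x) := x :- y) refl x y) (neg-pos y-x<0)))

    -≤ : ∀ {x y} → 0# ≤ y → x - y ≤ x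
    -≤ {x} {y} 0≤y x<x-y = 0≤y (0<-⇒< (<-respʳ-≈ (solve 2 (λ x y → (x :- y) :- x := :0 :- y) refl x y) (<⇒0<- x<x-y)))

    alt≥0 : ∀ m d → 0# ≤ alt m d
    alt≤term : ∀ m d → alt m d ≤ term m
    alt≥0 m zero    = <-irrefl refl
    alt≥0 m (suc d) = ≤⇒0≤- λ t<alt → alt≤term (suc m) d (<-trans (term-anti m) t<alt)
    alt≤term m zero    = <⇒≤ (term-pos m)
    alt≤term m (suc d) = -≤ (alt≥0 (suc m) d)

    alt-snoc : ∀ m d → alt m (suc d) ≈ alt m d + (- 1#) ^ʳ d * term (m ℕ.+ d)
    alt-snoc m zero = begin
      term m - 0#                      ≈⟨ AP.x-0≈x _ ⟩
      term m                           ≡⟨ ≡.cong term (ℕ.+-identityʳ m) ⟨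
      term (m ℕ.+ 0)                   ≈⟨ *-identityˡ _ ⟨
      1# * term (m ℕ.+ 0)              ≈⟨ +-identityˡ _ ⟨
      0# + 1# * term (m ℕ.+ 0)         ∎
      where open ≈R
    alt-snoc m (suc d) = begin
      term m - alt (suc m) (suc d)
        ≈⟨ +-congˡ (-‿cong (alt-snoc (suc m) d)) ⟩
      term m - (alt (suc m) d + (- 1#) ^ʳ d * term (suc m ℕ.+ d))
        ≡⟨ ≡.cong (λ e → term m - (alt (suc m) d + (- 1#) ^ʳ d * term e)) (ℕ.+-suc m d) ⟨
      term m - (alt (suc m) d + (- 1#) ^ʳ d * term (m ℕ.+ suc d))
        ≈⟨ lemma (term m) (alt (suc m) d) ((- 1#) ^ʳ d) (term (m ℕ.+ suc d)) ⟩
      term m - alt (suc m) d + (- 1#) * (- 1#) ^ʳ d * term (m ℕ.+ suc d) ∎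
      where
      open ≈R
      lemma : ∀ a b s e → a - (b + s * e) ≈ a - b + (- 1#) * s * e
      lemma a b s e = trans (solve 4 (λ a b s e → a :- (b :+ s :* e) := (a :- b) :+ (:- s) :* e) refl a b s e)
        (+-congˡ (*-congʳ (sym (RP.-1*x≈-x s))))

    leibniz-split : ∀ m d → leibniz (m ℕ.+ d) ≈ leibniz m + (- 1#) ^ʳ m * alt m d
    leibniz-split m zero = trans (reflexive (≡.cong leibniz (ℕ.+-identityʳ m)))
      (sym (trans (+-congˡ (zeroʳ _)) (+-identityʳ _)))
    leibniz-split m (suc d) = begin
      leibniz (m ℕ.+ suc d)
        ≡⟨ ≡.cong leibniz (ℕ.+-suc m d) ⟩
      leibniz (m ℕ.+ d) + (- 1#) ^ʳ (m ℕ.+ d) * term (m ℕ.+ d)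
        ≈⟨ +-cong (leibniz-split m d) (*-congʳ (EP.^-homo-* (- 1#) m d)) ⟩
      (leibniz m + (- 1#) ^ʳ m * alt m d) + ((- 1#) ^ʳ m * (- 1#) ^ʳ d) * term (m ℕ.+ d)
        ≈⟨ solve 5 (λ l s a r e → (l :+ s :* a) :+ (s :* r) :* e := l :+ s :* (a :+ r :* e)) refl
             (leibniz m) ((- 1#) ^ʳ m) (alt m d) ((- 1#) ^ʳ d) (term (m ℕ.+ d)) ⟩
      leibniz m + (- 1#) ^ʳ m * (alt m d + (- 1#) ^ʳ d * term (m ℕ.+ d))
        ≈⟨ +-congˡ (*-congˡ (alt-snoc m d)) ⟨
      leibniz m + (- 1#) ^ʳ m * alt m (suc d) ∎
      where open ≈R

    ∣∣<-cong : ∀ {x y δ} → x ≈ y → ∣ x ∣< δ → ∣ y ∣< δ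
    ∣∣<-cong x≈y (p , q) = <-respʳ-≈ x≈y p , <-respˡ-≈ x≈y q

    neg-anti : ∀ {x y} → x < y → - y < - x
    neg-anti {x} {y} x<y = 0<-⇒< (<-respʳ-≈ (solve 2 (λ x y → y :- x := (:- x) :- (:- y)) refl x y) (<⇒0<- x<y))

    ∣∣<-neg : ∀ {x δ} → ∣ x ∣< δ → ∣ - x ∣< δ
    ∣∣<-neg {x} {δ} (p , q) = neg-anti q , <-respʳ-≈ (RP.-‿involutive δ) (neg-anti p)

    ∣∣<-sign : ∀ m {x δ} → ∣ x ∣< δ → ∣ (- 1#) ^ʳ m * x ∣< δ
    ∣∣<-sign zero    {x} p = ∣∣<-cong (sym (*-identityˡ x)) p
    ∣∣<-sign (suc m) {x} p = ∣∣<-cong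
      (trans (sym (RP.-1*x≈-x _)) (sym (*-assoc (- 1#) ((- 1#) ^ʳ m) x))) (∣∣<-neg (∣∣<-sign m p))

    leibniz-close : ∀ {δ m k} → 0# < δ → m ℕ.≤ k → term m < δ → ∣ leibniz k - leibniz m ∣< δ
    leibniz-close {δ} {m} {k} 0<δ m≤k t<δ = ∣∣<-cong (sym eq)
      (∣∣<-sign m (<-≤-trans (pos-neg 0<δ) (alt≥0 m d) , ≤-<-trans (alt≤term m d) t<δ))
      where
      d : ℕ
      d = k ℕ.∸ m
      eq : leibniz k - leibniz m ≈ (- 1#) ^ʳ m * alt m d
      eq = trans (+-congʳ (trans (reflexive (≡.cong leibniz (≡.sym (ℕ.m+[n∸m]≡n m≤k)))) (leibniz-split m d)))
        (solve 2 (λ l x → (l :+ x) :- l := x) refl (leibniz m) ((- 1#) ^ʳ m * alt m d))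

    leibniz-cauchy : IsCauchy leibniz
    leibniz-cauchy δ 0<δ = proj₁ (term-small δ 0<δ) , λ j k N≤j N≤k →
      [ (λ j≤k → ∣∣<-cong (solve 2 (λ x y → :- (y :- x) := x :- y) refl (leibniz j) (leibniz k))
          (∣∣<-neg (leibniz-close 0<δ j≤k (proj₂ (term-small δ 0<δ) j N≤j))))
      , (λ k≤j → leibniz-close 0<δ k≤j (proj₂ (term-small δ 0<δ) k N≤k)) ]′ (ℕ.≤-total j k)

  π/4 π : ℝ
  π/4 = proj₁ (complete leibniz leibniz-cauchy)
  π   = ofℕ 4 * π/4

  leibniz⟶π/4 : leibniz ⟶ π/4
  leibniz⟶π/4 = proj₂ (complete leibniz leibniz-cauchy)

  abstract
    0<π : 0# < π
    0<π = *-pos (0<ofℕ-suc 3) (0<-⇒< (<-respʳ-≈ (sym (AP.x-0≈x l)) 0<l))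
      where
      l p : ℝ
      l = π/4
      p = term 0 - term 1
      0<p : 0# < p
      0<p = <⇒0<- (term-anti 0)
      N k : ℕ
      N = proj₁ (leibniz⟶π/4 p 0<p)
      k = 2 ℕ.+ N
      lk≈ : leibniz k ≈ alt 0 k
      lk≈ = trans (leibniz-split 0 k) (trans (+-identityˡ _) (*-identityˡ _))
      p≤ : p ≤ leibniz k
      p≤ lk<p = alt≤term 1 (suc N) (0<-⇒< (<-respʳ-≈
        (solve 3 (λ a b e → (a :- b) :- (a :- e) := e :- b) refl (term 0) (term 1) (alt 1 (suc N)))
        (<⇒0<- (<-respˡ-≈ lk≈ lk<p))))
      close : leibniz k - l < leibniz k
      close = <-≤-trans (proj₂ (proj₂ (leibniz⟶π/4 p 0<p) k (ℕ.m≤n+m N 2))) p≤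
      0<l : 0# < l
      0<l = <-respʳ-≈ (solve 2 (λ x l → x :- (x :- l) := l) refl (leibniz k) l) (<⇒0<- close)

  infix 6 _+i_
  record ℂ : Set c where
    constructor _+i_
    field
      re im : ℝ

  open ℂ public

  infix  4 _≈ᶜ_
  infixl 6 _+ᶜ_
  infixl 7 _*ᶜ_

  _≈ᶜ_ : Rel ℂ ℓ₁
  z ≈ᶜ w = (re z ≈ re w) × (im z ≈ im w)

  _+ᶜ_ _*ᶜ_ : ℂ → ℂ → ℂ
  z +ᶜ w = (re z + re w) +i (im z + im w)
  z *ᶜ w = (re z * re w - im z * im w) +i (re z * im w + im z * re w)

  -ᶜ_ : ℂ → ℂ
  -ᶜ z = (- re z) +i (- im z)

  0ᶜ 1ᶜ 𝕚 : ℂ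
  0ᶜ = 0# +i 0#
  1ᶜ = 1# +i 0#
  𝕚  = 0# +i 1#

  ofℝ : ℝ → ℂ
  ofℝ x = x +i 0#

  -- |z|²
  normSq : ℂ → ℝ
  normSq z = re z * re z + im z * im z

  private abstract
    *ᶜ-assoc : ∀ z w v → (z *ᶜ w) *ᶜ v ≈ᶜ z *ᶜ (w *ᶜ v)
    *ᶜ-assoc (a +i b) (d +i e) (f +i g) =
      solve 6 (λ a b d e f g → (a :* d :- b :* e) :* f :- (a :* e :+ b :* d) :* g
                             := a :* (d :* f :- e :* g) :- b :* (d :* g :+ e :* f)) refl a b d e f g ,
      solve 6 (λ a b d e f g → (a :* d :- b :* e) :* g :+ (a :* e :+ b :* d) :* f
                             := a :* (d :* g :+ e :* f) :+ b :* (d :* f :- e :* g)) refl a b d e f g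

    *ᶜ-comm : ∀ z w → z *ᶜ w ≈ᶜ w *ᶜ z
    *ᶜ-comm (a +i b) (d +i e) =
      solve 4 (λ a b d e → a :* d :- b :* e := d :* a :- e :* b) refl a b d e ,
      solve 4 (λ a b d e → a :* e :+ b :* d := d :* b :+ e :* a) refl a b d e

    *ᶜ-identityˡ : ∀ z → 1ᶜ *ᶜ z ≈ᶜ z
    *ᶜ-identityˡ (a +i b) =
      trans (+-cong (*-identityˡ a) (trans (-‿cong (zeroˡ b)) RP.-0#≈0#)) (+-identityʳ a) ,
      trans (+-cong (*-identityˡ b) (zeroˡ a)) (+-identityʳ b)

    *ᶜ-distribˡ : ∀ z w v → z *ᶜ (w +ᶜ v) ≈ᶜ z *ᶜ w +ᶜ z *ᶜ v
    *ᶜ-distribˡ (a +i b) (d +i e) (f +i g) =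
      solve 6 (λ a b d e f g → a :* (d :+ f) :- b :* (e :+ g)
                             := (a :* d :- b :* e) :+ (a :* f :- b :* g)) refl a b d e f g ,
      solve 6 (λ a b d e f g → a :* (e :+ g) :+ b :* (d :+ f)
                             := (a :* e :+ b :* d) :+ (a :* g :+ b :* f)) refl a b d e f g

  ≈ᶜ-isEquivalence : IsEquivalence _≈ᶜ_
  ≈ᶜ-isEquivalence = record
    { refl  = refl , refl
    ; sym   = λ (p , q) → sym p , sym q
    ; trans = λ (p , q) (p′ , q′) → trans p p′ , trans q q′
    }

  private
    *ᶜ-cong : ∀ {z w u v} → z ≈ᶜ w → u ≈ᶜ v → z *ᶜ u ≈ᶜ w *ᶜ v
    *ᶜ-cong (p , q) (r , s) =
      +-cong (*-cong p r) (-‿cong (*-cong q s)) , +-cong (*-cong p s) (*-cong q r)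

    transᶜ = IsEquivalence.trans ≈ᶜ-isEquivalence

  ℂ-commutativeRing : CommutativeRing c ℓ₁
  ℂ-commutativeRing = record
    { Carrier = ℂ
    ; _≈_ = _≈ᶜ_
    ; _+_ = _+ᶜ_
    ; _*_ = _*ᶜ_
    ; -_  = -ᶜ_
    ; 0#  = 0ᶜ
    ; 1#  = 1ᶜ
    ; isCommutativeRing = record
      { isRing = record
        { +-isAbelianGroup = record
          { isGroup = record
            { isMonoid = record
              { isSemigroup = record
                { isMagma = record
                  { isEquivalence = ≈ᶜ-isEquivalence
                  ; ∙-cong = λ (p , q) (r , s) → +-cong p r , +-cong q s
                  }
                ; assoc = λ z w v → +-assoc _ _ _ , +-assoc _ _ _
                }
              ; identity = (λ z → +-identityˡ _ , +-identityˡ _) , (λ z → +-identityʳ _ , +-identityʳ _)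
              }
            ; inverse = (λ z → -‿inverseˡ _ , -‿inverseˡ _) , (λ z → -‿inverseʳ _ , -‿inverseʳ _)
            ; ⁻¹-cong = λ (p , q) → -‿cong p , -‿cong q
            }
          ; comm = λ z w → +-comm _ _ , +-comm _ _
          }
        ; *-cong     = *ᶜ-cong
        ; *-assoc    = *ᶜ-assoc
        ; *-identity = *ᶜ-identityˡ , λ z → transᶜ (*ᶜ-comm z 1ᶜ) (*ᶜ-identityˡ z)
        ; distrib    = *ᶜ-distribˡ , λ z w v → transᶜ (*ᶜ-comm (w +ᶜ v) z) (transᶜ (*ᶜ-distribˡ z w v)
                         (+-cong (proj₁ (*ᶜ-comm z w)) (proj₁ (*ᶜ-comm z v)) , +-cong (proj₂ (*ᶜ-comm z w)) (proj₂ (*ᶜ-comm z v))))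
        }
      ; *-comm = *ᶜ-comm
      }
    }

  private module C = CommutativeRing ℂ-commutativeRing

  open C public using () renaming (_-_ to _-ᶜ_)
  open Algebra.Definitions.RawSemiring (RawRing.rawSemiring C.rawRing) public
    using () renaming (sum to ∑ᶜ; product to ∏ᶜ; _^_ to _^ᶜ_; _×_ to _·ᶜ_)
  open Algebra.Definitions _≈ᶜ_ using (Invertible)

  Unit : ℂ → Set (c ⊔ ℓ₁)
  Unit = Invertible 1ᶜ _*ᶜ_

  _⁻¹[_] : (z : ℂ) → Unit z → ℂ
  z ⁻¹[ u ] = proj₁ u

  infixl 7 _/_[_]
  _/_[_] : ℂ → (w : ℂ) → Unit w → ℂ
  z / w [ u ] = z *ᶜ w ⁻¹[ u ]

  2π𝕚 : ℂ
  2π𝕚 = ofℝ (ofℕ 2 * π) *ᶜ 𝕚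

  abstract
    normSq-cong : ∀ {z w} → z ≈ᶜ w → normSq z ≈ normSq w
    normSq-cong (p , q) = +-cong (*-cong p p) (*-cong q q)

    normSq-* : ∀ z w → normSq (z *ᶜ w) ≈ normSq z * normSq w
    normSq-* (a +i b) (d +i e) = solve 4 (λ a b d e →
      (a :* d :- b :* e) :* (a :* d :- b :* e) :+ (a :* e :+ b :* d) :* (a :* e :+ b :* d)
        := (a :* a :+ b :* b) :* (d :* d :+ e :* e)) refl a b d e

    normSq-ofℝ : ∀ x → normSq (ofℝ x) ≈ x * x
    normSq-ofℝ x = trans (+-congˡ (zeroˡ 0#)) (+-identityʳ _)

    normSq-1 : normSq 1ᶜ ≈ 1#
    normSq-1 = trans (normSq-ofℝ 1#) (*-identityˡ 1#)

    normSq-𝕚^ : ∀ m → normSq (𝕚 ^ᶜ m) ≈ 1#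
    normSq-𝕚^ zero    = normSq-1
    normSq-𝕚^ (suc m) = trans (normSq-* 𝕚 (𝕚 ^ᶜ m))
      (trans (*-cong (trans (+-cong (zeroˡ 0#) (*-identityˡ 1#)) (+-identityˡ 1#)) (normSq-𝕚^ m)) (*-identityˡ 1#))

    0<normSq⇒Unit : ∀ z → 0# < normSq z → Unit z
    0<normSq⇒Unit (a +i b) 0<N = u , transᶜ (*ᶜ-comm u (a +i b)) zu≈1 , zu≈1
      where
      N r : ℝ
      N = a * a + b * b
      r = inv N (#-sym (<⇒# 0<N))
      Nr≈1 : N * r ≈ 1#
      Nr≈1 = inv-inverseʳ N (#-sym (<⇒# 0<N))
      u : ℂ
      u = (a * r) +i (- b * r)
      zu≈1 : (a +i b) *ᶜ u ≈ᶜ 1ᶜ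
      zu≈1 = trans (solve 3 (λ a b r → a :* (a :* r) :- b :* (:- b :* r) := (a :* a :+ b :* b) :* r) refl a b r) Nr≈1
           , solve 3 (λ a b r → a :* (:- b :* r) :+ b :* (a :* r) := :0) refl a b r

    Unit-1 : Unit 1ᶜ
    Unit-1 = 1ᶜ , *ᶜ-identityˡ 1ᶜ , *ᶜ-identityˡ 1ᶜ

    Unit-* : ∀ {z w} → Unit z → Unit w → Unit (z *ᶜ w)
    Unit-* {z} {w} (z′ , _ , zz′≈1) (w′ , _ , ww′≈1) =
      z′ *ᶜ w′ , transᶜ (*ᶜ-comm (z′ *ᶜ w′) (z *ᶜ w)) e , e
      where
      open CS C.*-commutativeSemigroup using (interchange)
      e : (z *ᶜ w) *ᶜ (z′ *ᶜ w′) ≈ᶜ 1ᶜ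
      e = transᶜ (interchange z w z′ w′) (transᶜ (*ᶜ-cong zz′≈1 ww′≈1) (*ᶜ-identityˡ 1ᶜ))

    Unit-^ : ∀ {z} m → Unit z → Unit (z ^ᶜ m)
    Unit-^ zero    u = Unit-1
    Unit-^ (suc m) u = Unit-* u (Unit-^ m u)

    Unit-∏ : ∀ {z : Vector ℂ n} → (∀ k → Unit (z k)) → Unit (∏ᶜ z)
    Unit-∏ {n = zero}  u = Unit-1
    Unit-∏ {n = suc n} u = Unit-* (u zero) (Unit-∏ (u ∘ suc))

    Unit-2π𝕚 : Unit 2π𝕚
    Unit-2π𝕚 = Unit-* (0<normSq⇒Unit _ (<-respʳ-≈ (sym (normSq-ofℝ _)) (*-pos 0<2π 0<2π)))
                      (0<normSq⇒Unit 𝕚 (+-pos′ (sq-nonneg 0#)))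
      where
      0<2π : 0# < ofℕ 2 * π
      0<2π = *-pos (0<ofℕ-suc 1) 0<π
      +-pos′ : 0# ≤ 0# * 0# → 0# < 0# * 0# + 1# * 1#
      +-pos′ p = <-respʳ-≈ (+-comm _ _) (+-pos (*-pos 0<1 0<1) p)

    Unit-1+si : ∀ s → Unit (1# +i s)
    Unit-1+si s = 0<normSq⇒Unit _ (+-pos (*-pos 0<1 0<1) (sq-nonneg s))

  -- The circle |z| = ε
  Circle : ℝ → Set (c ⊔ ℓ₁)
  Circle ε = Σ[ z ∈ ℂ ] normSq z ≈ ε * ε

  pt : ∀ {ε} → Circle ε → ℂ
  pt = proj₁

  abstract
    Unit-circle : ∀ {ε} → 0# < ε → (z : Circle ε) → Unit (pt z)
    Unit-circle 0<ε (z , e) = 0<normSq⇒Unit z (<-respʳ-≈ (sym e) (*-pos 0<ε 0<ε))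

    sq-mono-< : ∀ {x y} → 0# < x → x < y → x * x < y * y
    sq-mono-< {x} {y} 0<x x<y = <-trans (*-monoʳ-< 0<x x<y)
      (<-respˡ-≈ (*-comm x y) (*-monoʳ-< (<-trans 0<x x<y) x<y))

    sq-# : ∀ {x y} → 0# < x → 0# < y → x # y → x * x # y * y
    sq-# 0<x 0<y x#y = [ (λ x<y → <⇒# (sq-mono-< 0<x x<y)) , (λ y<x → #-sym (<⇒# (sq-mono-< 0<y y<x))) ]′ (#⇒<⊎> x#y)

    #⇒-#0 : ∀ {x y} → x # y → x - y # 0#
    #⇒-#0 {x} {y} x#y = AP.invertibleʳ⇒# (proj₁ (#⇒invertible x#y) ,
      trans (*-congʳ (AP.x-0≈x (x - y))) (proj₂ (proj₂ (#⇒invertible x#y))))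

    normSq-#⇒ : ∀ z w → normSq z # normSq w → 0# < normSq (z -ᶜ w)
    normSq-#⇒ (a +i b) (d +i e) N#M =
      [ (λ p → +-pos (#⇒sq-pos (#-factorˡ p)) (sq-nonneg (b - e)))
      , (λ q → <-respʳ-≈ (+-comm _ _) (+-pos (#⇒sq-pos (#-factorˡ q)) (sq-nonneg (a - d)))) ]′
      (+-#⇒ (AP.#-congʳ
        (solve 4 (λ a b d e → (a :* a :+ b :* b) :- (d :* d :+ e :* e)
                           := (a :- d) :* (a :+ d) :+ (b :- e) :* (b :+ e)) refl a b d e)
        (#⇒-#0 N#M)))

    Unit-difference : ∀ {ε η} → 0# < ε → 0# < η → ε # η →
                      (z : Circle ε) (w : Circle η) → Unit (pt z -ᶜ pt w)
    Unit-difference 0<ε 0<η ε#η (z , p) (w , q) = 0<normSq⇒Unit (z -ᶜ w)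
      (normSq-#⇒ z w (AP.#-congʳ (sym p) (AP.#-congˡ (sym q) (sq-# 0<ε 0<η ε#η))))

  -- The Cayley transform (1 + si)/(1 − si) = e^(2i·arctan s) runs
  -- counterclockwise through the unit circle from 1 to i as s goes from 0 to 1.
  cayley : ℝ → ℂ
  cayley s = (1# +i s) / (1# +i (- s)) [ Unit-1+si (- s) ]

  abstract
    normSq-cayley : ∀ s → normSq (cayley s) ≈ 1#
    normSq-cayley s = trans (normSq-* (1# +i s) u) (trans (*-congʳ (+-congˡ (solve 1 (λ s → s :* s := (:- s) :* (:- s)) refl s)))
      (trans (sym (normSq-* (1# +i (- s)) u)) (trans (normSq-cong (proj₂ (proj₂ (Unit-1+si (- s))))) normSq-1)))
      where
      u : ℂ
      u = proj₁ (Unit-1+si (- s))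

    normSq-arc : ∀ ε m s → normSq (ofℝ ε *ᶜ 𝕚 ^ᶜ m *ᶜ cayley s) ≈ ε * ε
    normSq-arc ε m s = trans (normSq-* _ _) (trans (*-cong (normSq-* _ _) (normSq-cayley s)) (trans (*-identityʳ _)
      (trans (*-cong (normSq-ofℝ ε) (normSq-𝕚^ m)) (*-identityʳ _))))

  -- Quarter q of the circle |z| = ε, from ε·i^q to ε·i^(q+1); the four
  -- quarters together traverse the circle once counterclockwise.
  arc : ∀ ε → Fin 4 → ℝ → Circle ε
  arc ε q s = ofℝ ε *ᶜ 𝕚 ^ᶜ toℕ q *ᶜ cayley s , normSq-arc ε (toℕ q) s

  -- Tagged partitions of [0, 1]; 0 = x₀ ≤ t₀ ≤ x₁ ≤ ⋯ ≤ x_size = 1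
  record Partition : Set (c ⊔ ℓ₁ ⊔ ℓ₂) where
    field
      size       : ℕ
      node       : Vector ℝ (suc size)
      tag        : Vector ℝ size
      node-first : node zero ≈ 0#
      node-last  : node (fromℕ size) ≈ 1#
      node≤tag   : ∀ k → node (inject₁ k) ≤ tag k
      tag≤node   : ∀ k → tag k ≤ node (suc k)

    MeshBelow : ℝ → Set ℓ₂
    MeshBelow η = ∀ k → node (suc k) - node (inject₁ k) < η

  -- ∫_γ f(z) dz for a path γ with parameter interval [0, 1], as the limit of
  -- the Riemann–Stieltjes sums ∑ₖ f(γ(tₖ)) (γ(xₖ₊₁) − γ(xₖ)).
  module _ {ε : ℝ} (γ : ℝ → Circle ε) (f : Circle ε → ℂ) where

    stieltjesSum : Partition → ℂ
    stieltjesSum P = ∑ᶜ λ k → f (γ (tag k)) *ᶜ (pt (γ (node (suc k))) -ᶜ pt (γ (node (inject₁ k))))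
      where open Partition P

    IsPathIntegral : ℂ → Set (c ⊔ ℓ₁ ⊔ ℓ₂)
    IsPathIntegral J = ∀ δ → 0# < δ → ∃[ η ] 0# < η ×
      (∀ P → Partition.MeshBelow P η → normSq (stieltjesSum P -ᶜ J) < δ * δ)

  -- I = ∫_{|z| = ε} f(z) dz
  IsCircleIntegral : (ε : ℝ) → (Circle ε → ℂ) → ℂ → Set (c ⊔ ℓ₁ ⊔ ℓ₂)
  IsCircleIntegral ε f I = Σ[ J ∈ Vector ℂ 4 ] (∀ q → IsPathIntegral (arc ε q) f (J q)) × I ≈ᶜ ∑ᶜ J

  Torus : Vector ℝ n → Set (c ⊔ ℓ₁)
  Torus ε = ∀ k → Circle (ε k)

  infixr 5 _∷ᵗ_
  _∷ᵗ_ : {ε : Vector ℝ (suc n)} → Circle (ε zero) → Torus (tail ε) → Torus ε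
  (z ∷ᵗ w) zero    = z
  (z ∷ᵗ w) (suc k) = w k

  -- I = ∫_{|z₁| = ε₁} ⋯ ∫_{|zₙ| = εₙ} F(z₁, …, zₙ) dzₙ ⋯ dz₁, as an iterated
  -- integral with zₙ innermost.
  IsIteratedIntegral : (ε : Vector ℝ n) → (Torus ε → ℂ) → ℂ → Set (c ⊔ ℓ₁ ⊔ ℓ₂)
  IsIteratedIntegral {zero}  ε F I = Lift (c ⊔ ℓ₂) (I ≈ᶜ F (λ ()))
  IsIteratedIntegral {suc n} ε F I = Σ[ G ∈ (Circle (ε zero) → ℂ) ]
    (∀ z → IsIteratedIntegral (tail ε) (λ w → F (z ∷ᵗ w)) (G z)) × IsCircleIntegral (ε zero) G I

  module Integrand (t : ℕ) (ε : Vector ℝ n) (0<ε : ∀ k → 0# < ε k)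
                   (ε-distinct : ∀ j k → j ≢ k → ε j # ε k) (z : Torus ε) where

    factor : Fin n → Fin n → ℂ
    factor k j = if does (j Fin.≟ k) then 1ᶜ else pt (z k) -ᶜ pt (z j)

    -- ∏_{j ≠ k} (z_k − z_j)
    denominator : Fin n → ℂ
    denominator k = ∏ᶜ (factor k)

    abstract
      Unit-factor : ∀ k j → Unit (factor k j)
      Unit-factor k j with j Fin.≟ k
      ... | yes _  = Unit-1
      ... | no j≢k = Unit-difference (0<ε k) (0<ε j) (ε-distinct k j (j≢k ∘ ≡.sym)) (z k) (z j)

      Unit-denominator : ∀ k → Unit (denominator k)
      Unit-denominator k = Unit-∏ (Unit-factor k)

      Unit-monomial : Unit (∏ᶜ (pt ∘ z) ^ᶜ (t ℕ.+ 1))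
      Unit-monomial = Unit-^ (t ℕ.+ 1) (Unit-∏ (λ k → Unit-circle (0<ε k) (z k)))

    integrand : ℂ
    integrand =
      (∏ᶜ (pt ∘ z) ^ᶜ (t ℕ.+ 1)) ⁻¹[ Unit-monomial ] *ᶜ
      (∑ᶜ λ k → pt (z k) ^ᶜ (t ℕ.+ n ℕ.∸ 1) / denominator k [ Unit-denominator k ]) ^ᶜ n

  open Integrand public using (integrand)

  Matrix : ∀ {a} → Set a → ℕ → Set a
  Matrix A n = Fin n → Fin n → A

  Birkhoff : ∀ n → Matrix ℝ n → Set (ℓ₁ ⊔ ℓ₂)
  Birkhoff n x = (∀ j k → 0# ≤ x j k)
               × (∀ j → ∑ (λ k → x j k) ≈ 1#)
               × (∀ k → ∑ (λ j → x j k) ≈ 1#)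

  -- The dilate rP = { r·y ∣ y ∈ P }
  Dilate : ∀ {p} → ℝ → (Matrix ℝ n → Set p) → Matrix ℝ n → Set (c ⊔ ℓ₁ ⊔ p)
  Dilate r P x = Σ[ y ∈ _ ] P y × (∀ j k → x j k ≈ r * y j k)

  -- P ∩ ℤ^{n×n}
  latticePoints : ∀ {p} → (Matrix ℝ n → Set p) → Setoid p 0ℓ
  latticePoints P = record
    { Carrier = Σ[ M ∈ Matrix ℤ _ ] P (λ j k → ofℤ (M j k))
    ; _≈_ = λ (M , _) (M′ , _) → ∀ j k → M j k ≡ M′ j k
    ; isEquivalence = record
      { refl  = λ j k → ≡.refl
      ; sym   = λ e j k → ≡.sym (e j k)
      ; trans = λ e e′ j k → ≡.trans (e j k) (e′ j k)
      }
    }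

  -- H = H_n(t) = #(tB_n ∩ ℤ^{n×n})
  IsEhrhartCount : (n t : ℕ) → ℕ → Set (c ⊔ ℓ₁ ⊔ ℓ₂)
  IsEhrhartCount n t H = Inverse (latticePoints (Dilate (ofℕ t) (Birkhoff n))) (≡.setoid (Fin H))

{-# OPTIONS --safe #-}
module Submission where

-- The sum over k is the Lagrange form of the divided difference of
-- x^(t+n−1) at z₁, …, zₙ, which is the complete homogeneous symmetric polynomial
-- h_t; so the integrand is a Laurent polynomial, and expanding h_t^n over the
-- n-tuples of exponent vectors (the rows of a matrix) gives one monomial
-- ∏ z_k^(s_k − t − 1) for each matrix with row sums t and column sums s_k.
-- Integrating one variable at a time leaves 2πi per variable when s_k = t and 0
-- otherwise.  Powers other than z⁻¹ have primitives.  On a quarter circle the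
-- Cayley parameter turns dz/z into 2i ds/(1 + s²), and the partial sums of the
-- arctangent series serve as approximate primitives; their values at 1 are the
-- partial sums of the Leibniz series for π/4.

open import Defs
open import Algebra.Bundles using (CommutativeRing; CommutativeSemiring)
import Algebra.Definitions.RawSemiring
import Algebra.Properties.CommutativeMonoid.Sum
import Algebra.Properties.CommutativeSemigroup
import Algebra.Properties.CommutativeSemiring.Exp
import Algebra.Properties.Monoid.Mult
import Algebra.Properties.Ring
import Algebra.Properties.Semiring.Exp
import Algebra.Properties.Semiring.Sum
import Algebra.Solver.Ring
open import Algebra.Solver.Ring.AlmostCommutativeRing
  using (AlmostCommutativeRing; fromCommutativeRing; _-Raw-AlmostCommutative⟶_)
open import Data.Bool.Base using (if_then_else_)
open import Data.Empty using (⊥-elim)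
open import Data.Fin.Base using (Fin; zero; suc; toℕ; inject₁; fromℕ)
import Data.Fin.Properties as Fin
open import Data.Integer.Base as ℤ using (ℤ; +_; -[1+_])
import Data.Integer.Properties as ℤ
open import Data.List.Base as List using (List; []; _∷_; _++_; map; cartesianProductWith; length; filter)
open import Data.List.Membership.Propositional using (_∈_)
open import Data.List.Membership.Propositional.Properties
  using (∈-map⁺; ∈-map⁻; ∈-++⁺ˡ; ∈-++⁺ʳ; ∈-++⁻; ∈-cartesianProductWith⁺; ∈-cartesianProductWith⁻; ∈-lookup; ∈-filter⁺; ∈-filter⁻)
open import Data.List.Membership.Propositional.Properties.WithK using (unique⇒irrelevant)
open import Data.List.Relation.Unary.AllPairs using ([]; _∷_)
open import Data.List.Relation.Unary.All using ([])
open import Data.List.Relation.Unary.Any using (here; index)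
open import Data.List.Relation.Unary.Any.Properties using (lookup-index)
open import Data.List.Relation.Unary.Unique.Propositional using (Unique)
import Data.List.Relation.Unary.Unique.Propositional.Properties as Unique
open import Data.Maybe.Base as Maybe using (Maybe)
open import Data.Nat.Base as ℕ using (ℕ; zero; suc; NonZero)
import Data.Nat.Properties as ℕ
open import Data.Product.Base using (Σ-syntax; ∃-syntax; _×_; _,_; proj₁; proj₂)
open import Data.Sum.Base using (inj₁; inj₂; [_,_]′)
open import Data.Vec.Base as Vec using (Vec; []; _∷_)
open import Data.Vec.Functional using (Vector; tail)
import Data.Vec.Properties as Vec
open import Data.Vec.Relation.Unary.All as VecAll using ([]; _∷_)
import Data.Vec.Relation.Unary.All.Properties as VecAll
open import Function.Base using (_∘_)
open import Level using (_⊔_; lift)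
open import Relation.Binary.Consequences using (dec⇒weaklyDec)
open import Relation.Binary.Definitions using (Tri; tri<; tri≈; tri>)
open import Relation.Binary.PropositionalEquality as ≡ using (_≡_; _≢_)
import Relation.Binary.Reasoning.Setoid
open import Relation.Binary.Structures using (IsStrictPartialOrder)
open import Relation.Nullary.Decidable using (Dec; does; yes; no; dec-true; dec-false)
open import Relation.Nullary.Negation.Core using (¬_)

-- Riemann-Stieltjes sums with free tags are compared with a primitive on one tagged interval [x, y]
-- at a time: an error of order (y - x)² is harmless there, because such errors sum to a multiple of
-- the mesh. No derivative is formed; congruence up to O(y - x) (`_≋_`) takes its place. The
-- obstacle is dz/z. At s = 1, where π/4 has to appear, the geometric series for 1/(1 + s²) does not
-- converge, and its remainder, of size s^(2m)/(1 + s²), is not uniformly small on [0, 1]. It is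
-- small in the mean, since s^(2m) has integral 1/(2m + 1). Hence an approximate primitive carries a
-- second, real function whose increments pay for errors that are not quadratic. Order on the reals
-- is not decidable and inverses need witnesses, so the divided differences never divide: the
-- reciprocals for fewer nodes are products of the given ones with differences of nodes.

-- Exponent vectors of a given total degree

module Compositions where

  raise : ∀ {n} → Vec ℕ (suc n) → Vec ℕ (suc n)
  raise (i ∷ a) = suc i ∷ a

  -- The recursion lowers the first entry by one or fixes it at 0, instead of ranging over its
  -- values, so that sums over this list obey the recurrence h_(t+1)(z) = z₀ h_t(z) + h_(t+1)(tail
  -- z) directly.
  compositions : ∀ n → ℕ → List (Vec ℕ n)
  compositions zero    zero    = [] ∷ []
  compositions zero    (suc t) = []
  compositions (suc n) zero    = map (0 ∷_) (compositions n 0)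
  compositions (suc n) (suc t) = map raise (compositions (suc n) t) ++ map (0 ∷_) (compositions n (suc t))

  ∈-compositions⁺ : ∀ {n} (a : Vec ℕ n) → a ∈ compositions n (Vec.sum a)
  ∈-compositions⁺ []      = here ≡.refl
  ∈-compositions⁺ {suc n} (i ∷ a) = go i
    where
    go : ∀ i → (i ∷ a) ∈ compositions (suc n) (i ℕ.+ Vec.sum a)
    -- `compositions` reduces only once its total is known to be zero or a successor.
    go zero with Vec.sum a | ∈-compositions⁺ a
    ... | zero  | a∈ = ∈-map⁺ (0 ∷_) a∈
    ... | suc t | a∈ = ∈-++⁺ʳ _ (∈-map⁺ (0 ∷_) a∈)
    go (suc i) = ∈-++⁺ˡ (∈-map⁺ raise (go i))

  ∈-compositions⁻ : ∀ n t {a : Vec ℕ n} → a ∈ compositions n t → Vec.sum a ≡ t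
  ∈-compositions⁻ zero zero (here ≡.refl) = ≡.refl
  ∈-compositions⁻ (suc n) zero a∈ with ∈-map⁻ (0 ∷_) a∈
  ... | _ , b∈ , ≡.refl = ∈-compositions⁻ n 0 b∈
  ∈-compositions⁻ (suc n) (suc t) a∈ with ∈-++⁻ (map raise (compositions (suc n) t)) a∈
  ... | inj₁ p with ∈-map⁻ raise p
  ...   | (_ ∷ _) , b∈ , ≡.refl = ≡.cong suc (∈-compositions⁻ (suc n) t b∈)
  ∈-compositions⁻ (suc n) (suc t) a∈ | inj₂ p with ∈-map⁻ (0 ∷_) p
  ...   | _ , b∈ , ≡.refl = ∈-compositions⁻ n (suc t) b∈

  raise-injective : ∀ {n} {a b : Vec ℕ (suc n)} → raise a ≡ raise b → a ≡ b
  raise-injective {a = _ ∷ _} {_ ∷ _} ≡.refl = ≡.refl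

  compositions-unique : ∀ n t → Unique (compositions n t)
  compositions-unique zero    zero    = [] ∷ []
  compositions-unique zero    (suc t) = []
  compositions-unique (suc n) zero    = Unique.map⁺ Vec.∷-injectiveʳ (compositions-unique n 0)
  compositions-unique (suc n) (suc t) = Unique.++⁺
    (Unique.map⁺ raise-injective (compositions-unique (suc n) t))
    (Unique.map⁺ Vec.∷-injectiveʳ (compositions-unique n (suc t)))
    λ (p , q) → disjoint p q
    where
    disjoint : ∀ {a} → a ∈ map raise (compositions (suc n) t) → a ∈ map (0 ∷_) (compositions n (suc t)) → _
    disjoint p q with ∈-map⁻ raise p | ∈-map⁻ (0 ∷_) q
    ... | (_ ∷ _) , _ , ≡.refl | _ , _ , ()

-- Tuples over a list, positions in a list, column sums

module _ {a} {A : Set a} where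

  sequences : List A → ∀ m → List (Vec A m)
  sequences xs zero    = [] ∷ []
  sequences xs (suc m) = cartesianProductWith _∷_ xs (sequences xs m)

  ∈-sequences⁺ : ∀ {xs m} {v : Vec A m} → VecAll.All (_∈ xs) v → v ∈ sequences xs m
  ∈-sequences⁺ []       = here ≡.refl
  ∈-sequences⁺ (p ∷ ps) = ∈-cartesianProductWith⁺ _∷_ p (∈-sequences⁺ ps)

  ∈-sequences⁻ : ∀ {xs} m {v : Vec A m} → v ∈ sequences xs m → VecAll.All (_∈ xs) v
  ∈-sequences⁻ zero (here ≡.refl) = []
  ∈-sequences⁻ {xs} (suc m) v∈ with ∈-cartesianProductWith⁻ _∷_ xs (sequences xs m) v∈
  ... | _ , _ , p , q , ≡.refl = p ∷ ∈-sequences⁻ m q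

  sequences-unique : ∀ {xs} → Unique xs → ∀ m → Unique (sequences xs m)
  sequences-unique xs! zero    = [] ∷ []
  sequences-unique xs! (suc m) =
    Unique.cartesianProductWith⁺ _∷_ Vec.∷-injective xs! (sequences-unique xs! m)

  -- In a list without repetitions an element has a single membership proof, so its position does
  -- not depend on how membership was shown.
  index-unique : ∀ {xs : List A} → Unique xs → ∀ {x y} (p : x ∈ xs) (q : y ∈ xs) → x ≡ y → index p ≡ index q
  index-unique xs! p q ≡.refl = ≡.cong index (unique⇒irrelevant xs! p q)

  index-∈-lookup : ∀ (xs : List A) i → index (∈-lookup {xs = xs} i) ≡ i
  index-∈-lookup (x ∷ xs) zero    = ≡.refl
  index-∈-lookup (x ∷ xs) (suc i) = ≡.cong suc (index-∈-lookup xs i)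

-- The rows are exponent vectors, and multiplying their monomials adds them; hence a fold over the
-- rows rather than one sum for each column.
columnSums : ∀ {m n} → Vec (Vec ℕ n) m → Vec ℕ n
columnSums []      = Vec.replicate _ 0
columnSums (a ∷ A) = Vec.zipWith ℕ._+_ a (columnSums A)

lookup-columnSums : ∀ {m n} (A : Vec (Vec ℕ n) m) k →
                    Vec.lookup (columnSums A) k ≡ Vec.sum (Vec.tabulate λ j → Vec.lookup (Vec.lookup A j) k)
lookup-columnSums []      k = Vec.lookup-replicate k 0
lookup-columnSums (a ∷ A) k = ≡.trans (Vec.lookup-zipWith ℕ._+_ k a (columnSums A))
  (≡.cong (Vec.lookup a k ℕ.+_) (lookup-columnSums A k))

lookup-injective : ∀ {a} {A : Set a} {n} {u v : Vec A n} → (∀ k → Vec.lookup u k ≡ Vec.lookup v k) → u ≡ v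
lookup-injective {u = u} {v} e = ≡.trans (≡.sym (Vec.tabulate∘lookup u)) (≡.trans (Vec.tabulate-cong e) (Vec.tabulate∘lookup v))

-- Enumeration of the matrices over ℕ with all line sums t

module MagicMatrices (n t : ℕ) where

  open Compositions

  IsMagic : (Fin n → Fin n → ℕ) → Set
  IsMagic N = (∀ j → Vec.sum (Vec.tabulate (N j)) ≡ t) × (∀ k → Vec.sum (Vec.tabulate λ j → N j k) ≡ t)

  -- Row sums hold by construction and column sums are filtered afterwards: the terms of h_t^n are
  -- indexed by this list, and integration keeps those in `magicMatrices`.
  rowChoices : List (Vec (Vec ℕ n) n)
  rowChoices = sequences (compositions n t) n

  hasColumnSums? : (A : Vec (Vec ℕ n) n) → Dec (columnSums A ≡ Vec.replicate n t)
  hasColumnSums? A = Vec.≡-dec ℕ._≟_ (columnSums A) (Vec.replicate n t)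

  magicMatrices : List (Vec (Vec ℕ n) n)
  magicMatrices = filter hasColumnSums? rowChoices

  magicMatrices-unique : Unique magicMatrices
  magicMatrices-unique = Unique.filter⁺ hasColumnSums? (sequences-unique (compositions-unique n t) n)

  -- List membership is up to `≡`, which pointwise equal functions need not satisfy; tabulated
  -- matrices do.
  pack : (Fin n → Fin n → ℕ) → Vec (Vec ℕ n) n
  pack N = Vec.tabulate (λ j → Vec.tabulate (N j))

  unpack : Vec (Vec ℕ n) n → Fin n → Fin n → ℕ
  unpack A j = Vec.lookup (Vec.lookup A j)

  unpack-pack : ∀ N j k → unpack (pack N) j k ≡ N j k
  unpack-pack N j k = ≡.trans (≡.cong (λ r → Vec.lookup r k) (Vec.lookup∘tabulate _ j)) (Vec.lookup∘tabulate (N j) k)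

  pack-cong : ∀ {N N′} → (∀ j k → N j k ≡ N′ j k) → pack N ≡ pack N′
  pack-cong e = Vec.tabulate-cong λ j → Vec.tabulate-cong (e j)

  pack-unpack : ∀ A → pack (unpack A) ≡ A
  pack-unpack A = lookup-injective λ j → ≡.trans (Vec.lookup∘tabulate _ j) (Vec.tabulate∘lookup (Vec.lookup A j))

  pack∈ : ∀ N → IsMagic N → pack N ∈ magicMatrices
  pack∈ N (rows , cols) = ∈-filter⁺ hasColumnSums? (∈-sequences⁺ (VecAll.tabulate⁺ λ j →
      ≡.subst (λ s → Vec.tabulate (N j) ∈ compositions n s) (rows j) (∈-compositions⁺ _)))
    (lookup-injective λ k → ≡.trans (lookup-columnSums (pack N) k) (≡.trans
      (≡.cong Vec.sum (Vec.tabulate-cong λ j → unpack-pack N j k)) (≡.trans (cols k) (≡.sym (Vec.lookup-replicate k t)))))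

  ∈⇒magic : ∀ {A} → A ∈ magicMatrices → IsMagic (unpack A)
  ∈⇒magic {A} A∈ with ∈-filter⁻ hasColumnSums? A∈
  ... | A∈rows , e =
    (λ j → ≡.trans (≡.cong Vec.sum (Vec.tabulate∘lookup (Vec.lookup A j)))
             (∈-compositions⁻ n t (VecAll.lookup⁺ (∈-sequences⁻ n A∈rows) j))) ,
    (λ k → ≡.trans (≡.sym (lookup-columnSums A k)) (≡.trans (≡.cong (λ v → Vec.lookup v k) e) (Vec.lookup-replicate k t)))

  encode : ∀ N → IsMagic N → Fin (length magicMatrices)
  encode N m = index (pack∈ N m)

  decode : Fin (length magicMatrices) → Fin n → Fin n → ℕ
  decode i = unpack (List.lookup magicMatrices i)

  decode-magic : ∀ i → IsMagic (decode i)
  decode-magic i = ∈⇒magic (∈-lookup i)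

  encode-cong : ∀ {N N′} (m : IsMagic N) (m′ : IsMagic N′) → (∀ j k → N j k ≡ N′ j k) → encode N m ≡ encode N′ m′
  encode-cong m m′ e = index-unique magicMatrices-unique (pack∈ _ m) (pack∈ _ m′) (pack-cong e)

  decode-encode : ∀ N m j k → decode (encode N m) j k ≡ N j k
  decode-encode N m j k = ≡.trans (≡.cong (λ A → unpack A j k) (≡.sym (lookup-index (pack∈ N m)))) (unpack-pack N j k)

  encode-decode : ∀ i m → encode (decode i) m ≡ i
  encode-decode i m = ≡.trans
    (index-unique magicMatrices-unique (pack∈ (decode i) m) (∈-lookup i) (pack-unpack _))
    (index-∈-lookup magicMatrices i)

-- Finite sums over lists

module ListSum {r ℓ} (R : CommutativeSemiring r ℓ) where

  open CommutativeSemiring R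

  module _ {x} {X : Set x} where

    ∑ₗ : (X → Carrier) → List X → Carrier
    ∑ₗ f []       = 0#
    ∑ₗ f (x ∷ xs) = f x + ∑ₗ f xs

    ∑ₗ-cong : ∀ {f g} → (∀ x → f x ≈ g x) → ∀ xs → ∑ₗ f xs ≈ ∑ₗ g xs
    ∑ₗ-cong e []       = refl
    ∑ₗ-cong e (x ∷ xs) = +-cong (e x) (∑ₗ-cong e xs)

    ∑ₗ-++ : ∀ f xs ys → ∑ₗ f (xs ++ ys) ≈ ∑ₗ f xs + ∑ₗ f ys
    ∑ₗ-++ f []       ys = sym (+-identityˡ _)
    ∑ₗ-++ f (x ∷ xs) ys = trans (+-congˡ (∑ₗ-++ f xs ys)) (sym (+-assoc _ _ _))

    *-distribˡ-∑ₗ : ∀ c f xs → c * ∑ₗ f xs ≈ ∑ₗ (λ x → c * f x) xs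
    *-distribˡ-∑ₗ c f []       = zeroʳ c
    *-distribˡ-∑ₗ c f (x ∷ xs) = trans (distribˡ _ _ _) (+-congˡ (*-distribˡ-∑ₗ c f xs))

  ∑ₗ-map : ∀ {x y} {X : Set x} {Y : Set y} (f : Y → Carrier) (g : X → Y) xs → ∑ₗ f (map g xs) ≈ ∑ₗ (f ∘ g) xs
  ∑ₗ-map f g []       = refl
  ∑ₗ-map f g (x ∷ xs) = +-congˡ (∑ₗ-map f g xs)

  ∑ₗ-product : ∀ {x y z} {X : Set x} {Y : Set y} {Z : Set z} (_•_ : X → Y → Z) {f g h} →
    (∀ x y → h (x • y) ≈ f x * g y) → ∀ xs ys → ∑ₗ h (cartesianProductWith _•_ xs ys) ≈ ∑ₗ f xs * ∑ₗ g ys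
  ∑ₗ-product _•_ e [] ys = sym (zeroˡ _)
  ∑ₗ-product _•_ {f} {g} {h} e (x ∷ xs) ys = trans (∑ₗ-++ h (map (x •_) ys) _)
    (trans (+-cong (trans (∑ₗ-map h (x •_) ys) (trans (∑ₗ-cong (e x) ys) (sym (*-distribˡ-∑ₗ (f x) g ys)))) (∑ₗ-product _•_ e xs ys))
      (sym (distribʳ _ _ _)))

-- Complete homogeneous symmetric polynomials

module CompleteHomogeneous {r ℓ} (R : CommutativeSemiring r ℓ) where

  open CommutativeSemiring R hiding (zero)
  open Algebra.Definitions.RawSemiring rawSemiring using (product; _^_)
  open ListSum R
  open Compositions

  private
    module E = Algebra.Properties.Semiring.Exp semiring
    open Algebra.Properties.CommutativeSemigroup *-commutativeSemigroup using (interchange)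
    open Relation.Binary.Reasoning.Setoid setoid

  power-product : ∀ {n} → Vector Carrier n → Vec ℕ n → Carrier
  power-product z a = product (λ k → z k ^ Vec.lookup a k)

  power-product-0 : ∀ {n} (z : Vector Carrier n) → power-product z (Vec.replicate n 0) ≈ 1#
  power-product-0 {zero}  z = refl
  power-product-0 {suc n} z = trans (*-identityˡ _) (power-product-0 (tail z))

  power-product-+ : ∀ {n} (z : Vector Carrier n) a b →
    power-product z (Vec.zipWith ℕ._+_ a b) ≈ power-product z a * power-product z b
  power-product-+ z []      []      = sym (*-identityˡ 1#)
  power-product-+ z (i ∷ a) (j ∷ b) = trans (*-cong (E.^-homo-* (z zero) i j) (power-product-+ (tail z) a b)) (interchange _ _ _ _)

  h : ∀ n → ℕ → Vector Carrier n → Carrier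
  h n t z = ∑ₗ (power-product z) (compositions n t)

  -- Choosing one monomial from each factor is choosing the rows of a matrix, and the product of the
  -- chosen monomials has the column sums as exponents.
  h-power : ∀ {n} t z m → h n t z ^ m ≈ ∑ₗ (λ A → power-product z (columnSums A)) (sequences (compositions n t) m)
  h-power t z zero    = sym (trans (+-identityʳ _) (power-product-0 z))
  h-power t z (suc m) = trans (*-congˡ (h-power t z m))
    (sym (∑ₗ-product _∷_ (λ a A → power-product-+ z a (columnSums A)) (compositions _ t) (sequences (compositions _ t) m)))

  h-0 : ∀ n (z : Vector Carrier n) → h n 0 z ≈ 1#
  h-0 zero    z = +-identityʳ 1#
  h-0 (suc n) z = trans (∑ₗ-map (power-product z) (0 ∷_) (compositions n 0))
    (trans (∑ₗ-cong (λ a → *-identityˡ _) (compositions n 0)) (h-0 n (tail z)))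

  -- The two halves of `compositions` are the monomials divisible by the first variable and those
  -- free of it.
  h-recurrence : ∀ n t (z : Vector Carrier (suc n)) → h (suc n) (suc t) z ≈ z zero * h (suc n) t z + h n (suc t) (tail z)
  h-recurrence n t z = trans (∑ₗ-++ (power-product z) (map raise (compositions (suc n) t)) _)
    (+-cong (trans (∑ₗ-map (power-product z) raise (compositions (suc n) t))
        (trans (∑ₗ-cong (λ { (i ∷ a) → *-assoc _ _ _ }) (compositions (suc n) t)) (sym (*-distribˡ-∑ₗ (z zero) (power-product z) (compositions (suc n) t)))))
      (trans (∑ₗ-map (power-product z) (0 ∷_) (compositions n (suc t))) (∑ₗ-cong (λ a → *-identityˡ _) (compositions n (suc t)))))

  dropSecond : ∀ {n} → Vector Carrier (suc (suc n)) → Vector Carrier (suc n)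
  dropSecond z zero    = z zero
  dropSecond z (suc k) = z (suc (suc k))

  -- This would follow from `h-recurrence` by symmetry of h, but the list of compositions is not
  -- visibly symmetric. Induction on t avoids permutations: both sides are unfolded at the first
  -- variable, and the results agree up to rearrangement.
  h-recurrence₂ : ∀ n t (z : Vector Carrier (suc (suc n))) →
    h (suc (suc n)) (suc t) z ≈ z (suc zero) * h (suc (suc n)) t z + h (suc n) (suc t) (dropSecond z)
  h-recurrence₂ n zero z = begin
    h (suc (suc n)) 1 z
      ≈⟨ h-recurrence (suc n) 0 z ⟩
    a * h (suc (suc n)) 0 z + h (suc n) 1 (tail z)
      ≈⟨ +-cong (*-congˡ (h-0 (suc (suc n)) z)) (trans (h-recurrence n 0 (tail z)) (+-congʳ (*-congˡ (h-0 (suc n) (tail z))))) ⟩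
    a * 1# + (b * 1# + D)
      ≈⟨ trans (sym (+-assoc _ _ _)) (trans (+-congʳ (+-comm _ _)) (+-assoc _ _ _)) ⟩
    b * 1# + (a * 1# + D)
      ≈⟨ +-cong (*-congˡ (h-0 (suc (suc n)) z)) (trans (h-recurrence n 0 (dropSecond z)) (+-congʳ (*-congˡ (h-0 (suc n) (dropSecond z))))) ⟨
    b * h (suc (suc n)) 0 z + h (suc n) 1 (dropSecond z) ∎
    where
    a b D : Carrier
    a = z zero
    b = z (suc zero)
    D = h n 1 (tail (tail z))
  h-recurrence₂ n (suc t) z = begin
    h (suc (suc n)) (suc (suc t)) z
      ≈⟨ h-recurrence (suc n) (suc t) z ⟩
    a * h (suc (suc n)) (suc t) z + h (suc n) (suc (suc t)) (tail z)
      ≈⟨ +-cong (*-congˡ (h-recurrence₂ n t z)) (h-recurrence n (suc t) (tail z)) ⟩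
    a * (b * B + A′) + (b * A + D)
      ≈⟨ rearrange ⟩
    b * (a * B + A) + (a * A′ + D)
      ≈⟨ +-cong (*-congˡ (h-recurrence (suc n) t z)) (h-recurrence n (suc t) (dropSecond z)) ⟨
    b * h (suc (suc n)) (suc t) z + h (suc n) (suc (suc t)) (dropSecond z) ∎
    where
    a b A A′ B D : Carrier
    a  = z zero
    b  = z (suc zero)
    A  = h (suc n) (suc t) (tail z)
    A′ = h (suc n) (suc t) (dropSecond z)
    B  = h (suc (suc n)) t z
    D  = h n (suc (suc t)) (tail (tail z))
    rearrange : a * (b * B + A′) + (b * A + D) ≈ b * (a * B + A) + (a * A′ + D)
    rearrange = begin
      a * (b * B + A′) + (b * A + D)            ≈⟨ +-congʳ (distribˡ a (b * B) A′) ⟩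
      (a * (b * B) + a * A′) + (b * A + D)      ≈⟨ +-interchange _ _ _ _ ⟩
      (a * (b * B) + b * A) + (a * A′ + D)      ≈⟨ +-congʳ (+-congʳ (x∙yz≈y∙xz a b B)) ⟩
      (b * (a * B) + b * A) + (a * A′ + D)      ≈⟨ +-congʳ (distribˡ b (a * B) A) ⟨
      b * (a * B + A) + (a * A′ + D)            ∎
      where
      open Algebra.Properties.CommutativeSemigroup +-commutativeSemigroup using () renaming (interchange to +-interchange)
      open Algebra.Properties.CommutativeSemigroup *-commutativeSemigroup using (x∙yz≈y∙xz)

module BirkhoffIntegral {c ℓ₁ ℓ₂} (reals : RealNumbers c ℓ₁ ℓ₂) where

  open Analysis reals
  open Solver using (solve; con; _:=_; _:+_; _:*_; _:-_; :-_)

  private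
    module RP = Algebra.Properties.Ring ring
    module ΣR = Algebra.Properties.Semiring.Sum semiring
    module ≈R = Relation.Binary.Reasoning.Setoid setoid
    module ER = Algebra.Properties.Semiring.Exp semiring
    module MP = Algebra.Properties.Monoid.Mult (CommutativeRing.+-monoid commutativeRing)

  -- Inequalities between constructive reals

  module Order where

    open IsStrictPartialOrder isStrictPartialOrder public
      using (<-respʳ-≈; <-respˡ-≈) renaming (trans to <-trans; irrefl to <-irrefl)

    abstract
      ≤-reflexive : ∀ {x y} → x ≈ y → x ≤ y
      ≤-reflexive x≈y = <-irrefl (sym x≈y)

      -- Since `≤` is the negation of the reversed `<`, a counterexample z < x is compared with y by
      -- cotransitivity, and either outcome is refuted.
      ≤-trans : ∀ {x y z} → x ≤ y → y ≤ z → x ≤ z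
      ≤-trans x≤y y≤z z<x = [ y≤z , x≤y ]′ (<-cotrans z<x _)

      ≤-resp-≈ : ∀ {x x′ y y′} → x ≈ x′ → y ≈ y′ → x ≤ y → x′ ≤ y′
      ≤-resp-≈ x≈ y≈ x≤y y′<x′ = x≤y (<-respˡ-≈ (sym y≈) (<-respʳ-≈ (sym x≈) y′<x′))

      ≤⇒0≤- : ∀ {x y} → x ≤ y → 0# ≤ y - x
      ≤⇒0≤- {x} {y} x≤y y-x<0 = x≤y (0<-⇒< (<-respʳ-≈ (solve 2 (λ x y → :- (y :- x) := x :- y) refl x y) (neg-pos y-x<0)))

      -- The separate d lets an inequality be proved by one ring identity for the difference and the
      -- sign of its other side.
      0≤-⇒≤ : ∀ {x y d} → d ≈ y - x → 0# ≤ d → x ≤ y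
      0≤-⇒≤ {x} {y} d≈ 0≤d y<x = 0≤d (<-respˡ-≈ (sym d≈) (<-respʳ-≈ (-‿inverseʳ y)
        (<-respˡ-≈ (sym (solve 2 (λ x y → y :- x := (y :+ (y :- x)) :- y) refl x y))
          (+-monoˡ-< (- y) (<-respʳ-≈ (solve 2 (λ x y → x :+ (y :- x) := y) refl x y) (+-monoˡ-< (y - x) y<x))))))

      +-nonneg : ∀ {x y} → 0# ≤ x → 0# ≤ y → 0# ≤ x + y
      +-nonneg {x} {y} 0≤x 0≤y x+y<0 = [ (λ x+y<x → 0≤y (0<-⇒< (<-respʳ-≈
        (solve 2 (λ x y → x :- (x :+ y) := con ℤ.0ℤ :- y) refl x y) (<⇒0<- x+y<x)))) , 0≤x ]′ (<-cotrans x+y<0 x)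

      -- If the product were negative, it would be apart from 0, hence so would both factors;
      -- nonnegative and apart from 0 means positive, a contradiction.
      *-nonneg : ∀ {x y} → 0# ≤ x → 0# ≤ y → 0# ≤ x * y
      *-nonneg {x} {y} 0≤x 0≤y xy<0 = <⇒≤ (*-pos (positive 0≤x (#-factorˡ xy#0))
        (positive 0≤y (#-factorˡ (<⇒# (<-respˡ-≈ (*-comm x y) xy<0))))) xy<0
        where
        xy#0 : x * y # 0#
        xy#0 = <⇒# xy<0
        positive : ∀ {z} → 0# ≤ z → z # 0# → 0# < z
        positive 0≤z z#0 = [ (λ z<0 → ⊥-elim (0≤z z<0)) , (λ 0<z → 0<z) ]′ (#⇒<⊎> z#0)

      0≤1 : 0# ≤ 1#
      0≤1 = <⇒≤ 0<1

      +-mono-≤ : ∀ {x y u v} → x ≤ y → u ≤ v → x + u ≤ y + v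
      +-mono-≤ {x} {y} {u} {v} x≤y u≤v = 0≤-⇒≤
        (solve 4 (λ x y u v → (y :- x) :+ (v :- u) := (y :+ v) :- (x :+ u)) refl x y u v)
        (+-nonneg (≤⇒0≤- x≤y) (≤⇒0≤- u≤v))

      *-monoˡ-≤ : ∀ {x y z} → 0# ≤ z → x ≤ y → z * x ≤ z * y
      *-monoˡ-≤ {x} {y} {z} 0≤z x≤y = 0≤-⇒≤
        (solve 3 (λ x y z → z :* (y :- x) := z :* y :- z :* x) refl x y z) (*-nonneg 0≤z (≤⇒0≤- x≤y))

      *-mono-≤ : ∀ {x y u v} → 0# ≤ x → 0# ≤ v → x ≤ y → u ≤ v → x * u ≤ y * v
      *-mono-≤ {x} {y} {u} {v} 0≤x 0≤v x≤y u≤v = ≤-trans (*-monoˡ-≤ 0≤x u≤v)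
        (≤-resp-≈ (*-comm v x) (*-comm v y) (*-monoˡ-≤ 0≤v x≤y))

      sq-cancel-≤ : ∀ {x d} → 0# ≤ d → x * x ≤ d * d → x ≤ d
      sq-cancel-≤ {x} {d} 0≤d xx≤dd d<x = xx≤dd (≤-<-trans
        (*-monoˡ-≤ 0≤d (<⇒≤ d<x)) (*-monoʳ-< (≤-<-trans 0≤d d<x) d<x))

      normSq-nonneg : ∀ z → 0# ≤ normSq z
      normSq-nonneg z = +-nonneg (sq-nonneg (re z)) (sq-nonneg (im z))

  open Order

  -- Ring solver and powers for complex numbers

  module ComplexRing where

    module C = CommutativeRing ℂ-commutativeRing
    module XC = Algebra.Properties.CommutativeSemiring.Exp C.commutativeSemiring
    module ΣC = Algebra.Properties.Semiring.Sum C.semiring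
    module ΠC = Algebra.Properties.CommutativeMonoid.Sum C.*-commutativeMonoid

    -- Coefficients for the solver. The numeral 1 is interpreted as `ofℝ (1# + 0#)`, which is not
    -- `1ᶜ` by computation; this is why `1ᶜ` is passed to `solveᶜ` as a variable below, while `2ᶜ`
    -- may be written as a constant.
    ofℤᶜ : ℤ → ℂ
    ofℤᶜ i = ofℝ (ofℤ i)

    private
      ACRᶜ : AlmostCommutativeRing c ℓ₁
      ACRᶜ = fromCommutativeRing ℂ-commutativeRing

    abstract
      ofℝ-cong : ∀ {x y} → x ≈ y → ofℝ x ≈ᶜ ofℝ y
      ofℝ-cong e = e , refl

      ofℝ-+ : ∀ x y → ofℝ (x + y) ≈ᶜ ofℝ x +ᶜ ofℝ y
      ofℝ-+ x y = refl , sym (+-identityˡ 0#)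

      ofℝ-neg : ∀ x → ofℝ (- x) ≈ᶜ -ᶜ ofℝ x
      ofℝ-neg x = refl , sym RP.-0#≈0#

      ofℝ-* : ∀ x y → ofℝ (x * y) ≈ᶜ ofℝ x *ᶜ ofℝ y
      ofℝ-* x y = sym (trans (+-congˡ (trans (-‿cong (zeroˡ 0#)) RP.-0#≈0#)) (+-identityʳ _)) ,
        sym (trans (+-cong (zeroʳ x) (zeroˡ y)) (+-identityˡ 0#))

      ofℝ-minus : ∀ x y → ofℝ (x - y) ≈ᶜ ofℝ x -ᶜ ofℝ y
      ofℝ-minus x y = C.trans (ofℝ-+ x (- y)) (C.+-congˡ {ofℝ x} {ofℝ (- y)} { -ᶜ ofℝ y} (ofℝ-neg y))

      ofℝ-^ : ∀ x k → ofℝ (x ^ʳ k) ≈ᶜ ofℝ x ^ᶜ k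
      ofℝ-^ x zero    = C.refl
      ofℝ-^ x (suc k) = C.trans (ofℝ-* x (x ^ʳ k)) (C.*-congˡ {ofℝ x} {ofℝ (x ^ʳ k)} {ofℝ x ^ᶜ k} (ofℝ-^ x k))

    private
      ofℤᶜ-morphism : ℤ.+-*-rawRing -Raw-AlmostCommutative⟶ ACRᶜ
      ofℤᶜ-morphism = record
        { ⟦_⟧    = ofℤᶜ
        ; +-homo = λ i j → C.trans (ofℝ-cong (ofℤ-+ i j)) (ofℝ-+ (ofℤ i) (ofℤ j))
        ; *-homo = λ i j → C.trans (ofℝ-cong (ofℤ-* i j)) (ofℝ-* (ofℤ i) (ofℤ j))
        ; -‿homo = λ i → C.trans (ofℝ-cong (ofℤ-neg i)) (ofℝ-neg (ofℤ i))
        ; 0-homo = C.refl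
        ; 1-homo = +-identityʳ 1# , refl
        }

      ofℤᶜ-≟ : ∀ i j → Maybe (ofℤᶜ i ≈ᶜ ofℤᶜ j)
      ofℤᶜ-≟ i j = Maybe.map (C.reflexive ∘ ≡.cong ofℤᶜ) (dec⇒weaklyDec ℤ._≟_ i j)

    private
      module CSolver = Algebra.Solver.Ring ℤ.+-*-rawRing ACRᶜ ofℤᶜ-morphism ofℤᶜ-≟

    open CSolver public using () renaming
      (solve to solveᶜ; con to conᶜ; _:=_ to _:=ᶜ_; _:+_ to _:+ᶜ_; _:*_ to _:*ᶜ_; _:-_ to _:-ᶜ_; :-_ to :-ᶜ_)

    abstract
      1^ : ∀ k → 1ᶜ ^ᶜ k ≈ᶜ 1ᶜ
      1^ zero    = C.refl
      1^ (suc k) = C.trans (C.*-identityˡ (1ᶜ ^ᶜ k)) (1^ k)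

      power-inverse : ∀ {z w} → z *ᶜ w ≈ᶜ 1ᶜ → ∀ k → z ^ᶜ k *ᶜ w ^ᶜ k ≈ᶜ 1ᶜ
      power-inverse {z} {w} zw≈1 k = C.trans (C.sym (XC.^-distrib-* z w k)) (C.trans (XC.^-congˡ k zw≈1) (1^ k))

  open ComplexRing

  open ListSum C.commutativeSemiring

  -- Bounds on the modulus

  module Modulus where

    infix 4 ‖_‖≤_
    -- |z| ≤ b stated through squares, which takes no square root; with `0# ≤ b` the squares compare
    -- as the moduli do.
    ‖_‖≤_ : ℂ → ℝ → Set ℓ₂
    ‖ z ‖≤ b = (0# ≤ b) × (normSq z ≤ b * b)

    abstract
      ‖‖-cong : ∀ {z w a} → z ≈ᶜ w → ‖ z ‖≤ a → ‖ w ‖≤ a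
      ‖‖-cong z≈w (0≤a , p) = 0≤a , ≤-resp-≈ (normSq-cong z≈w) refl p

      ‖‖-mono : ∀ {z a b} → a ≤ b → ‖ z ‖≤ a → ‖ z ‖≤ b
      ‖‖-mono {z} {a} {b} a≤b (0≤a , p) = 0≤b , ≤-trans p (*-mono-≤ 0≤a 0≤b a≤b a≤b)
        where
        0≤b : 0# ≤ b
        0≤b = ≤-trans 0≤a a≤b

      ‖‖-* : ∀ {z w a b} → ‖ z ‖≤ a → ‖ w ‖≤ b → ‖ z *ᶜ w ‖≤ a * b
      ‖‖-* {z} {w} {a} {b} (0≤a , p) (0≤b , q) = *-nonneg 0≤a 0≤b ,
        ≤-resp-≈ (sym (normSq-* z w)) (solve 2 (λ a b → (a :* a) :* (b :* b) := (a :* b) :* (a :* b)) refl a b)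
          (*-mono-≤ (normSq-nonneg z) (*-nonneg 0≤b 0≤b) p q)

      -- |z + w|² = |z|² + |w|² + 2⟨z, w⟩, and ⟨z, w⟩ ≤ ab by Cauchy-Schwarz, whose gap is the
      -- square of `cross`.
      ‖‖-+ : ∀ {z w a b} → ‖ z ‖≤ a → ‖ w ‖≤ b → ‖ z +ᶜ w ‖≤ a + b
      ‖‖-+ {z} {w} {a} {b} (0≤a , p) (0≤b , q) = +-nonneg 0≤a 0≤b ,
        ≤-resp-≈ (sym (expand (re z) (im z) (re w) (im w))) (solve 2 (λ a b → (a :* a :+ b :* b) :+ (a :* b :+ a :* b) := (a :+ b) :* (a :+ b)) refl a b)
          (+-mono-≤ (+-mono-≤ p q) (+-mono-≤ inner≤ab inner≤ab))
        where
        inner cross : ℝ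
        inner = re z * re w + im z * im w
        cross = re z * im w - im z * re w
        expand : ∀ s t u v → (s + u) * (s + u) + (t + v) * (t + v)
               ≈ ((s * s + t * t) + (u * u + v * v)) + ((s * u + t * v) + (s * u + t * v))
        expand = solve 4 (λ s t u v → (s :+ u) :* (s :+ u) :+ (t :+ v) :* (t :+ v)
               := ((s :* s :+ t :* t) :+ (u :* u :+ v :* v)) :+ ((s :* u :+ t :* v) :+ (s :* u :+ t :* v))) refl
        cauchy-schwarz : inner * inner ≤ normSq z * normSq w
        cauchy-schwarz = 0≤-⇒≤ (solve 4 (λ s t u v →
            (s :* v :- t :* u) :* (s :* v :- t :* u) :=
            (s :* s :+ t :* t) :* (u :* u :+ v :* v) :- (s :* u :+ t :* v) :* (s :* u :+ t :* v)) refl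
            (re z) (im z) (re w) (im w)) (sq-nonneg cross)
        inner≤ab : inner ≤ a * b
        inner≤ab = sq-cancel-≤ (*-nonneg 0≤a 0≤b) (≤-trans cauchy-schwarz
          (≤-resp-≈ (normSq-* z w) refl (proj₂ (‖‖-* {z} {w} (0≤a , p) (0≤b , q)))))

      ‖‖-neg : ∀ {z a} → ‖ z ‖≤ a → ‖ -ᶜ z ‖≤ a
      ‖‖-neg {z} (0≤a , p) = 0≤a , ≤-resp-≈ (+-cong (neg-sq (re z)) (neg-sq (im z))) refl p
        where
        neg-sq : ∀ x → x * x ≈ (- x) * (- x)
        neg-sq = solve 1 (λ x → x :* x := (:- x) :* (:- x)) refl

      ‖0‖ : ‖ 0ᶜ ‖≤ 0#
      ‖0‖ = <-irrefl refl , ≤-reflexive (normSq-ofℝ 0#)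

      ‖1‖ : ‖ 1ᶜ ‖≤ 1#
      ‖1‖ = 0≤1 , ≤-reflexive (normSq-ofℝ 1#)

      ‖ofℝ‖ : ∀ {x b} → 0# ≤ x → x ≤ b → ‖ ofℝ x ‖≤ b
      ‖ofℝ‖ 0≤x x≤b = ≤-trans 0≤x x≤b , ≤-resp-≈ (sym (normSq-ofℝ _)) refl (*-mono-≤ 0≤x (≤-trans 0≤x x≤b) x≤b x≤b)

      ‖ofℝ-abs‖ : ∀ {x b} → ∣ x ∣< b → ‖ ofℝ x ‖≤ b
      ‖ofℝ-abs‖ {x} {b} (-b<x , x<b) = 0≤b , 0≤-⇒≤
          (trans (solve 2 (λ x b → (b :- x) :* (x :- (:- b)) := b :* b :- x :* x) refl x b) (+-congˡ (-‿cong (sym (normSq-ofℝ x)))))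
          (*-nonneg (<⇒≤ (<⇒0<- x<b)) (<⇒≤ (<⇒0<- -b<x)))
        where
        0≤b : 0# ≤ b
        0≤b b<0 = <-irrefl refl (<-trans (<-trans (neg-pos b<0) -b<x) (<-trans x<b b<0))

      -- With n = |z|², the inequality n ≤ (n + 1)² gives every z an explicit bound without a square
      -- root.
      ‖‖-exists : ∀ z → ‖ z ‖≤ normSq z + ofℕ 1
      ‖‖-exists z = +-nonneg 0≤n (<⇒≤ (0<ofℕ-suc 0)) , 0≤-⇒≤
        (solve 1 (λ n → n :* n :+ (n :+ con ℤ.1ℤ) := (n :+ con ℤ.1ℤ) :* (n :+ con ℤ.1ℤ) :- n) refl (normSq z))
        (+-nonneg (*-nonneg 0≤n 0≤n) (+-nonneg 0≤n (<⇒≤ (0<ofℕ-suc 0))))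
        where
        0≤n : 0# ≤ normSq z
        0≤n = normSq-nonneg z

      ‖‖<⇒normSq< : ∀ {z a δ} → ‖ z ‖≤ a → a < δ → normSq z < δ * δ
      ‖‖<⇒normSq< (0≤a , p) a<δ = ≤-<-trans p (≤-<-trans (*-monoˡ-≤ 0≤a (<⇒≤ a<δ)) (*-monoʳ-< (≤-<-trans 0≤a a<δ) a<δ))

  open Modulus

  -- Approximate primitives and Riemann-Stieltjes sums

  module Riemann where

    abstract
      telescope : ∀ {n} (v : Vector ℝ (suc n)) → ∑ (λ k → v (suc k) - v (inject₁ k)) ≈ v (fromℕ n) - v zero
      telescope {zero}  v = sym (-‿inverseʳ (v zero))
      telescope {suc n} v = trans (+-congˡ (telescope (tail v)))
        (solve 3 (λ a b d → (b :- a) :+ (d :- b) := d :- a) refl (v zero) (v (suc zero)) (v (fromℕ (suc n))))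

      telescopeᶜ : ∀ {n} (v : Vector ℂ (suc n)) → ∑ᶜ (λ k → v (suc k) -ᶜ v (inject₁ k)) ≈ᶜ v (fromℕ n) -ᶜ v zero
      telescopeᶜ {zero}  v = C.sym (C.-‿inverseʳ (v zero))
      telescopeᶜ {suc n} v = C.trans (C.+-congˡ {v (suc zero) -ᶜ v zero} (telescopeᶜ (tail v)))
        (solveᶜ 3 (λ a b d → (b :-ᶜ a) :+ᶜ (d :-ᶜ b) :=ᶜ d :-ᶜ a) C.refl (v zero) (v (suc zero)) (v (fromℕ (suc n))))

      ‖∑‖ : ∀ {n} {e : Vector ℂ n} {b : Vector ℝ n} → (∀ k → ‖ e k ‖≤ b k) → ‖ ∑ᶜ e ‖≤ ∑ b
      ‖∑‖ {zero}  p = ‖0‖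
      ‖∑‖ {suc n} p = ‖‖-+ (p zero) (‖∑‖ (p ∘ suc))

      ∑-mono-≤ : ∀ {n} {a b : Vector ℝ n} → (∀ k → a k ≤ b k) → ∑ a ≤ ∑ b
      ∑-mono-≤ {zero}  p = ≤-reflexive refl
      ∑-mono-≤ {suc n} p = +-mono-≤ (p zero) (∑-mono-≤ (p ∘ suc))

      first≤ : ∀ {n} (v : Vector ℝ (suc n)) → (∀ k → v (inject₁ k) ≤ v (suc k)) → ∀ k → v zero ≤ v k
      first≤ v mono zero = ≤-reflexive refl
      first≤ {suc n} v mono (suc k) = ≤-trans (mono zero) (first≤ (tail v) (mono ∘ suc) k)

      ≤last : ∀ {n} (v : Vector ℝ (suc n)) → (∀ k → v (inject₁ k) ≤ v (suc k)) → ∀ k → v k ≤ v (fromℕ n)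
      ≤last {zero}  v mono zero = ≤-reflexive refl
      ≤last {suc n} v mono zero = ≤-trans (mono zero) (≤last (tail v) (mono ∘ suc) zero)
      ≤last {suc n} v mono (suc k) = ≤last (tail v) (mono ∘ suc) k

      -- The witness is η = e/(K + 1); the 1 makes the divisor positive even if K vanishes.
      small-multiple : ∀ {K e} → 0# ≤ K → 0# < e → ∃[ η ] (0# < η × K * η ≤ e)
      small-multiple {K} {e} 0≤K 0<e = e * r , *-pos 0<e 0<r ,
        0≤-⇒≤ (trans (solve 3 (λ K e r → e :* r := e :* ((K :+ con ℤ.1ℤ) :* r) :- K :* (e :* r)) refl K e r)
                     (+-congʳ (trans (*-congˡ (inv-inverseʳ _ K+1#0)) (*-identityʳ e))))
              (<⇒≤ (*-pos 0<e 0<r))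
        where
        0<K+1 : 0# < K + ofℕ 1
        0<K+1 = <-respʳ-≈ (+-comm _ _) (+-pos (0<ofℕ-suc 0) 0≤K)
        K+1#0 : K + ofℕ 1 # 0#
        K+1#0 = #-sym (<⇒# 0<K+1)
        r : ℝ
        r = inv (K + ofℕ 1) K+1#0
        0<r : 0# < r
        0<r = inverse-pos 0<K+1 (inv-inverseʳ _ K+1#0)

      quarter : ∀ {δ} → 0# < δ → ∃[ e ] (0# < e × (e + e) + (e + e) ≈ δ)
      quarter {δ} 0<δ = δ * u , *-pos 0<δ (inverse-pos {ofℕ 4} (0<ofℕ-suc 3) 4u≈1) ,
        trans (solve 2 (λ δ u → (δ :* u :+ δ :* u) :+ (δ :* u :+ δ :* u) := δ :* (con (+ 4) :* u)) refl δ u)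
          (trans (*-congˡ 4u≈1) (*-identityʳ δ))
        where
        u : ℝ
        u = unitFraction 3
        4u≈1 : ofℕ 4 * u ≈ 1#
        4u≈1 = inv-inverseʳ (ofℕ 4) (#-sym (<⇒# (0<ofℕ-suc 3)))

    -- F is a primitive of f along γ up to errors whose total is at most e: the
    -- second-order errors vanish with the mesh, and those measured by the
    -- increments of B add up to B 1 − B 0.
    record ApproximatePrimitive {ε} (γ : ℝ → Circle ε) (f : Circle ε → ℂ) (J : ℂ) (e : ℝ) : Set (c ⊔ ℓ₁ ⊔ ℓ₂) where
      field
        F       : ℝ → ℂ
        B       : ℝ → ℝ
        K       : ℝ
        0≤K     : 0# ≤ K
        F-cong  : ∀ {x y} → x ≈ y → F x ≈ᶜ F y
        B-cong  : ∀ {x y} → x ≈ y → B x ≈ B y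
        bound   : ∀ {x τ y} → 0# ≤ x → x ≤ τ → τ ≤ y → y ≤ 1# →
                  ‖ (F y -ᶜ F x) -ᶜ f (γ τ) *ᶜ (pt (γ y) -ᶜ pt (γ x)) ‖≤ K * ((y - x) * (y - x)) + (B y - B x)
        F-total : ‖ (F 1# -ᶜ F 0#) -ᶜ J ‖≤ e
        B-total : B 1# - B 0# ≤ e

    module _ {ε} {γ : ℝ → Circle ε} {f : Circle ε → ℂ} {J : ℂ} where

      abstract
        -- The sum differs from J by the local errors and by F(1) - F(0) - J. In K ∑ h², one factor
        -- h is at most the mesh bound η and the other sums to 1, which leaves Kη ≤ e; the
        -- increments of B telescope to at most e; the last e is `F-total`.
        stieltjesSum-close : ∀ {e η} (A : ApproximatePrimitive γ f J e) → 0# < η →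
          let open ApproximatePrimitive A in K * η ≤ e →
          ∀ P → Partition.MeshBelow P η → ‖ stieltjesSum γ f P -ᶜ J ‖≤ (e + e) + e
        stieltjesSum-close {e} {η} A 0<η Kη≤e P mesh =
          ‖‖-cong sum≈ (‖‖-+ (‖‖-neg (‖‖-mono ∑b≤ (‖∑‖ bounds)))
            (‖‖-cong (C.sym {(F (node (fromℕ size)) -ᶜ F (node zero)) -ᶜ J} {(F 1# -ᶜ F 0#) -ᶜ J} (C.+-congʳ {x = -ᶜ J} F-ends)) F-total))
          where
          open ApproximatePrimitive A
          open Partition P
          h : Fin size → ℝ
          h k = node (suc k) - node (inject₁ k)
          Δz E : Fin size → ℂ
          Δz k = f (γ (tag k)) *ᶜ (pt (γ (node (suc k))) -ᶜ pt (γ (node (inject₁ k))))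
          E k = (F (node (suc k)) -ᶜ F (node (inject₁ k))) -ᶜ Δz k
          b : Fin size → ℝ
          b k = K * (h k * h k) + (B (node (suc k)) - B (node (inject₁ k)))
          step : ∀ k → node (inject₁ k) ≤ node (suc k)
          step k = ≤-trans (node≤tag k) (tag≤node k)
          bounds : ∀ k → ‖ E k ‖≤ b k
          bounds k = bound (≤-trans (≤-reflexive (sym node-first)) (first≤ node step (inject₁ k)))
            (node≤tag k) (tag≤node k) (≤-trans (≤last node step (suc k)) (≤-reflexive node-last))
          F-ends : F (node (fromℕ size)) -ᶜ F (node zero) ≈ᶜ F 1# -ᶜ F 0#
          F-ends = C.+-cong (F-cong node-last) (C.-‿cong (F-cong node-first))
          ∑b≤ : ∑ b ≤ e + e
          ∑b≤ = ≤-trans (∑-mono-≤ {b = λ k → (K * η) * h k + (B (node (suc k)) - B (node (inject₁ k)))}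
                  λ k → +-mono-≤ (≤-resp-≈ refl (solve 3 (λ K h η → K :* (h :* η) := (K :* η) :* h) refl K (h k) η)
                    (*-monoˡ-≤ 0≤K (*-monoˡ-≤ (≤⇒0≤- (step k)) (<⇒≤ (mesh k))))) (≤-reflexive refl))
                (≤-trans (≤-reflexive total) (+-mono-≤ Kη≤e B-total))
            where
            total : ∑ (λ k → (K * η) * h k + (B (node (suc k)) - B (node (inject₁ k)))) ≈ K * η + (B 1# - B 0#)
            total = begin
              ∑ (λ k → (K * η) * h k + (B (node (suc k)) - B (node (inject₁ k))))
                ≈⟨ ΣR.∑-distrib-+ (λ k → (K * η) * h k) (λ k → B (node (suc k)) - B (node (inject₁ k))) ⟩
              ∑ (λ k → (K * η) * h k) + ∑ (λ k → B (node (suc k)) - B (node (inject₁ k)))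
                ≈⟨ +-cong (sym (ΣR.*-distribˡ-sum (K * η) h)) (telescope (B ∘ node)) ⟩
              (K * η) * ∑ h + (B (node (fromℕ size)) - B (node zero))
                ≈⟨ +-cong (*-congˡ (trans (telescope node) (trans (+-cong node-last (-‿cong node-first))
                     (trans (+-congˡ RP.-0#≈0#) (+-identityʳ 1#)))))
                     (+-cong (B-cong node-last) (-‿cong (B-cong node-first))) ⟩
              (K * η) * 1# + (B 1# - B 0#)
                ≈⟨ +-congʳ (*-identityʳ (K * η)) ⟩
              K * η + (B 1# - B 0#) ∎
              where open ≈R
          ∑E≈ : ∑ᶜ E +ᶜ ∑ᶜ Δz ≈ᶜ F (node (fromℕ size)) -ᶜ F (node zero)
          ∑E≈ = C.trans (C.sym (ΣC.∑-distrib-+ E Δz)) (C.trans (ΣC.sum-cong-≋ λ k →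
              solveᶜ 2 (λ a d → (a :-ᶜ d) :+ᶜ d :=ᶜ a) C.refl
                (F (node (suc k)) -ᶜ F (node (inject₁ k))) (Δz k))
            (telescopeᶜ (F ∘ node)))
          sum≈ : (-ᶜ ∑ᶜ E) +ᶜ ((F (node (fromℕ size)) -ᶜ F (node zero)) -ᶜ J) ≈ᶜ ∑ᶜ Δz -ᶜ J
          sum≈ = C.trans (C.+-congˡ { -ᶜ ∑ᶜ E} (C.+-congʳ { -ᶜ J} (C.sym ∑E≈)))
            (solveᶜ 3 (λ e s j → (:-ᶜ e) :+ᶜ ((e :+ᶜ s) :-ᶜ j) :=ᶜ s :-ᶜ j)
              C.refl (∑ᶜ E) (∑ᶜ Δz) J)

        approximatePrimitives⇒integral : (∀ {e} → 0# < e → ApproximatePrimitive γ f J e) → IsPathIntegral γ f J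
        approximatePrimitives⇒integral approx δ 0<δ = η , 0<η , λ P mesh →
          ‖‖<⇒normSq< (stieltjesSum-close A 0<η Kη≤e P mesh) 3e<δ
          where
          e : ℝ
          e = proj₁ (quarter 0<δ)
          0<e : 0# < e
          0<e = proj₁ (proj₂ (quarter 0<δ))
          -- Three errors of size e = δ/4 leave room for the strict inequality.
          3e<δ : (e + e) + e < δ
          3e<δ = <-respʳ-≈ (trans (solve 1 (λ e → e :+ ((e :+ e) :+ e) := (e :+ e) :+ (e :+ e)) refl e) (proj₂ (proj₂ (quarter 0<δ))))
            (<-respˡ-≈ (+-identityˡ _) (+-monoˡ-< ((e + e) + e) 0<e))
          A : ApproximatePrimitive γ f J e
          A = approx 0<e
          mesh-bound : ∃[ η ] (0# < η × ApproximatePrimitive.K A * η ≤ e)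
          mesh-bound = small-multiple (ApproximatePrimitive.0≤K A) 0<e
          η : ℝ
          η = proj₁ mesh-bound
          0<η : 0# < η
          0<η = proj₁ (proj₂ mesh-bound)
          Kη≤e : ApproximatePrimitive.K A * η ≤ e
          Kη≤e = proj₂ (proj₂ mesh-bound)

  open Riemann

  -- First-order congruence of families over tagged intervals

  module Families where

    -- Bundles the arguments of the local estimate `bound`, so that errors become functions of one
    -- index. Containment in [0, 1] keeps powers of the parameter bounded.
    record TaggedInterval : Set (c ⊔ ℓ₂) where
      field
        {x τ y} : ℝ
        0≤x     : 0# ≤ x
        x≤τ     : x ≤ τ
        τ≤y     : τ ≤ y
        y≤1     : y ≤ 1#

      width : ℝ
      width = y - x

      abstract
        0≤width : 0# ≤ width
        0≤width = ≤⇒0≤- (≤-trans x≤τ τ≤y)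

    open TaggedInterval using (width; 0≤width)

    Family : Set (c ⊔ ℓ₂)
    Family = TaggedInterval → ℂ

    record Bounded (u : Family) : Set (c ⊔ ℓ₂) where
      constructor bounded
      field
        bound   : ℝ
        0≤bound : 0# ≤ bound
        holds   : ∀ p → ‖ u p ‖≤ bound

    -- Equality up to O(width): a congruence on bounded families.
    infix 4 _≋_
    record _≋_ (u v : Family) : Set (c ⊔ ℓ₂) where
      constructor mk≋
      field
        rate   : ℝ
        0≤rate : 0# ≤ rate
        close  : ∀ p → ‖ u p -ᶜ v p ‖≤ rate * width p

    atˣ atᵗ atʸ : (ℝ → ℂ) → Family
    atˣ f p = f (TaggedInterval.x p)
    atᵗ f p = f (TaggedInterval.τ p)
    atʸ f p = f (TaggedInterval.y p)

    infixl 7 _⊛_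
    infixl 6 _⊕_
    _⊛_ _⊕_ : Family → Family → Family
    (u ⊛ v) p = u p *ᶜ v p
    (u ⊕ v) p = u p +ᶜ v p

    const : ℂ → Family
    const z p = z

    infixr 8 _^ᶠ_
    _^ᶠ_ : Family → ℕ → Family
    (u ^ᶠ k) p = u p ^ᶜ k

    abstract
      bounded-const : ∀ z → Bounded (const z)
      bounded-const z = bounded (normSq z + ofℕ 1) (proj₁ (‖‖-exists z)) λ p → ‖‖-exists z

      bounded-* : ∀ {u v} → Bounded u → Bounded v → Bounded (u ⊛ v)
      bounded-* (bounded a 0≤a p) (bounded b 0≤b q) = bounded (a * b) (*-nonneg 0≤a 0≤b) λ i → ‖‖-* (p i) (q i)

      bounded-+ : ∀ {u v} → Bounded u → Bounded v → Bounded (u ⊕ v)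
      bounded-+ (bounded a 0≤a p) (bounded b 0≤b q) = bounded (a + b) (+-nonneg 0≤a 0≤b) λ i → ‖‖-+ (p i) (q i)

      bounded-neg : ∀ {u} → Bounded u → Bounded (-ᶜ_ ∘ u)
      bounded-neg (bounded a 0≤a p) = bounded a 0≤a λ i → ‖‖-neg (p i)

      bounded-^ : ∀ {u} k → Bounded u → Bounded (u ^ᶠ k)
      bounded-^ zero    b = bounded-const 1ᶜ
      bounded-^ (suc k) b = bounded-* b (bounded-^ k b)

      ≈⇒≋ : ∀ {u v} → (∀ p → u p ≈ᶜ v p) → u ≋ v
      ≈⇒≋ {u} {v} e = mk≋ 0# (≤-reflexive refl) λ p →
        ‖‖-cong (C.sym (C.trans (C.+-congʳ { -ᶜ v p} (e p)) (C.-‿inverseʳ (v p))))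
          (‖‖-mono (≤-reflexive (sym (zeroˡ (width p)))) ‖0‖)

      ≋-refl : ∀ {u} → u ≋ u
      ≋-refl = ≈⇒≋ λ p → C.refl

      ≋-sym : ∀ {u v} → u ≋ v → v ≋ u
      ≋-sym {u} {v} (mk≋ a 0≤a e) = mk≋ a 0≤a λ p →
        ‖‖-cong (solveᶜ 2 (λ u v → :-ᶜ (u :-ᶜ v) :=ᶜ v :-ᶜ u) C.refl (u p) (v p)) (‖‖-neg (e p))

      ≋-trans : ∀ {u v w} → u ≋ v → v ≋ w → u ≋ w
      ≋-trans {u} {v} {w} (mk≋ a 0≤a e) (mk≋ b 0≤b f) = mk≋ (a + b) (+-nonneg 0≤a 0≤b) λ p →
        ‖‖-mono (≤-reflexive (sym (distribʳ (width p) a b)))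
          (‖‖-cong (solveᶜ 3 (λ u v w → (u :-ᶜ v) :+ᶜ (v :-ᶜ w) :=ᶜ u :-ᶜ w) C.refl (u p) (v p) (w p))
            (‖‖-+ (e p) (f p)))

      ≋-+ : ∀ {u u′ v v′} → u ≋ u′ → v ≋ v′ → u ⊕ v ≋ u′ ⊕ v′
      ≋-+ {u} {u′} {v} {v′} (mk≋ a 0≤a e) (mk≋ b 0≤b f) = mk≋ (a + b) (+-nonneg 0≤a 0≤b) λ p →
        ‖‖-mono (≤-reflexive (sym (distribʳ (width p) a b)))
          (‖‖-cong (solveᶜ 4 (λ u u′ v v′ → (u :-ᶜ u′) :+ᶜ (v :-ᶜ v′)
              :=ᶜ (u :+ᶜ v) :-ᶜ (u′ :+ᶜ v′)) C.refl (u p) (u′ p) (v p) (v′ p))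
            (‖‖-+ (e p) (f p)))

      ≋-neg : ∀ {u v} → u ≋ v → (-ᶜ_ ∘ u) ≋ (-ᶜ_ ∘ v)
      ≋-neg {u} {v} (mk≋ a 0≤a e) = mk≋ a 0≤a λ p →
        ‖‖-cong (solveᶜ 2 (λ u v → :-ᶜ (u :-ᶜ v) :=ᶜ (:-ᶜ u) :-ᶜ (:-ᶜ v)) C.refl (u p) (v p))
          (‖‖-neg (e p))

      -- uv - u′v′ = (u - u′)v + u′(v - v′), which is why exactly v and u′ have to be bounded.
      ≋-* : ∀ {u u′ v v′} → Bounded v → Bounded u′ → u ≋ u′ → v ≋ v′ → u ⊛ v ≋ u′ ⊛ v′
      ≋-* {u} {u′} {v} {v′} (bounded s 0≤s p) (bounded r 0≤r q) (mk≋ a 0≤a e) (mk≋ b 0≤b f) =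
        mk≋ (a * s + r * b) (+-nonneg (*-nonneg 0≤a 0≤s) (*-nonneg 0≤r 0≤b)) λ i →
          ‖‖-mono (≤-reflexive (solve 5 (λ a b s r h → (a :* h) :* s :+ r :* (b :* h) := (a :* s :+ r :* b) :* h)
                refl a b s r (width i)))
            (‖‖-cong (solveᶜ 4 (λ u u′ v v′ → (u :-ᶜ u′) :*ᶜ v :+ᶜ u′ :*ᶜ (v :-ᶜ v′)
                :=ᶜ u :*ᶜ v :-ᶜ u′ :*ᶜ v′) C.refl (u i) (u′ i) (v i) (v′ i))
              (‖‖-+ (‖‖-* (e i) (p i)) (‖‖-* (q i) (f i))))

      ≋-^ : ∀ {u v} k → Bounded u → Bounded v → u ≋ v → u ^ᶠ k ≋ v ^ᶠ k
      ≋-^ zero    bu bv e = ≋-refl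
      ≋-^ (suc k) bu bv e = ≋-* (bounded-^ k bu) bv e (≋-^ k bu bv e)

    -- The polynomial ∑ aⁱ b^(k-i) for 0 ≤ i ≤ k, that is the quotient (b^(k+1) - a^(k+1))/(b - a)
    -- written without division, so that it also makes sense at a = b.
    secant : ℕ → ℂ → ℂ → ℂ
    secant zero    a b = 1ᶜ
    secant (suc k) a b = b *ᶜ secant k a b +ᶜ a ^ᶜ suc k

    abstract
      secant-slope : ∀ k a b → b ^ᶜ suc k -ᶜ a ^ᶜ suc k ≈ᶜ (b -ᶜ a) *ᶜ secant k a b
      secant-slope zero a b = C.trans (C.+-cong (C.*-identityʳ b) (C.-‿cong (C.*-identityʳ a))) (C.sym (C.*-identityʳ (b -ᶜ a)))
      secant-slope (suc k) a b = C.trans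
        (solveᶜ 4 (λ a b p q → b :*ᶜ q :-ᶜ a :*ᶜ p
            :=ᶜ b :*ᶜ (q :-ᶜ p) :+ᶜ (b :-ᶜ a) :*ᶜ p) C.refl a b (a ^ᶜ suc k) (b ^ᶜ suc k))
        (C.trans (C.+-congʳ (C.*-congˡ (secant-slope k a b)))
          (solveᶜ 4 (λ a b p s → b :*ᶜ ((b :-ᶜ a) :*ᶜ s) :+ᶜ (b :-ᶜ a) :*ᶜ p
            :=ᶜ (b :-ᶜ a) :*ᶜ (b :*ᶜ s :+ᶜ p)) C.refl a b (a ^ᶜ suc k) (secant k a b)))

      bounded-secant : ∀ {u v} k → Bounded u → Bounded v → Bounded (λ p → secant k (u p) (v p))
      bounded-secant zero    bu bv = bounded-const 1ᶜ
      bounded-secant (suc k) bu bv = bounded-+ (bounded-* bv (bounded-secant k bu bv)) (bounded-^ (suc k) bu)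

      secant-diagonal : ∀ k a → secant k a a ≈ᶜ ofℝ (ofℕ (suc k)) *ᶜ a ^ᶜ k
      secant-diagonal zero a = C.sym (C.trans (C.*-identityʳ _) (+-identityʳ 1# , refl))
      secant-diagonal (suc k) a = C.trans (C.+-congʳ (C.*-congˡ (secant-diagonal k a)))
        (C.trans (solveᶜ 4 (λ a n q i → a :*ᶜ (n :*ᶜ q) :+ᶜ a :*ᶜ q
            :=ᶜ (conᶜ ℤ.1ℤ :+ᶜ n) :*ᶜ (a :*ᶜ q)) C.refl a (ofℝ (ofℕ (suc k))) (a ^ᶜ k) 1ᶜ)
          (C.*-congʳ (C.trans (C.+-congʳ (+-identityʳ 1# , refl)) (C.sym (ofℝ-+ 1# (ofℕ (suc k)))))))

      secant-≋ : ∀ {a b m} k → Bounded a → Bounded b → Bounded m → a ≋ m → b ≋ m →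
                 (λ p → secant k (a p) (b p)) ≋ (λ p → secant k (m p) (m p))
      secant-≋ zero    ba bb bm a≋m b≋m = ≋-refl
      secant-≋ (suc k) ba bb bm a≋m b≋m = ≋-+
        (≋-* (bounded-secant k ba bb) bm b≋m (secant-≋ k ba bb bm a≋m b≋m)) (≋-^ (suc k) ba bm a≋m)

      -- The difference form of "z^(k+1)/(k+1) has derivative z^k": a and b are values at the end
      -- points, m is the value at the tag, and replacing both by m costs O(width).
      normalised-secant-≋ : ∀ {a b m} k → Bounded a → Bounded b → Bounded m → a ≋ m → b ≋ m →
        (λ p → ofℝ (unitFraction k) *ᶜ secant k (a p) (b p)) ≋ m ^ᶠ k
      normalised-secant-≋ {m = m} k ba bb bm a≋m b≋m = ≋-trans
        (≋-* (bounded-secant k ba bb) (bounded-const _) ≋-refl (secant-≋ k ba bb bm a≋m b≋m))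
        (≈⇒≋ λ p → C.trans (C.*-congˡ (secant-diagonal k (m p))) (C.trans (C.sym (C.*-assoc _ _ (m p ^ᶜ k)))
          (C.trans (C.*-congʳ (C.trans (C.sym (ofℝ-* _ _)) (ofℝ-cong (trans (*-comm _ _) (inv-inverseʳ (ofℕ (suc k)) _)))))
            (C.*-identityˡ _))))

  open Families
  open TaggedInterval using (width; 0≤width)

  -- The Cayley transform and Lipschitz estimates

  module Arcs where

    2ᶜ : ℂ
    2ᶜ = ofℝ (ofℕ 2)

    abstract
      -- Inverses come out of abstract proofs and are known only through their defining equation;
      -- this is how two of them are identified.
      inverse-unique : ∀ {z w z′ w′} → z *ᶜ z′ ≈ᶜ 1ᶜ → w *ᶜ w′ ≈ᶜ 1ᶜ → z ≈ᶜ w → z′ ≈ᶜ w′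
      inverse-unique {z} {w} {z′} {w′} zz′≈1 ww′≈1 z≈w = C.trans (C.sym (C.*-identityʳ z′)) (C.trans (C.*-congˡ (C.sym ww′≈1))
        (C.trans (solveᶜ 3 (λ z′ w w′ → z′ :*ᶜ (w :*ᶜ w′) :=ᶜ (w :*ᶜ z′) :*ᶜ w′) C.refl z′ w w′)
          (C.trans (C.*-congʳ (C.trans (C.*-congʳ (C.sym z≈w)) zz′≈1)) (C.*-identityˡ w′))))

      inverse-difference : ∀ {z w z′ w′} → z *ᶜ z′ ≈ᶜ 1ᶜ → w *ᶜ w′ ≈ᶜ 1ᶜ → w′ -ᶜ z′ ≈ᶜ (z -ᶜ w) *ᶜ (z′ *ᶜ w′)
      inverse-difference {z} {w} {z′} {w′} zz′≈1 ww′≈1 = C.sym (C.trans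
        (solveᶜ 4 (λ z w z′ w′ → (z :-ᶜ w) :*ᶜ (z′ :*ᶜ w′)
           :=ᶜ (z :*ᶜ z′) :*ᶜ w′ :-ᶜ (w :*ᶜ w′) :*ᶜ z′) C.refl z w z′ w′)
        (C.+-cong (C.trans (C.*-congʳ zz′≈1) (C.*-identityˡ w′)) (C.-‿cong (C.trans (C.*-congʳ ww′≈1) (C.*-identityˡ z′)))))

      -- Multiplying d² ≤ |z|² by r²|w|² gives |w|² ≤ r², because dr = 1 and |zw| = 1.
      ‖inverse‖ : ∀ {z w d r} → z *ᶜ w ≈ᶜ 1ᶜ → 0# ≤ r → d * r ≈ 1# → d * d ≤ normSq z → ‖ w ‖≤ r
      ‖inverse‖ {z} {w} {d} {r} zw≈1 0≤r dr≈1 dd≤ = 0≤r ,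
        ≤-resp-≈ (trans (solve 3 (λ d r n → (r :* r) :* (d :* d :* n) := (d :* r) :* (d :* r) :* n) refl d r (normSq w))
                   (trans (*-congʳ (trans (*-cong dr≈1 dr≈1) (*-identityˡ 1#))) (*-identityˡ (normSq w))))
                 (trans (*-congˡ (trans (sym (normSq-* z w)) (trans (normSq-cong zw≈1) normSq-1))) (*-identityʳ (r * r)))
          (*-monoˡ-≤ (*-nonneg 0≤r 0≤r) (≤-resp-≈ (*-comm _ _) (*-comm _ _) (*-monoˡ-≤ (normSq-nonneg w) dd≤)))

      -- Turns a number given by its coordinates into a ring expression that the complex solver can
      -- use.
      1+si-split : ∀ s → 1# +i s ≈ᶜ 1ᶜ +ᶜ 𝕚 *ᶜ ofℝ s
      1+si-split s = solve 2 (λ u s → u := u :+ (con ℤ.0ℤ :* s :- u :* con ℤ.0ℤ)) refl 1# s ,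
        trans (sym (*-identityˡ s)) (solve 2 (λ u s → u :* s := con ℤ.0ℤ :+ (con ℤ.0ℤ :* con ℤ.0ℤ :+ u :* s)) refl 1# s)

      1-si-split : ∀ s → 1# +i (- s) ≈ᶜ 1ᶜ -ᶜ 𝕚 *ᶜ ofℝ s
      1-si-split s = C.trans (1+si-split (- s)) (C.+-congˡ (C.trans (C.*-congˡ (ofℝ-neg s))
        (solveᶜ 2 (λ i s → i :*ᶜ (:-ᶜ s) :=ᶜ :-ᶜ (i :*ᶜ s)) C.refl 𝕚 (ofℝ s))))

      ‖𝕚‖ : ‖ 𝕚 ‖≤ 1#
      ‖𝕚‖ = 0≤1 , ≤-reflexive (trans (+-congʳ (zeroˡ 0#)) (+-identityˡ _))

    1/1-si 1/1+si : ℝ → ℂ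
    1/1-si s = proj₁ (Unit-1+si (- s))
    1/1+si s = proj₁ (Unit-1+si s)

    abstract
      1-si-inverse : ∀ s → (1ᶜ -ᶜ 𝕚 *ᶜ ofℝ s) *ᶜ 1/1-si s ≈ᶜ 1ᶜ
      1-si-inverse s = C.trans (C.*-congʳ (C.sym (1-si-split s))) (proj₂ (proj₂ (Unit-1+si (- s))))

      1+si-inverse : ∀ s → (1ᶜ +ᶜ 𝕚 *ᶜ ofℝ s) *ᶜ 1/1+si s ≈ᶜ 1ᶜ
      1+si-inverse s = C.trans (C.*-congʳ (C.sym (1+si-split s))) (proj₂ (proj₂ (Unit-1+si s)))

      ‖1/1+si‖ : ∀ s → ‖ 1/1+si s ‖≤ 1#
      ‖1/1+si‖ s = ‖inverse‖ (proj₂ (proj₂ (Unit-1+si s))) 0≤1 (*-identityˡ 1#)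
        (0≤-⇒≤ (solve 2 (λ u s → s :* s := (u :* u :+ s :* s) :- u :* u) refl 1# s) (sq-nonneg s))

      ‖1/1-si‖ : ∀ s → ‖ 1/1-si s ‖≤ 1#
      ‖1/1-si‖ s = ‖1/1+si‖ (- s)

      1/1-si-cong : ∀ {s t} → s ≈ t → 1/1-si s ≈ᶜ 1/1-si t
      1/1-si-cong {s} {t} s≈t = inverse-unique (1-si-inverse s) (1-si-inverse t)
        (C.+-congˡ (C.-‿cong (C.*-congˡ (ofℝ-cong s≈t))))

      cayley-split : ∀ s → cayley s ≈ᶜ (1ᶜ +ᶜ 𝕚 *ᶜ ofℝ s) *ᶜ 1/1-si s
      cayley-split s = C.*-congʳ (1+si-split s)

      cayley-cong : ∀ {s t} → s ≈ t → cayley s ≈ᶜ cayley t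
      cayley-cong s≈t = C.*-cong (refl , s≈t) (1/1-si-cong s≈t)

      cayley-0 : cayley 0# ≈ᶜ 1ᶜ
      cayley-0 = C.trans (C.*-congˡ (inverse-unique (1-si-inverse 0#) (C.*-identityˡ 1ᶜ)
          (solveᶜ 2 (λ u i → u :-ᶜ i :*ᶜ conᶜ ℤ.0ℤ :=ᶜ u) C.refl 1ᶜ 𝕚)))
        (C.*-identityˡ 1ᶜ)

      𝕚² : 𝕚 *ᶜ 𝕚 ≈ᶜ -ᶜ 1ᶜ
      𝕚² = trans (+-congʳ (zeroˡ 0#)) (trans (+-identityˡ _) (-‿cong (*-identityˡ 1#))) ,
        trans (+-cong (zeroˡ 1#) (zeroʳ 1#)) (trans (+-identityˡ 0#) (sym RP.-0#≈0#))

      cayley-1 : cayley 1# ≈ᶜ 𝕚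
      cayley-1 = C.trans (cayley-split 1#) (C.trans (C.*-congʳ (C.sym (C.trans
          (solveᶜ 2 (λ i u → i :*ᶜ (u :-ᶜ i :*ᶜ u) :=ᶜ
            (:-ᶜ (i :*ᶜ i)) :*ᶜ u :+ᶜ i :*ᶜ u) C.refl 𝕚 1ᶜ)
          (C.+-congʳ (C.trans (C.*-congʳ (C.-‿cong 𝕚²)) (C.trans
            (solveᶜ 1 (λ u → (:-ᶜ (:-ᶜ u)) :*ᶜ u :=ᶜ u :*ᶜ u) C.refl 1ᶜ) (C.*-identityˡ 1ᶜ)))))))
        (C.trans (C.*-assoc 𝕚 _ (1/1-si 1#)) (C.trans (C.*-congˡ (1-si-inverse 1#)) (C.*-identityʳ 𝕚))))

      -- c′(s) = 2i / (1 − si)² for the Cayley transform c, in difference form.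
      cayley-difference : ∀ x y → cayley y -ᶜ cayley x ≈ᶜ (2ᶜ *ᶜ 𝕚) *ᶜ (1/1-si x *ᶜ 1/1-si y) *ᶜ ofℝ (y - x)
      cayley-difference x y = C.trans (C.+-cong (cayley-shift y) (C.-‿cong (cayley-shift x)))
        (C.trans (solveᶜ 3 (λ u v w → (conᶜ (+ 2) :*ᶜ u :-ᶜ w) :-ᶜ (conᶜ (+ 2) :*ᶜ v :-ᶜ w)
            :=ᶜ conᶜ (+ 2) :*ᶜ (u :-ᶜ v)) C.refl (1/1-si y) (1/1-si x) 1ᶜ)
          (C.trans (C.*-congˡ (inverse-difference (1-si-inverse x) (1-si-inverse y)))
            (C.trans (solveᶜ 7 (λ o i x y u v w → o :*ᶜ (((w :-ᶜ i :*ᶜ x) :-ᶜ (w :-ᶜ i :*ᶜ y)) :*ᶜ (u :*ᶜ v))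
                :=ᶜ (o :*ᶜ i) :*ᶜ (u :*ᶜ v) :*ᶜ (y :-ᶜ x)) C.refl 2ᶜ 𝕚 (ofℝ x) (ofℝ y) (1/1-si x) (1/1-si y) 1ᶜ)
              (C.*-congˡ (C.sym (ofℝ-minus y x))))))
        where
        -- (1 + si)/(1 - si) = 2/(1 - si) - 1, so increments of the Cayley transform are twice those
        -- of a reciprocal.
        cayley-shift : ∀ s → cayley s ≈ᶜ 2ᶜ *ᶜ 1/1-si s -ᶜ 1ᶜ
        cayley-shift s = C.trans (cayley-split s) (C.trans
          (C.trans (solveᶜ 4 (λ w i s u → (w :+ᶜ i :*ᶜ s) :*ᶜ u :=ᶜ
            conᶜ (+ 2) :*ᶜ (w :*ᶜ u) :-ᶜ (w :-ᶜ i :*ᶜ s) :*ᶜ u) C.refl 1ᶜ 𝕚 (ofℝ s) (1/1-si s))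
            (C.+-congʳ (C.*-congˡ (C.*-identityˡ (1/1-si s)))))
          (C.+-congˡ (C.-‿cong (1-si-inverse s))))

    record Lipschitz (f : ℝ → ℂ) : Set (c ⊔ ℓ₂) where
      constructor lipschitz
      field
        constant   : ℝ
        0≤constant : 0# ≤ constant
        holds      : ∀ {a b} → a ≤ b → ‖ f b -ᶜ f a ‖≤ constant * (b - a)

    abstract
      lipschitz-slope : ∀ {f} (g : ℝ → ℝ → ℂ) {k} → 0# ≤ k → (∀ a b → f b -ᶜ f a ≈ᶜ g a b *ᶜ ofℝ (b - a)) →
                        (∀ a b → ‖ g a b ‖≤ k) → Lipschitz f
      lipschitz-slope g {k} 0≤k slope g≤ = lipschitz k 0≤k λ {a} {b} a≤b →
        ‖‖-cong (C.sym (slope a b)) (‖‖-* (g≤ a b) (‖ofℝ‖ (≤⇒0≤- a≤b) (≤-reflexive refl)))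

      lipschitz-scale : ∀ {f} z → Lipschitz f → Lipschitz (λ s → z *ᶜ f s)
      lipschitz-scale {f} z (lipschitz k 0≤k h) = lipschitz ((normSq z + ofℕ 1) * k) (*-nonneg (proj₁ (‖‖-exists z)) 0≤k)
        λ {a} {b} a≤b → ‖‖-mono (≤-reflexive (sym (*-assoc _ k (b - a))))
          (‖‖-cong (solveᶜ 3 (λ z u v → z :*ᶜ (u :-ᶜ v) :=ᶜ z :*ᶜ u :-ᶜ z :*ᶜ v)
            C.refl z (f b) (f a)) (‖‖-* (‖‖-exists z) (h a≤b)))

      lipschitz-inverse : ∀ {f g k} → 0# ≤ k → (∀ s → f s *ᶜ g s ≈ᶜ 1ᶜ) → (∀ s → ‖ g s ‖≤ k) → Lipschitz f → Lipschitz g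
      lipschitz-inverse {f} {g} {k} 0≤k fg≈1 g≤ (lipschitz l 0≤l h) = lipschitz (l * (k * k)) (*-nonneg 0≤l (*-nonneg 0≤k 0≤k))
        λ {a} {b} a≤b → ‖‖-mono (≤-reflexive (solve 3 (λ l h k → (l :* h) :* (k :* k) := (l :* (k :* k)) :* h) refl l (b - a) k))
          (‖‖-cong (C.trans (solveᶜ 3 (λ u v w → (:-ᶜ (v :-ᶜ u)) :*ᶜ w :=ᶜ (u :-ᶜ v) :*ᶜ w)
               C.refl (f a) (f b) (g a *ᶜ g b)) (C.sym (inverse-difference (fg≈1 a) (fg≈1 b))))
            (‖‖-* (‖‖-neg (h a≤b)) (‖‖-* (g≤ a) (g≤ b))))

      lipschitz-ofℝ : Lipschitz ofℝ
      lipschitz-ofℝ = lipschitz 1# 0≤1 λ {a} {b} a≤b → ‖‖-cong (ofℝ-minus b a)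
        (‖ofℝ‖ (≤⇒0≤- a≤b) (≤-reflexive (sym (*-identityˡ (b - a)))))

      lipschitz-transfer : ∀ f {g} → (∀ a b → f b -ᶜ f a ≈ᶜ g b -ᶜ g a) → Lipschitz f → Lipschitz g
      lipschitz-transfer f e (lipschitz k 0≤k h) = lipschitz k 0≤k λ {a} {b} a≤b → ‖‖-cong (e a b) (h a≤b)

      lipschitz-1-si : Lipschitz (λ s → 1ᶜ -ᶜ 𝕚 *ᶜ ofℝ s)
      lipschitz-1-si = lipschitz-transfer (λ s → (-ᶜ 𝕚) *ᶜ ofℝ s) (λ a b →
        solveᶜ 4 (λ w i u v → (:-ᶜ i) :*ᶜ u :-ᶜ (:-ᶜ i) :*ᶜ v
          :=ᶜ (w :-ᶜ i :*ᶜ u) :-ᶜ (w :-ᶜ i :*ᶜ v)) C.refl 1ᶜ 𝕚 (ofℝ b) (ofℝ a))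
        (lipschitz-scale (-ᶜ 𝕚) lipschitz-ofℝ)

      lipschitz-1/1-si : Lipschitz 1/1-si
      lipschitz-1/1-si = lipschitz-inverse 0≤1 1-si-inverse ‖1/1-si‖ lipschitz-1-si

      lipschitz-cayley : Lipschitz cayley
      lipschitz-cayley = lipschitz-slope (λ x y → (2ᶜ *ᶜ 𝕚) *ᶜ (1/1-si x *ᶜ 1/1-si y))
        (*-nonneg (proj₁ (‖‖-exists (2ᶜ *ᶜ 𝕚))) (*-nonneg 0≤1 0≤1)) cayley-difference
        λ x y → ‖‖-* (‖‖-exists (2ᶜ *ᶜ 𝕚)) (‖‖-* (‖1/1-si‖ x) (‖1/1-si‖ y))

      -- The tag lies between the end points, so its distance from either is at most the width; the
      -- Lipschitz constant becomes the rate.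
      atˣ≋atᵗ : ∀ {f} → Lipschitz f → atˣ f ≋ atᵗ f
      atˣ≋atᵗ (lipschitz k 0≤k h) = ≋-sym (mk≋ k 0≤k λ p → let open TaggedInterval p in
        ‖‖-mono (*-monoˡ-≤ 0≤k (+-mono-≤ τ≤y (≤-reflexive refl))) (h x≤τ))

      atʸ≋atᵗ : ∀ {f} → Lipschitz f → atʸ f ≋ atᵗ f
      atʸ≋atᵗ (lipschitz k 0≤k h) = mk≋ k 0≤k λ p → let open TaggedInterval p in
        ‖‖-mono (*-monoˡ-≤ 0≤k (0≤-⇒≤ (solve 3 (λ x τ y → τ :- x := (y :- x) :- (y :- τ)) refl x τ y) (≤⇒0≤- x≤τ))) (h τ≤y)

  open Arcs

  -- Integrals of the powers that have a primitive on the circle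

  module CirclePowers where

    abstract
      arc-cong : ∀ ε q {s t} → s ≈ t → pt (arc ε q s) ≈ᶜ pt (arc ε q t)
      arc-cong ε q s≈t = C.*-congˡ (cayley-cong s≈t)

      arc-0 : ∀ ε q → pt (arc ε q 0#) ≈ᶜ ofℝ ε *ᶜ 𝕚 ^ᶜ toℕ q
      arc-0 ε q = C.trans (C.*-congˡ cayley-0) (C.*-identityʳ _)

      arc-1 : ∀ ε q → pt (arc ε q 1#) ≈ᶜ ofℝ ε *ᶜ 𝕚 ^ᶜ suc (toℕ q)
      arc-1 ε q = C.trans (C.*-congˡ cayley-1) (C.trans (C.*-assoc (ofℝ ε) (𝕚 ^ᶜ toℕ q) 𝕚) (C.*-congˡ (C.*-comm (𝕚 ^ᶜ toℕ q) 𝕚)))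

      𝕚⁴ : 𝕚 ^ᶜ 4 ≈ᶜ 𝕚 ^ᶜ 0
      𝕚⁴ = C.trans (solveᶜ 2 (λ i u → i :*ᶜ (i :*ᶜ (i :*ᶜ (i :*ᶜ u))) :=ᶜ
              (i :*ᶜ i) :*ᶜ (i :*ᶜ i) :*ᶜ u) C.refl 𝕚 1ᶜ)
        (C.trans (C.*-congʳ (C.*-cong 𝕚² 𝕚²)) (C.trans
          (solveᶜ 1 (λ u → (:-ᶜ u) :*ᶜ (:-ᶜ u) :*ᶜ u :=ᶜ u :*ᶜ u :*ᶜ u) C.refl 1ᶜ)
          (C.trans (C.*-congʳ (C.*-identityˡ 1ᶜ)) (C.*-identityˡ 1ᶜ))))

      lipschitz-arc : ∀ ε q → Lipschitz (pt ∘ arc ε q)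
      lipschitz-arc ε q = lipschitz-scale (ofℝ ε *ᶜ 𝕚 ^ᶜ toℕ q) lipschitz-cayley

    module _ {ε} (0<ε : 0# < ε) where

      recip : Circle ε → ℂ
      recip z = proj₁ (Unit-circle 0<ε z)

      abstract
        recip-inverse : ∀ z → pt z *ᶜ recip z ≈ᶜ 1ᶜ
        recip-inverse z = proj₂ (proj₂ (Unit-circle 0<ε z))

        recip-cong : ∀ {z w} → pt z ≈ᶜ pt w → recip z ≈ᶜ recip w
        recip-cong {z} {w} = inverse-unique (recip-inverse z) (recip-inverse w)

        ‖pt‖ : ∀ (z : Circle ε) → ‖ pt z ‖≤ ε
        ‖pt‖ (z , e) = <⇒≤ 0<ε , ≤-reflexive e

        ε#0 : ε # 0#
        ε#0 = #-sym (<⇒# 0<ε)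

        0<1/ε : 0# < inv ε ε#0
        0<1/ε = inverse-pos 0<ε (inv-inverseʳ ε ε#0)

        ‖recip‖ : ∀ z → ‖ recip z ‖≤ inv ε ε#0
        ‖recip‖ z = ‖inverse‖ (recip-inverse z) (<⇒≤ 0<1/ε) (inv-inverseʳ ε ε#0) (≤-reflexive (sym (proj₂ z)))

        lipschitz-recip : ∀ q → Lipschitz (recip ∘ arc ε q)
        lipschitz-recip q = lipschitz-inverse (<⇒≤ 0<1/ε) (λ s → recip-inverse (arc ε q s)) (λ s → ‖recip‖ (arc ε q s)) (lipschitz-arc ε q)

        bounded-pt : (p : TaggedInterval → Circle ε) → Bounded (pt ∘ p)
        bounded-pt p = bounded ε (<⇒≤ 0<ε) (λ i → ‖pt‖ (p i))

        bounded-recip : (p : TaggedInterval → Circle ε) → Bounded (recip ∘ p)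
        bounded-recip p = bounded (inv ε ε#0) (<⇒≤ 0<1/ε) (λ i → ‖recip‖ (p i))

        -- The error Δz · (G - f) is a product of two factors of order O(width), hence quadratic,
        -- and B can be constant.
        slope⇒primitive : ∀ q {f P : Circle ε → ℂ} {G : Family} →
          (∀ {z w} → pt z ≈ᶜ pt w → P z ≈ᶜ P w) →
          (∀ p → atʸ (P ∘ arc ε q) p -ᶜ atˣ (P ∘ arc ε q) p ≈ᶜ (atʸ (pt ∘ arc ε q) p -ᶜ atˣ (pt ∘ arc ε q) p) *ᶜ G p) →
          G ≋ atᵗ (f ∘ arc ε q) →
          ∀ {e} → 0# < e → ApproximatePrimitive (arc ε q) f (P (arc ε q 1#) -ᶜ P (arc ε q 0#)) e
        slope⇒primitive q {f} {P} {G} P-cong slope (mk≋ k 0≤k G≋) {e} 0<e = record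
          { F       = P ∘ arc ε q
          ; B       = λ _ → 0#
          ; K       = l * k
          ; 0≤K     = *-nonneg 0≤l 0≤k
          ; F-cong  = λ x≈y → P-cong (arc-cong ε q x≈y)
          ; B-cong  = λ _ → refl
          ; bound   = λ {x} {τ} {y} 0≤x x≤τ τ≤y y≤1 →
              let p = record { 0≤x = 0≤x ; x≤τ = x≤τ ; τ≤y = τ≤y ; y≤1 = y≤1 }
                  Δz = pt (arc ε q y) -ᶜ pt (arc ε q x)
              in ‖‖-mono (≤-reflexive (solve 3 (λ l k h → (l :* h) :* (k :* h) := (l :* k) :* (h :* h) :+ (con ℤ.0ℤ :- con ℤ.0ℤ)) refl l k (y - x)))
                 (‖‖-cong (C.sym (C.trans (C.+-congʳ (slope p))
                     (solveᶜ 3 (λ d g f → d :*ᶜ g :-ᶜ f :*ᶜ d :=ᶜ d :*ᶜ (g :-ᶜ f)) C.refl Δz (G p) (f (arc ε q τ)))))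
                   (‖‖-* (h (≤-trans x≤τ τ≤y)) (G≋ p)))
          ; F-total = ‖‖-cong (C.sym (C.-‿inverseʳ (P (arc ε q 1#) -ᶜ P (arc ε q 0#)))) (‖‖-mono (<⇒≤ 0<e) ‖0‖)
          ; B-total = ≤-resp-≈ (sym (-‿inverseʳ 0#)) refl (<⇒≤ 0<e)
          }
          where
          open Lipschitz (lipschitz-arc ε q) renaming (constant to l; 0≤constant to 0≤l; holds to h)

        -- P depends only on the point of the circle. Each quarter ends where the next one starts,
        -- and i⁴ = 1 closes the last one up with the first, so the four differences of P cancel.
        primitive⇒circleIntegral : ∀ {f : Circle ε → ℂ} (P : Circle ε → ℂ) → (G : Fin 4 → Family) →
          (∀ {z w} → pt z ≈ᶜ pt w → P z ≈ᶜ P w) →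
          (∀ q p → atʸ (P ∘ arc ε q) p -ᶜ atˣ (P ∘ arc ε q) p ≈ᶜ (atʸ (pt ∘ arc ε q) p -ᶜ atˣ (pt ∘ arc ε q) p) *ᶜ G q p) →
          (∀ q → G q ≋ atᵗ (f ∘ arc ε q)) → IsCircleIntegral ε f 0ᶜ
        primitive⇒circleIntegral {f} P G P-cong slope G≋ = (λ q → P (arc ε q 1#) -ᶜ P (arc ε q 0#)) ,
          (λ q → approximatePrimitives⇒integral (slope⇒primitive q {f} {P} {G q} P-cong (slope q) (G≋ q))) ,
          C.sym (C.trans (C.+-cong (C.+-congʳ (joint 𝟎 𝟏 C.refl)) (C.+-cong (C.+-congʳ (joint 𝟏 𝟐 C.refl))
            (C.+-cong (C.+-congʳ (joint 𝟐 𝟑 C.refl)) (C.+-congʳ (C.+-congʳ (joint 𝟑 𝟎 𝕚⁴))))))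
            (solveᶜ 4 (λ a b d e → (b :-ᶜ a) :+ᶜ ((d :-ᶜ b) :+ᶜ ((e :-ᶜ d) :+ᶜ ((a :-ᶜ e) :+ᶜ conᶜ ℤ.0ℤ)))
               :=ᶜ conᶜ ℤ.0ℤ) C.refl (start 𝟎) (start 𝟏) (start 𝟐) (start 𝟑)))
          where
          𝟎 𝟏 𝟐 𝟑 : Fin 4
          𝟎 = zero
          𝟏 = suc zero
          𝟐 = suc (suc zero)
          𝟑 = suc (suc (suc zero))
          start : Fin 4 → ℂ
          start q = P (arc ε q 0#)
          joint : ∀ q r → 𝕚 ^ᶜ suc (toℕ q) ≈ᶜ 𝕚 ^ᶜ toℕ r → P (arc ε q 1#) ≈ᶜ start r
          joint q r e = P-cong (C.trans (arc-1 ε q) (C.trans (C.*-congˡ e) (C.sym (arc-0 ε r))))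

        ∮-power : ∀ k → IsCircleIntegral ε (λ z → pt z ^ᶜ k) 0ᶜ
        ∮-power k = primitive⇒circleIntegral {λ z → pt z ^ᶜ k} (λ z → ofℝ (unitFraction k) *ᶜ pt z ^ᶜ suc k)
          (λ q p → ofℝ (unitFraction k) *ᶜ secant k (atˣ (pt ∘ arc ε q) p) (atʸ (pt ∘ arc ε q) p))
          (λ z≈w → C.*-congˡ (XC.^-congˡ (suc k) z≈w))
          (λ q p → slope (ofℝ (unitFraction k)) (atˣ (pt ∘ arc ε q) p) (atʸ (pt ∘ arc ε q) p))
          (λ q → normalised-secant-≋ k (bounded-pt (λ p → arc ε q (TaggedInterval.x p))) (bounded-pt (λ p → arc ε q (TaggedInterval.y p)))
              (bounded-pt (λ p → arc ε q (TaggedInterval.τ p)))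
            (atˣ≋atᵗ (lipschitz-arc ε q)) (atʸ≋atᵗ (lipschitz-arc ε q)))
          where
          slope : ∀ r a b → r *ᶜ b ^ᶜ suc k -ᶜ r *ᶜ a ^ᶜ suc k ≈ᶜ (b -ᶜ a) *ᶜ (r *ᶜ secant k a b)
          slope r a b = C.trans (solveᶜ 3 (λ r p q → r :*ᶜ q :-ᶜ r :*ᶜ p :=ᶜ r :*ᶜ (q :-ᶜ p)) C.refl r (a ^ᶜ suc k) (b ^ᶜ suc k))
            (C.trans (C.*-congˡ (secant-slope k a b))
              (solveᶜ 3 (λ r d s → r :*ᶜ (d :*ᶜ s) :=ᶜ d :*ᶜ (r :*ᶜ s)) C.refl r (b -ᶜ a) (secant k a b)))

        -- The primitive is -w^(k+1)/(k+1) with w = 1/z. Measuring its slope against z instead of w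
        -- brings in the product of the two end point reciprocals (`inverse-difference`), and this
        -- supplies the two extra powers of w.
        ∮-recip-power : ∀ k → IsCircleIntegral ε (λ z → recip z ^ᶜ suc (suc k)) 0ᶜ
        ∮-recip-power k = primitive⇒circleIntegral {λ z → recip z ^ᶜ suc (suc k)} (λ z → -ᶜ (ofℝ (unitFraction k) *ᶜ recip z ^ᶜ suc k))
          (λ q p → (atˣ (recip ∘ arc ε q) p *ᶜ atʸ (recip ∘ arc ε q) p) *ᶜ
                   (ofℝ (unitFraction k) *ᶜ secant k (atˣ (recip ∘ arc ε q) p) (atʸ (recip ∘ arc ε q) p)))
          (λ {z} {w} z≈w → C.-‿cong (C.*-congˡ (XC.^-congˡ (suc k) (recip-cong {z} {w} z≈w))))
          (λ q p → slope (ofℝ (unitFraction k)) (recip-inverse (arc ε q (TaggedInterval.x p))) (recip-inverse (arc ε q (TaggedInterval.y p))))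
          (λ q → ≋-trans (≋-* (bounded-* (bounded-const _) (bounded-secant k (bounded-recip _) (bounded-recip _)))
               (bounded-* (bounded-recip (λ p → arc ε q (TaggedInterval.τ p))) (bounded-recip (λ p → arc ε q (TaggedInterval.τ p))))
               (≋-* (bounded-recip _) (bounded-recip _) (atˣ≋atᵗ (lipschitz-recip q)) (atʸ≋atᵗ (lipschitz-recip q)))
               (normalised-secant-≋ k (bounded-recip _) (bounded-recip _) (bounded-recip (λ p → arc ε q (TaggedInterval.τ p)))
                 (atˣ≋atᵗ (lipschitz-recip q)) (atʸ≋atᵗ (lipschitz-recip q))))
             (≈⇒≋ λ p → C.*-assoc _ _ _))
          where
          slope : ∀ r {z w z′ w′} → z *ᶜ z′ ≈ᶜ 1ᶜ → w *ᶜ w′ ≈ᶜ 1ᶜ → (-ᶜ (r *ᶜ w′ ^ᶜ suc k)) -ᶜ (-ᶜ (r *ᶜ z′ ^ᶜ suc k))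
                  ≈ᶜ (w -ᶜ z) *ᶜ ((z′ *ᶜ w′) *ᶜ (r *ᶜ secant k z′ w′))
          slope r {z} {w} {z′} {w′} zz′≈1 ww′≈1 = C.trans
            (solveᶜ 3 (λ r p q → (:-ᶜ (r :*ᶜ q)) :-ᶜ (:-ᶜ (r :*ᶜ p)) :=ᶜ (:-ᶜ r) :*ᶜ (q :-ᶜ p)) C.refl r (z′ ^ᶜ suc k) (w′ ^ᶜ suc k))
            (C.trans (C.*-congˡ (C.trans (secant-slope k z′ w′) (C.*-congʳ (inverse-difference zz′≈1 ww′≈1))))
              (solveᶜ 5 (λ r z w m s → (:-ᶜ r) :*ᶜ (((z :-ᶜ w) :*ᶜ m) :*ᶜ s) :=ᶜ
                 (w :-ᶜ z) :*ᶜ (m :*ᶜ (r :*ᶜ s))) C.refl r z w (z′ *ᶜ w′) (secant k z′ w′)))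

  open CirclePowers

  -- Partial sums of the arctangent series

  module ArctanPolynomials where

    sign : ℕ → ℂ
    sign m = ofℝ ((- 1#) ^ʳ m)

    arctanPoly : ℕ → ℝ → ℂ
    arctanPoly zero    s = 0ᶜ
    arctanPoly (suc m) s = arctanPoly m s +ᶜ sign m *ᶜ (ofℝ (unitFraction (2 ℕ.* m)) *ᶜ ofℝ s ^ᶜ suc (2 ℕ.* m))

    -- The difference quotient of `arctanPoly` over the interval, written without division.
    arctanSecant : ℕ → Family
    arctanSecant zero    = const 0ᶜ
    arctanSecant (suc m) = arctanSecant m ⊕ const (sign m) ⊛ (λ p → ofℝ (unitFraction (2 ℕ.* m)) *ᶜ secant (2 ℕ.* m) (atˣ ofℝ p) (atʸ ofℝ p))

    -- The derivative of `arctanPoly`: a partial sum of the series of 1/(1 + a²).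
    geometric : ℕ → ℂ → ℂ
    geometric zero    a = 0ᶜ
    geometric (suc m) a = geometric m a +ᶜ sign m *ᶜ a ^ᶜ (2 ℕ.* m)

    abstract
      sign-suc : ∀ m → sign (suc m) ≈ᶜ -ᶜ sign m
      sign-suc m = C.trans (ofℝ-cong (RP.-1*x≈-x _)) (ofℝ-neg _)

      ‖sign‖ : ∀ m → ‖ sign m ‖≤ 1#
      ‖sign‖ zero    = ‖1‖
      ‖sign‖ (suc m) = ‖‖-cong (C.sym (sign-suc m)) (‖‖-neg (‖sign‖ m))

      arctanPoly-cong : ∀ m {s t} → s ≈ t → arctanPoly m s ≈ᶜ arctanPoly m t
      arctanPoly-cong zero    s≈t = C.refl
      arctanPoly-cong (suc m) s≈t = C.+-cong (arctanPoly-cong m s≈t)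
        (C.*-congˡ (C.*-congˡ (XC.^-congˡ (suc (2 ℕ.* m)) (ofℝ-cong s≈t))))

      arctanPoly-0 : ∀ m → arctanPoly m 0# ≈ᶜ 0ᶜ
      arctanPoly-0 zero    = C.refl
      arctanPoly-0 (suc m) = C.trans (C.+-cong (arctanPoly-0 m)
        (C.trans (C.*-congˡ (C.trans (C.*-congˡ (C.zeroˡ (0ᶜ ^ᶜ (2 ℕ.* m)))) (C.zeroʳ _))) (C.zeroʳ (sign m)))) (C.+-identityˡ 0ᶜ)

      arctanPoly-1 : ∀ m → arctanPoly m 1# ≈ᶜ ofℝ (leibniz m)
      arctanPoly-1 zero    = C.refl
      arctanPoly-1 (suc m) = C.trans (C.+-cong (arctanPoly-1 m)
        (C.trans (C.*-congˡ (C.trans (C.*-congˡ (1^ (suc (2 ℕ.* m)))) (C.*-identityʳ _))) (C.sym (ofℝ-* _ _)))) (C.sym (ofℝ-+ _ _))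

      arctanPoly-slope : ∀ m p → atʸ (arctanPoly m) p -ᶜ atˣ (arctanPoly m) p ≈ᶜ ofℝ (width p) *ᶜ arctanSecant m p
      arctanPoly-slope zero p = C.trans (C.-‿inverseʳ 0ᶜ) (C.sym (C.zeroʳ _))
      arctanPoly-slope (suc m) p = C.trans
        (solveᶜ 6 (λ f g s r b a → (g :+ᶜ s :*ᶜ (r :*ᶜ b)) :-ᶜ (f :+ᶜ s :*ᶜ (r :*ᶜ a))
           :=ᶜ (g :-ᶜ f) :+ᶜ s :*ᶜ (r :*ᶜ (b :-ᶜ a))) C.refl
           (arctanPoly m x) (arctanPoly m y) (sign m) r (ofℝ y ^ᶜ suc (2 ℕ.* m)) (ofℝ x ^ᶜ suc (2 ℕ.* m)))
        (C.trans (C.+-cong (arctanPoly-slope m p) (C.*-congˡ (C.*-congˡ (C.trans (secant-slope (2 ℕ.* m) (ofℝ x) (ofℝ y)) (C.*-congʳ (C.sym (ofℝ-minus y x)))))))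
          (solveᶜ 5 (λ h f s r q → h :*ᶜ f :+ᶜ s :*ᶜ (r :*ᶜ (h :*ᶜ q))
            :=ᶜ h :*ᶜ (f :+ᶜ s :*ᶜ (r :*ᶜ q))) C.refl
            (ofℝ (width p)) (arctanSecant m p) (sign m) r (secant (2 ℕ.* m) (ofℝ x) (ofℝ y))))
        where
        open TaggedInterval p using (x; y)
        r : ℂ
        r = ofℝ (unitFraction (2 ℕ.* m))

      bounded-x : Bounded (atˣ ofℝ)
      bounded-x = bounded 1# 0≤1 λ p → let open TaggedInterval p in ‖ofℝ‖ 0≤x (≤-trans x≤τ (≤-trans τ≤y y≤1))

      bounded-τ : Bounded (atᵗ ofℝ)
      bounded-τ = bounded 1# 0≤1 λ p → let open TaggedInterval p in ‖ofℝ‖ (≤-trans 0≤x x≤τ) (≤-trans τ≤y y≤1)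

      bounded-y : Bounded (atʸ ofℝ)
      bounded-y = bounded 1# 0≤1 λ p → let open TaggedInterval p in ‖ofℝ‖ (≤-trans 0≤x (≤-trans x≤τ τ≤y)) y≤1

      real-secant-≋ : ∀ k → (λ p → ofℝ (unitFraction k) *ᶜ secant k (atˣ ofℝ p) (atʸ ofℝ p)) ≋ atᵗ ofℝ ^ᶠ k
      real-secant-≋ k = normalised-secant-≋ k bounded-x bounded-y bounded-τ (atˣ≋atᵗ lipschitz-ofℝ) (atʸ≋atᵗ lipschitz-ofℝ)

      arctanSecant-≋ : ∀ m → arctanSecant m ≋ atᵗ (geometric m ∘ ofℝ)
      arctanSecant-≋ zero    = ≋-refl
      arctanSecant-≋ (suc m) = ≋-+ (arctanSecant-≋ m)
        (≋-* (bounded-* (bounded-const _) (bounded-secant (2 ℕ.* m) bounded-x bounded-y)) (bounded-const (sign m)) ≋-refl (real-secant-≋ (2 ℕ.* m)))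

      geometric-sum : ∀ m a → geometric m a *ᶜ (1ᶜ +ᶜ a ^ᶜ 2) ≈ᶜ 1ᶜ -ᶜ sign m *ᶜ a ^ᶜ (2 ℕ.* m)
      geometric-sum zero a = C.trans (C.zeroˡ _) (C.sym (C.trans (C.+-congˡ (C.-‿cong (C.*-identityˡ 1ᶜ))) (C.-‿inverseʳ 1ᶜ)))
      geometric-sum (suc m) a = C.trans (C.distribʳ (1ᶜ +ᶜ a ^ᶜ 2) (geometric m a) _) (C.trans (C.+-congʳ (geometric-sum m a))
        (C.trans (C.+-congˡ (C.trans (C.distribˡ _ 1ᶜ (a ^ᶜ 2)) (C.+-congʳ (C.*-identityʳ _))))
          (C.trans (solveᶜ 4 (λ u s b a → (u :-ᶜ s :*ᶜ b) :+ᶜ (s :*ᶜ b :+ᶜ (s :*ᶜ b) :*ᶜ a)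
              :=ᶜ u :-ᶜ (:-ᶜ s) :*ᶜ (a :*ᶜ b)) C.refl 1ᶜ (sign m) (a ^ᶜ (2 ℕ.* m)) (a ^ᶜ 2))
            (C.+-congˡ (C.-‿cong (C.*-cong (C.sym (sign-suc m))
              (C.trans (C.*-congˡ (C.sym (XC.^-assocʳ a 2 m))) (XC.^-assocʳ a 2 (suc m)))))))))

    -- 1/(1 + s²) in factored form, since dz/z along an arc produces the two factors separately.
    arctan′ : ℝ → ℂ
    arctan′ s = 1/1-si s *ᶜ 1/1+si s

    abstract
      arctan′-inverse : ∀ s → (1ᶜ +ᶜ ofℝ s ^ᶜ 2) *ᶜ arctan′ s ≈ᶜ 1ᶜ
      arctan′-inverse s = C.trans (C.*-congʳ (C.sym (C.trans
          (solveᶜ 3 (λ w i s → (w :-ᶜ i :*ᶜ s) :*ᶜ (w :+ᶜ i :*ᶜ s) :=ᶜ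
            w :*ᶜ w :+ᶜ (:-ᶜ (i :*ᶜ i)) :*ᶜ (s :*ᶜ s)) C.refl 1ᶜ 𝕚 (ofℝ s))
          (C.+-cong (C.*-identityˡ 1ᶜ) (C.trans (C.*-congʳ (C.trans (C.-‿cong 𝕚²)
              (solveᶜ 1 (λ u → :-ᶜ (:-ᶜ u) :=ᶜ u) C.refl 1ᶜ)))
            (C.trans (C.*-identityˡ _) (C.*-congˡ (C.sym (C.*-identityʳ (ofℝ s))))))))))
        (C.trans (solveᶜ 4 (λ a b u v → (a :*ᶜ b) :*ᶜ (u :*ᶜ v) :=ᶜ (a :*ᶜ u) :*ᶜ (b :*ᶜ v)) C.refl
            (1ᶜ -ᶜ 𝕚 *ᶜ ofℝ s) (1ᶜ +ᶜ 𝕚 *ᶜ ofℝ s) (1/1-si s) (1/1+si s))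
          (C.trans (C.*-cong (1-si-inverse s) (1+si-inverse s)) (C.*-identityˡ 1ᶜ)))

      ‖arctan′‖ : ∀ s → ‖ arctan′ s ‖≤ 1#
      ‖arctan′‖ s = ‖‖-mono (≤-reflexive (*-identityˡ 1#)) (‖‖-* (‖1/1-si‖ s) (‖1/1+si‖ s))

      geometric-remainder : ∀ m s → geometric m (ofℝ s) -ᶜ arctan′ s ≈ᶜ -ᶜ (arctan′ s *ᶜ (sign m *ᶜ ofℝ s ^ᶜ (2 ℕ.* m)))
      geometric-remainder m s = C.trans (C.+-congʳ (C.trans (C.sym (C.*-identityʳ _)) (C.*-congˡ (C.sym (arctan′-inverse s)))))
        (C.trans (solveᶜ 3 (λ g d r → g :*ᶜ (d :*ᶜ r) :-ᶜ r :=ᶜ r :*ᶜ (g :*ᶜ d) :-ᶜ r) C.refl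
            (geometric m (ofℝ s)) (1ᶜ +ᶜ ofℝ s ^ᶜ 2) (arctan′ s))
          (C.trans (C.+-congʳ (C.*-congˡ (geometric-sum m (ofℝ s))))
            (C.trans (solveᶜ 3 (λ r u e → r :*ᶜ (u :-ᶜ e) :-ᶜ r :=ᶜ (r :*ᶜ u :-ᶜ r) :-ᶜ r :*ᶜ e) C.refl
               (arctan′ s) 1ᶜ (sign m *ᶜ ofℝ s ^ᶜ (2 ℕ.* m)))
              (C.trans (C.+-congʳ (C.trans (C.+-congʳ (C.*-identityʳ (arctan′ s))) (C.-‿inverseʳ (arctan′ s)))) (C.+-identityˡ _)))))

  open ArctanPolynomials

  -- The integral of dz/z

  module CircleLogarithm where

    -- πi/2, the value of the integral of dz/z over each quarter, whatever the radius.
    quarterTurn : ℂ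
    quarterTurn = (2ᶜ *ᶜ 𝕚) *ᶜ ofℝ π/4

    -- Δz/z divided by 2i · width, with Δz between the end points and z at the tag. If all three
    -- parameters coincide, it is 1/(1 + τ²).
    arctanIncrement : Family
    arctanIncrement p = (1/1-si x *ᶜ 1/1-si y) *ᶜ ((1ᶜ -ᶜ 𝕚 *ᶜ ofℝ τ) *ᶜ 1/1+si τ)
      where open TaggedInterval p using (x; τ; y)

    abstract
      ‖2𝕚‖ : ‖ 2ᶜ *ᶜ 𝕚 ‖≤ ofℕ 2
      ‖2𝕚‖ = ‖‖-mono (≤-reflexive (*-identityʳ (ofℕ 2))) (‖‖-* (‖ofℝ‖ (<⇒≤ (0<ofℕ-suc 1)) (≤-reflexive refl)) ‖𝕚‖)

      bounded-1/1-si : ∀ (s : TaggedInterval → ℝ) → Bounded (1/1-si ∘ s)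
      bounded-1/1-si s = bounded 1# 0≤1 λ p → ‖1/1-si‖ (s p)

      arctanIncrement-≋ : arctanIncrement ≋ atᵗ arctan′
      arctanIncrement-≋ = ≋-trans
        (≋-* bounded-conj (bounded-* (bounded-1/1-si TaggedInterval.τ) (bounded-1/1-si TaggedInterval.τ))
          (≋-* (bounded-1/1-si TaggedInterval.y) (bounded-1/1-si TaggedInterval.τ) (atˣ≋atᵗ lipschitz-1/1-si) (atʸ≋atᵗ lipschitz-1/1-si))
          ≋-refl)
        (≈⇒≋ λ p → simplify (TaggedInterval.τ p))
        where
        bounded-conj : Bounded (atᵗ λ s → (1ᶜ -ᶜ 𝕚 *ᶜ ofℝ s) *ᶜ 1/1+si s)
        bounded-conj = bounded-* (bounded-+ (bounded-const 1ᶜ) (bounded-neg (bounded-* (bounded-const 𝕚) bounded-τ)))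
          (bounded 1# 0≤1 λ p → ‖1/1+si‖ (TaggedInterval.τ p))
        simplify : ∀ s → (1/1-si s *ᶜ 1/1-si s) *ᶜ ((1ᶜ -ᶜ 𝕚 *ᶜ ofℝ s) *ᶜ 1/1+si s) ≈ᶜ arctan′ s
        simplify s = C.trans (solveᶜ 3 (λ u d v → (u :*ᶜ u) :*ᶜ (d :*ᶜ v) :=ᶜ (d :*ᶜ u) :*ᶜ (u :*ᶜ v)) C.refl
            (1/1-si s) (1ᶜ -ᶜ 𝕚 *ᶜ ofℝ s) (1/1+si s))
          (C.trans (C.*-congʳ (1-si-inverse s)) (C.*-identityˡ _))

      -- The factor ε i^q of the arc cancels against the one in 1/z, leaving the reciprocal of the
      -- Cayley transform. This removes radius and quarter from the computation.
      rotation-recip : ∀ {ε} (0<ε : 0# < ε) q s → (ofℝ ε *ᶜ 𝕚 ^ᶜ toℕ q) *ᶜ recip 0<ε (arc ε q s) ≈ᶜ (1ᶜ -ᶜ 𝕚 *ᶜ ofℝ s) *ᶜ 1/1+si s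
      rotation-recip {ε} 0<ε q s = inverse-unique
        (C.trans (solveᶜ 3 (λ c r w → c :*ᶜ (r :*ᶜ w) :=ᶜ (r :*ᶜ c) :*ᶜ w) C.refl
          (cayley s) (ofℝ ε *ᶜ 𝕚 ^ᶜ toℕ q) (recip 0<ε (arc ε q s))) (recip-inverse 0<ε (arc ε q s)))
        (C.trans (C.*-congʳ (cayley-split s)) (C.trans
          (solveᶜ 4 (λ a u b v → (a :*ᶜ u) :*ᶜ (b :*ᶜ v) :=ᶜ (b :*ᶜ u) :*ᶜ (a :*ᶜ v)) C.refl
            (1ᶜ +ᶜ 𝕚 *ᶜ ofℝ s) (1/1-si s) (1ᶜ -ᶜ 𝕚 *ᶜ ofℝ s) (1/1+si s))
          (C.trans (C.*-cong (1-si-inverse s) (1+si-inverse s)) (C.*-identityˡ 1ᶜ))))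
        (C.refl {cayley s})

      logarithmic-increment : ∀ {ε} (0<ε : 0# < ε) q p → let open TaggedInterval p using (x; τ; y) in
        recip 0<ε (arc ε q τ) *ᶜ (pt (arc ε q y) -ᶜ pt (arc ε q x)) ≈ᶜ (2ᶜ *ᶜ 𝕚) *ᶜ (ofℝ (width p) *ᶜ arctanIncrement p)
      logarithmic-increment {ε} 0<ε q p = C.trans
        (solveᶜ 4 (λ w r a b → w :*ᶜ (r :*ᶜ b :-ᶜ r :*ᶜ a) :=ᶜ (r :*ᶜ w) :*ᶜ (b :-ᶜ a)) C.refl
          (recip 0<ε (arc ε q τ)) (ofℝ ε *ᶜ 𝕚 ^ᶜ toℕ q) (cayley x) (cayley y))
        (C.trans (C.*-cong (rotation-recip 0<ε q τ) (cayley-difference x y))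
          (solveᶜ 4 (λ d i u h → d :*ᶜ (i :*ᶜ u :*ᶜ h) :=ᶜ i :*ᶜ (h :*ᶜ (u :*ᶜ d))) C.refl
            ((1ᶜ -ᶜ 𝕚 *ᶜ ofℝ τ) *ᶜ 1/1+si τ) (2ᶜ *ᶜ 𝕚) (1/1-si x *ᶜ 1/1-si y) (ofℝ (width p))))
        where open TaggedInterval p using (x; τ; y)

      ‖ofℝ‖⇒neg≤ : ∀ {x b} → ‖ ofℝ x ‖≤ b → - x ≤ b
      ‖ofℝ‖⇒neg≤ {x} (0≤b , p) = sq-cancel-≤ 0≤b (≤-resp-≈ (trans (normSq-ofℝ x) (solve 1 (λ x → x :* x := (:- x) :* (:- x)) refl x)) refl p)

      0≤^ : ∀ {x} k → 0# ≤ x → 0# ≤ x ^ʳ k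
      0≤^ zero    0≤x = 0≤1
      0≤^ (suc k) 0≤x = *-nonneg 0≤x (0≤^ k 0≤x)

    powerPrimitive : ℕ → ℝ → ℝ
    powerPrimitive k s = unitFraction k * s ^ʳ suc k

    abstract
      powerPrimitive-cong : ∀ k {s t} → s ≈ t → powerPrimitive k s ≈ powerPrimitive k t
      powerPrimitive-cong k s≈t = *-congˡ (ER.^-congˡ (suc k) s≈t)

      powerPrimitive-total : ∀ k → powerPrimitive k 1# - powerPrimitive k 0# ≈ unitFraction k
      powerPrimitive-total k = trans (+-cong (trans (*-congˡ (1^ʳ (suc k))) (*-identityʳ _))
          (trans (-‿cong (trans (*-congˡ (zeroˡ (0# ^ʳ k))) (zeroʳ _))) RP.-0#≈0#)) (+-identityʳ _)
        where
        1^ʳ : ∀ k → 1# ^ʳ k ≈ 1#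
        1^ʳ zero    = refl
        1^ʳ (suc k) = trans (*-identityˡ _) (1^ʳ k)

      -- A real inequality read off from a complex one: `real-secant-≋` bounds the modulus of
      -- increment - width · τ^k by K · width², and only one side of that bound is needed.
      power≤increment : ∀ k → ∃[ K ] (0# ≤ K × (∀ p → let open TaggedInterval p using (x; τ; y) in
        width p * τ ^ʳ k ≤ (powerPrimitive k y - powerPrimitive k x) + K * (width p * width p)))
      power≤increment k = K , 0≤K , λ p → let open TaggedInterval p using (x; τ; y) in
        0≤-⇒≤ (solve 3 (λ h Y k → k :- (:- (Y :- h)) := (Y :+ k) :- h) refl (width p * τ ^ʳ k) (powerPrimitive k y - powerPrimitive k x) (K * (width p * width p)))
          (≤⇒0≤- (‖ofℝ‖⇒neg≤ (‖‖-mono (≤-reflexive (solve 2 (λ h K → h :* (K :* h) := K :* (h :* h)) refl (width p) K))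
            (‖‖-cong (eq p) (‖‖-* (‖ofℝ‖ (0≤width p) (≤-reflexive refl)) (close p))))))
        where
        open _≋_ (real-secant-≋ k) renaming (rate to K; 0≤rate to 0≤K)
        eq : ∀ p → let open TaggedInterval p using (x; τ; y) in
          ofℝ (width p) *ᶜ (ofℝ (unitFraction k) *ᶜ secant k (ofℝ x) (ofℝ y) -ᶜ ofℝ τ ^ᶜ k) ≈ᶜ
          ofℝ ((powerPrimitive k y - powerPrimitive k x) - width p * τ ^ʳ k)
        eq p = C.trans (solveᶜ 4 (λ h u s t → h :*ᶜ (u :*ᶜ s :-ᶜ t) :=ᶜ u :*ᶜ (h :*ᶜ s) :-ᶜ h :*ᶜ t) C.refl
              (ofℝ (width p)) (ofℝ (unitFraction k)) (secant k (ofℝ x) (ofℝ y)) (ofℝ τ ^ᶜ k))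
          (C.trans (C.+-cong
              (C.trans (C.*-congˡ (C.trans (C.*-congʳ (ofℝ-minus y x)) (C.trans (C.sym (secant-slope k (ofℝ x) (ofℝ y)))
                  (C.trans (C.+-cong (C.sym (ofℝ-^ y (suc k))) (C.-‿cong (C.sym (ofℝ-^ x (suc k))))) (C.sym (ofℝ-minus _ _))))))
                (C.trans (C.sym (ofℝ-* _ _)) (ofℝ-cong (solve 3 (λ u a b → u :* (b :- a) := u :* b :- u :* a) refl (unitFraction k) (x ^ʳ suc k) (y ^ʳ suc k)))))
              (C.-‿cong (C.trans (C.*-congˡ (C.sym (ofℝ-^ τ k))) (C.sym (ofℝ-* _ _)))))
            (C.sym (ofℝ-minus _ _)))
          where open TaggedInterval p using (x; τ; y)

      -- The remainder of the Leibniz series at τ is at most τ^(2m), hence is paid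
      -- for by the increments of s^(2m+1)/(2m+1), whose total tends to 0 with 1/m.
      arctan-bound : ∀ m → ∃[ K ] (0# ≤ K × (∀ p → let open TaggedInterval p using (x; τ; y) in
        ‖ ofℝ (width p) *ᶜ (arctanSecant m p -ᶜ arctanIncrement p) ‖≤
          K * (width p * width p) + (powerPrimitive (2 ℕ.* m) y - powerPrimitive (2 ℕ.* m) x)))
      arctan-bound m = K + L , +-nonneg 0≤K 0≤L , λ p → ‖‖-mono (budget p)
        (‖‖-* (‖ofℝ‖ (0≤width p) (≤-reflexive refl)) (‖‖-cong (split p) (‖‖-+ (close p) (remainder p))))
        where
        open _≋_ (≋-+ (arctanSecant-≋ m) (≋-neg arctanIncrement-≋)) renaming (rate to K; 0≤rate to 0≤K)
        L : ℝ
        L = proj₁ (power≤increment (2 ℕ.* m))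
        0≤L : 0# ≤ L
        0≤L = proj₁ (proj₂ (power≤increment (2 ℕ.* m)))
        budget : ∀ p → let open TaggedInterval p using (x; τ; y) in
          width p * (K * width p + τ ^ʳ (2 ℕ.* m)) ≤ (K + L) * (width p * width p) + (powerPrimitive (2 ℕ.* m) y - powerPrimitive (2 ℕ.* m) x)
        budget p = ≤-trans (≤-reflexive (solve 3 (λ h K T → h :* (K :* h :+ T) := K :* (h :* h) :+ h :* T) refl (width p) K (τ ^ʳ (2 ℕ.* m))))
            (≤-trans (+-mono-≤ (≤-reflexive refl) (proj₂ (proj₂ (power≤increment (2 ℕ.* m))) p))
              (≤-reflexive (solve 4 (λ h K L Y → K :* (h :* h) :+ (Y :+ L :* (h :* h)) := (K :+ L) :* (h :* h) :+ Y) refl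
                (width p) K L (powerPrimitive (2 ℕ.* m) y - powerPrimitive (2 ℕ.* m) x))))
          where open TaggedInterval p using (x; τ; y)
        split : ∀ p → let open TaggedInterval p using (τ) in
          ((arctanSecant m p +ᶜ (-ᶜ arctanIncrement p)) -ᶜ (geometric m (ofℝ τ) +ᶜ (-ᶜ arctan′ τ))) +ᶜ (geometric m (ofℝ τ) -ᶜ arctan′ τ)
            ≈ᶜ arctanSecant m p -ᶜ arctanIncrement p
        split p = solveᶜ 2 (λ a b → (a :-ᶜ b) :+ᶜ b :=ᶜ a) C.refl
          (arctanSecant m p -ᶜ arctanIncrement p) (geometric m (ofℝ τ) -ᶜ arctan′ τ)
          where open TaggedInterval p using (τ)
        remainder : ∀ p → let open TaggedInterval p using (τ) in ‖ geometric m (ofℝ τ) -ᶜ arctan′ τ ‖≤ τ ^ʳ (2 ℕ.* m)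
        remainder p = ‖‖-cong (C.sym (geometric-remainder m τ)) (‖‖-neg (‖‖-mono (≤-reflexive (trans (*-identityˡ _) (*-identityˡ _)))
          (‖‖-* (‖arctan′‖ τ) (‖‖-* (‖sign‖ m) (‖‖-cong (ofℝ-^ τ (2 ℕ.* m)) (‖ofℝ‖ (0≤^ (2 ℕ.* m) (≤-trans 0≤x x≤τ)) (≤-reflexive refl)))))))
          where open TaggedInterval p using (τ; 0≤x; x≤τ)

      unitFraction-small : ∀ {δ} → 0# < δ → ∃[ N ] (∀ m → N ℕ.≤ m → unitFraction (2 ℕ.* m) < δ)
      unitFraction-small {δ} 0<δ = N , λ m N≤m → inverse-anti {x = inv δ δ#0} {y = ofℕ (suc (2 ℕ.* m))}
          0<δ (inverse-pos {x = ofℕ (suc (2 ℕ.* m))} (0<ofℕ-suc (2 ℕ.* m)) (inv-inverseʳ (ofℕ (suc (2 ℕ.* m))) _))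
          (trans (*-comm _ δ) (inv-inverseʳ δ δ#0)) (inv-inverseʳ (ofℕ (suc (2 ℕ.* m))) _)
          (<-trans (proj₂ (archimedean (inv δ δ#0))) (ofℕ-mono-< (ℕ.s≤s (ℕ.≤-trans N≤m (ℕ.m≤n*m m 2)))))
        where
        δ#0 : δ # 0#
        δ#0 = #-sym (<⇒# 0<δ)
        N : ℕ
        N = proj₁ (archimedean (inv δ δ#0))

      -- The degree of the polynomial depends on e: `F-total` needs the Leibniz sum near π/4,
      -- `B-total` needs 1/(2m + 1) small. The factor 2i of the primitive doubles every bound.
      arc-logarithm : ∀ {ε} (0<ε : 0# < ε) q {e} → 0# < e → ApproximatePrimitive (arc ε q) (recip 0<ε) quarterTurn e
      arc-logarithm {ε} 0<ε q {e} 0<e = record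
        { F       = F
        ; B       = B
        ; K       = ofℕ 2 * K
        ; 0≤K     = *-nonneg 0≤2 0≤K
        ; F-cong  = λ x≈y → C.*-congˡ (arctanPoly-cong m x≈y)
        ; B-cong  = λ x≈y → *-congˡ (powerPrimitive-cong (2 ℕ.* m) x≈y)
        ; bound   = λ 0≤x x≤τ τ≤y y≤1 → bound′ (record { 0≤x = 0≤x ; x≤τ = x≤τ ; τ≤y = τ≤y ; y≤1 = y≤1 })
        ; F-total = ‖‖-mono (≤-reflexive 2[d+d]≈e) (‖‖-cong total (‖‖-* ‖2𝕚‖ (‖ofℝ-abs‖ (widen (proj₂ (leibniz⟶π/4 d 0<d) m (ℕ.m≤m+n N M))))))
        ; B-total = ≤-trans (≤-reflexive (trans (solve 3 (λ o a b → o :* b :- o :* a := o :* (b :- a)) refl (ofℕ 2)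
              (powerPrimitive (2 ℕ.* m) 0#) (powerPrimitive (2 ℕ.* m) 1#)) (*-congˡ (powerPrimitive-total (2 ℕ.* m)))))
            (≤-trans (*-monoˡ-≤ 0≤2 (≤-trans (<⇒≤ (proj₂ (unitFraction-small 0<d) m (ℕ.m≤n+m M N))) (<⇒≤ d<d+d))) (≤-reflexive 2[d+d]≈e))
        }
        where
        d : ℝ
        d = proj₁ (quarter 0<e)
        0<d : 0# < d
        0<d = proj₁ (proj₂ (quarter 0<e))
        N M m : ℕ
        N = proj₁ (leibniz⟶π/4 d 0<d)
        M = proj₁ (unitFraction-small 0<d)
        -- Large enough for both requirements at once.
        m = N ℕ.+ M
        F : ℝ → ℂ
        F s = (2ᶜ *ᶜ 𝕚) *ᶜ arctanPoly m s
        B : ℝ → ℝ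
        B s = ofℕ 2 * powerPrimitive (2 ℕ.* m) s
        K : ℝ
        K = proj₁ (arctan-bound m)
        0≤K : 0# ≤ K
        0≤K = proj₁ (proj₂ (arctan-bound m))
        0≤2 : 0# ≤ ofℕ 2
        0≤2 = <⇒≤ (0<ofℕ-suc 1)
        d<d+d : d < d + d
        d<d+d = <-respˡ-≈ (+-identityˡ d) (+-monoˡ-< d 0<d)
        2[d+d]≈e : ofℕ 2 * (d + d) ≈ e
        2[d+d]≈e = trans (solve 1 (λ d → con (+ 2) :* (d :+ d) := (d :+ d) :+ (d :+ d)) refl d) (proj₂ (proj₂ (quarter 0<e)))
        bound′ : ∀ p → let open TaggedInterval p using (x; τ; y) in
          ‖ (F y -ᶜ F x) -ᶜ recip 0<ε (arc ε q τ) *ᶜ (pt (arc ε q y) -ᶜ pt (arc ε q x)) ‖≤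
          (ofℕ 2 * K) * ((y - x) * (y - x)) + (B y - B x)
        bound′ p = ‖‖-mono (≤-reflexive (solve 5 (λ o K h a b → o :* (K :* h :+ (b :- a)) := (o :* K) :* h :+ (o :* b :- o :* a)) refl
                (ofℕ 2) K (width p * width p) (powerPrimitive (2 ℕ.* m) x) (powerPrimitive (2 ℕ.* m) y)))
              (‖‖-cong (C.sym (C.trans (C.+-cong increment (C.-‿cong (logarithmic-increment 0<ε q p)))
                (solveᶜ 4 (λ i h a b → i :*ᶜ (h :*ᶜ a) :-ᶜ i :*ᶜ (h :*ᶜ b) :=ᶜ i :*ᶜ (h :*ᶜ (a :-ᶜ b))) C.refl
                  (2ᶜ *ᶜ 𝕚) (ofℝ (width p)) (arctanSecant m p) (arctanIncrement p))))
              (‖‖-* ‖2𝕚‖ (proj₂ (proj₂ (arctan-bound m)) p)))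
          where
          open TaggedInterval p using (x; τ; y)
          increment : F y -ᶜ F x ≈ᶜ (2ᶜ *ᶜ 𝕚) *ᶜ (ofℝ (width p) *ᶜ arctanSecant m p)
          increment = C.sym (C.trans (C.*-congˡ (C.sym (arctanPoly-slope m p)))
            (solveᶜ 3 (λ i a b → i :*ᶜ (b :-ᶜ a) :=ᶜ i :*ᶜ b :-ᶜ i :*ᶜ a) C.refl
              (2ᶜ *ᶜ 𝕚) (arctanPoly m x) (arctanPoly m y)))
        -- With d = e/4 the doubled bound 2(d + d) is exactly e.
        widen : ∀ {x} → ∣ x ∣< d → ∣ x ∣< (d + d)
        widen (l , r) = <-trans (0<-⇒< (<-respʳ-≈ (solve 1 (λ d → d := (:- d) :- (:- (d :+ d))) refl d) 0<d)) l , <-trans r d<d+d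
        total : (2ᶜ *ᶜ 𝕚) *ᶜ ofℝ (leibniz m - π/4) ≈ᶜ (F 1# -ᶜ F 0#) -ᶜ quarterTurn
        total = C.trans (C.*-congˡ (ofℝ-minus (leibniz m) π/4)) (C.trans
          (solveᶜ 3 (λ i l k → i :*ᶜ (l :-ᶜ k) :=ᶜ (i :*ᶜ l :-ᶜ i :*ᶜ conᶜ ℤ.0ℤ) :-ᶜ i :*ᶜ k) C.refl (2ᶜ *ᶜ 𝕚) (ofℝ (leibniz m)) (ofℝ π/4))
          (C.+-congʳ (C.+-cong (C.*-congˡ (C.sym (arctanPoly-1 m))) (C.-‿cong (C.*-congˡ (C.sym (arctanPoly-0 m)))))))

      -- At r = π/4 the left side is `2π𝕚` by the definition of π.
      four-quarters : ∀ r → ofℝ (ofℕ 2 * (ofℕ 4 * r)) *ᶜ 𝕚 ≈ᶜ ∑ᶜ {4} (λ _ → (2ᶜ *ᶜ 𝕚) *ᶜ ofℝ r)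
      four-quarters r = C.trans (C.*-congʳ {𝕚} (C.trans (ofℝ-* (ofℕ 2) (ofℕ 4 * r)) (C.*-congˡ {2ᶜ} (ofℝ-* (ofℕ 4) r))))
        (solveᶜ 2 (λ i k → (conᶜ (+ 2) :*ᶜ (conᶜ (+ 4) :*ᶜ k)) :*ᶜ i :=ᶜ
          (conᶜ (+ 2) :*ᶜ i) :*ᶜ k :+ᶜ ((conᶜ (+ 2) :*ᶜ i) :*ᶜ k :+ᶜ
          ((conᶜ (+ 2) :*ᶜ i) :*ᶜ k :+ᶜ ((conᶜ (+ 2) :*ᶜ i) :*ᶜ k :+ᶜ conᶜ ℤ.0ℤ)))) C.refl 𝕚 (ofℝ r))

      ∮-recip : ∀ {ε} (0<ε : 0# < ε) → IsCircleIntegral ε (recip 0<ε) 2π𝕚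
      ∮-recip 0<ε = (λ _ → quarterTurn) , (λ q → approximatePrimitives⇒integral (arc-logarithm 0<ε q)) , four-quarters π/4

  open CircleLogarithm

  -- Linearity of path and circle integrals

  module Linearity where

    abstract
      ∑ᶜ-+ : ∀ {n} (f g : Vector ℂ n) → ∑ᶜ (λ k → f k +ᶜ g k) ≈ᶜ ∑ᶜ f +ᶜ ∑ᶜ g
      ∑ᶜ-+ = ΣC.∑-distrib-+

      ∑ᶜ-* : ∀ {n} z (f : Vector ℂ n) → z *ᶜ ∑ᶜ f ≈ᶜ ∑ᶜ (λ k → z *ᶜ f k)
      ∑ᶜ-* = ΣC.*-distribˡ-sum

      ∑ᶜ-0 : ∀ n → ∑ᶜ {n} (λ _ → 0ᶜ) ≈ᶜ 0ᶜ
      ∑ᶜ-0 = ΣC.sum-replicate-zero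

      weighted-cong : ∀ {n} {f g : Vector ℂ n} (d : Vector ℂ n) → (∀ k → f k ≈ᶜ g k) →
                      ∑ᶜ (λ k → f k *ᶜ d k) ≈ᶜ ∑ᶜ (λ k → g k *ᶜ d k)
      weighted-cong {f = f} {g} d f≈g = ΣC.sum-cong-≋ {x = λ k → f k *ᶜ d k} {y = λ k → g k *ᶜ d k} λ k → C.*-congʳ {d k} {f k} {g k} (f≈g k)

      weighted-+ : ∀ {n} (f g d : Vector ℂ n) →
                   ∑ᶜ (λ k → (f k +ᶜ g k) *ᶜ d k) ≈ᶜ ∑ᶜ (λ k → f k *ᶜ d k) +ᶜ ∑ᶜ (λ k → g k *ᶜ d k)
      weighted-+ f g d = C.trans
        (ΣC.sum-cong-≋ {x = λ k → (f k +ᶜ g k) *ᶜ d k} {y = λ k → f k *ᶜ d k +ᶜ g k *ᶜ d k} λ k → C.distribʳ (d k) (f k) (g k))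
        (ΣC.∑-distrib-+ (λ k → f k *ᶜ d k) (λ k → g k *ᶜ d k))

      weighted-* : ∀ {n} z (f d : Vector ℂ n) → z *ᶜ ∑ᶜ (λ k → f k *ᶜ d k) ≈ᶜ ∑ᶜ (λ k → (z *ᶜ f k) *ᶜ d k)
      weighted-* z f d = C.trans (ΣC.*-distribˡ-sum z (λ k → f k *ᶜ d k))
        (ΣC.sum-cong-≋ {x = λ k → z *ᶜ (f k *ᶜ d k)} {y = λ k → (z *ᶜ f k) *ᶜ d k} λ k → C.sym (C.*-assoc z (f k) (d k)))

      ‖‖-normSq : ∀ {z a} → 0# ≤ a → normSq z < a * a → ‖ z ‖≤ a
      ‖‖-normSq 0≤a z<a² = 0≤a , <⇒≤ z<a²

      -- ab/(a + b) serves as a common lower bound, because the smaller of two reals cannot be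
      -- picked by a decision.
      lower-bound : ∀ {a b} → 0# < a → 0# < b → ∃[ η ] (0# < η × η ≤ a × η ≤ b)
      lower-bound {a} {b} 0<a 0<b = a * (b * r) , *-pos 0<a (*-pos 0<b 0<r) ,
        below (<⇒≤ (*-pos 0<a (*-pos 0<a 0<r))) (solve 3 (λ a b r → a :* (a :* r) := a :* ((a :+ b) :* r) :- a :* (b :* r)) refl a b r) ,
        below (<⇒≤ (*-pos 0<b (*-pos 0<b 0<r))) (solve 3 (λ a b r → b :* (b :* r) := b :* ((a :+ b) :* r) :- a :* (b :* r)) refl a b r)
        where
        0<a+b : 0# < a + b
        0<a+b = +-pos 0<a (<⇒≤ 0<b)
        r : ℝ
        r = inv (a + b) (#-sym (<⇒# 0<a+b))
        [a+b]r≈1 : (a + b) * r ≈ 1#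
        [a+b]r≈1 = inv-inverseʳ (a + b) _
        0<r : 0# < r
        0<r = inverse-pos 0<a+b [a+b]r≈1
        below : ∀ {x y d} → 0# ≤ d → d ≈ x * ((a + b) * r) - y → y ≤ x
        below 0≤d e = 0≤-⇒≤ (trans e (+-congʳ (trans (*-congˡ [a+b]r≈1) (*-identityʳ _)))) 0≤d

    module _ {ε} {γ : ℝ → Circle ε} where

      private
        increments : ∀ P → Vector ℂ (Partition.size P)
        increments P k = pt (γ (node (suc k))) -ᶜ pt (γ (node (inject₁ k)))
          where open Partition P

        values : (Circle ε → ℂ) → ∀ P → Vector ℂ (Partition.size P)
        values f P k = f (γ (Partition.tag P k))

      abstract
        path-cong : ∀ {f g J} → (∀ z → f z ≈ᶜ g z) → IsPathIntegral γ f J → IsPathIntegral γ g J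
        path-cong {f} {g} {J} f≈g I δ 0<δ = proj₁ (I δ 0<δ) , proj₁ (proj₂ (I δ 0<δ)) , λ P mesh →
          <-respˡ-≈ (normSq-cong (C.+-congʳ { -ᶜ J} (weighted-cong {f = values f P} {values g P} (increments P) λ k → f≈g (γ (Partition.tag P k))))) (proj₂ (proj₂ (I δ 0<δ)) P mesh)

        path-+ : ∀ {f g J K} → IsPathIntegral γ f J → IsPathIntegral γ g K → IsPathIntegral γ (λ z → f z +ᶜ g z) (J +ᶜ K)
        path-+ {f} {g} {J} {K} I I′ δ 0<δ = η , 0<η , λ P mesh →
          ‖‖<⇒normSq< (‖‖-cong (split P)
            (‖‖-+ (‖‖-normSq (<⇒≤ 0<e) (proj₂ (proj₂ (I e 0<e)) P λ k → <-≤-trans (mesh k) η≤a))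
                  (‖‖-normSq (<⇒≤ 0<e) (proj₂ (proj₂ (I′ e 0<e)) P λ k → <-≤-trans (mesh k) η≤b))))
            (<-respʳ-≈ (proj₂ (proj₂ (quarter 0<δ))) (<-respˡ-≈ (+-identityˡ (e + e)) (+-monoˡ-< (e + e) (+-pos 0<e (<⇒≤ 0<e)))))
          where
          e : ℝ
          e = proj₁ (quarter 0<δ)
          0<e : 0# < e
          0<e = proj₁ (proj₂ (quarter 0<δ))
          meshes : ∃[ η ] (0# < η × η ≤ proj₁ (I e 0<e) × η ≤ proj₁ (I′ e 0<e))
          meshes = lower-bound (proj₁ (proj₂ (I e 0<e))) (proj₁ (proj₂ (I′ e 0<e)))
          η : ℝ
          η = proj₁ meshes
          0<η : 0# < η
          0<η = proj₁ (proj₂ meshes)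
          η≤a : η ≤ proj₁ (I e 0<e)
          η≤a = proj₁ (proj₂ (proj₂ meshes))
          η≤b : η ≤ proj₁ (I′ e 0<e)
          η≤b = proj₂ (proj₂ (proj₂ meshes))
          split : ∀ P → (stieltjesSum γ f P -ᶜ J) +ᶜ (stieltjesSum γ g P -ᶜ K) ≈ᶜ stieltjesSum γ (λ z → f z +ᶜ g z) P -ᶜ (J +ᶜ K)
          split P = C.trans (solveᶜ 4 (λ s t j k → (s :-ᶜ j) :+ᶜ (t :-ᶜ k) :=ᶜ (s :+ᶜ t) :-ᶜ (j :+ᶜ k)) C.refl
              (stieltjesSum γ f P) (stieltjesSum γ g P) J K)
            (C.+-congʳ { -ᶜ (J +ᶜ K)} (C.sym (weighted-+ (values f P) (values g P) (increments P))))

        path-* : ∀ {f J} z → IsPathIntegral γ f J → IsPathIntegral γ (λ w → z *ᶜ f w) (z *ᶜ J)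
        path-* {f} {J} z I δ 0<δ = proj₁ (I e 0<e) , proj₁ (proj₂ (I e 0<e)) , λ P mesh →
          <-respˡ-≈ (trans (sym (normSq-* z (stieltjesSum γ f P -ᶜ J))) (normSq-cong (split P)))
            (scaled (normSq-nonneg (stieltjesSum γ f P -ᶜ J)) (proj₂ (proj₂ (I e 0<e)) P mesh))
          where
          k : ℝ
          -- A bound for |z| that stays positive at z = 0.
          k = normSq z + ofℕ 1
          0<k : 0# < k
          0<k = <-respʳ-≈ (+-comm _ _) (+-pos (0<ofℕ-suc 0) (normSq-nonneg z))
          e : ℝ
          e = proj₁ (small-multiple (<⇒≤ 0<k) 0<δ)
          0<e : 0# < e
          0<e = proj₁ (proj₂ (small-multiple (<⇒≤ 0<k) 0<δ))
          ke≤δ : k * e ≤ δ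
          ke≤δ = proj₂ (proj₂ (small-multiple (<⇒≤ 0<k) 0<δ))
          k²e²≤δ² : (e * e) * (k * k) ≤ δ * δ
          k²e²≤δ² = ≤-resp-≈ (solve 2 (λ k e → (k :* e) :* (k :* e) := (e :* e) :* (k :* k)) refl k e) refl
            (*-mono-≤ (<⇒≤ (*-pos 0<k 0<e)) (<⇒≤ 0<δ) ke≤δ ke≤δ)
          scaled : ∀ {N} → 0# ≤ N → N < e * e → normSq z * N < δ * δ
          scaled {N} 0≤N N<e² = ≤-<-trans (*-mono-≤ (normSq-nonneg z) 0≤N (proj₂ (‖‖-exists z)) (≤-reflexive (refl {N})))
            (<-≤-trans (<-respˡ-≈ (*-comm N (k * k)) (*-monoʳ-< (*-pos 0<k 0<k) N<e²)) k²e²≤δ²)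
          split : ∀ P → z *ᶜ (stieltjesSum γ f P -ᶜ J) ≈ᶜ stieltjesSum γ (λ w → z *ᶜ f w) P -ᶜ z *ᶜ J
          split P = C.trans (solveᶜ 3 (λ z s j → z :*ᶜ (s :-ᶜ j) :=ᶜ z :*ᶜ s :-ᶜ z :*ᶜ j) C.refl z (stieltjesSum γ f P) J)
            (C.+-congʳ { -ᶜ (z *ᶜ J)} (weighted-* z (values f P) (increments P)))

        path-0 : IsPathIntegral γ (λ _ → 0ᶜ) 0ᶜ
        path-0 δ 0<δ = 1# , 0<1 , λ P mesh → ‖‖<⇒normSq< (‖‖-cong (vanishes P) ‖0‖) 0<δ
          where
          vanishes : ∀ P → 0ᶜ ≈ᶜ stieltjesSum γ (λ _ → 0ᶜ) P -ᶜ 0ᶜ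
          vanishes P = C.sym (C.trans (C.+-congʳ { -ᶜ 0ᶜ} (C.trans
            (ΣC.sum-cong-≋ {x = λ k → 0ᶜ *ᶜ increments P k} {y = λ _ → 0ᶜ} λ k → C.zeroˡ (increments P k)) (ΣC.sum-replicate-zero (Partition.size P)))) (C.-‿inverseʳ 0ᶜ))

    module _ {ε : ℝ} where

      abstract
        ∮-cong : ∀ {f g I K} → (∀ z → f z ≈ᶜ g z) → I ≈ᶜ K → IsCircleIntegral ε f I → IsCircleIntegral ε g K
        ∮-cong {f} {g} {I} {K} f≈g I≈K (J , paths , total) =
          J , (λ q → path-cong {γ = arc ε q} {f} {g} {J q} f≈g (paths q)) , C.trans {K} {I} {∑ᶜ J} (C.sym {I} {K} I≈K) total

        ∮-+ : ∀ {f g I K} → IsCircleIntegral ε f I → IsCircleIntegral ε g K → IsCircleIntegral ε (λ z → f z +ᶜ g z) (I +ᶜ K)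
        ∮-+ {f} {g} {I} {K} (J , paths , total) (J′ , paths′ , total′) =
          (λ q → J q +ᶜ J′ q) , (λ q → path-+ {γ = arc ε q} {f} {g} {J q} {J′ q} (paths q) (paths′ q)) ,
          C.trans {I +ᶜ K} {∑ᶜ J +ᶜ ∑ᶜ J′} {∑ᶜ (λ q → J q +ᶜ J′ q)} (C.+-cong {I} {∑ᶜ J} {K} {∑ᶜ J′} total total′)
            (C.sym {∑ᶜ (λ q → J q +ᶜ J′ q)} {∑ᶜ J +ᶜ ∑ᶜ J′} (∑ᶜ-+ J J′))

        ∮-* : ∀ {f I} z → IsCircleIntegral ε f I → IsCircleIntegral ε (λ w → z *ᶜ f w) (z *ᶜ I)
        ∮-* {f} {I} z (J , paths , total) = (λ q → z *ᶜ J q) , (λ q → path-* {γ = arc ε q} {f} {J q} z (paths q)) ,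
          C.trans {z *ᶜ I} {z *ᶜ ∑ᶜ J} {∑ᶜ (λ q → z *ᶜ J q)} (C.*-congˡ {z} {I} {∑ᶜ J} total) (∑ᶜ-* z J)

        ∮-sum : ∀ {x} {X : Set x} {f : X → Circle ε → ℂ} {I : X → ℂ} → (∀ x → IsCircleIntegral ε (f x) (I x)) →
                ∀ xs → IsCircleIntegral ε (λ z → ∑ₗ (λ x → f x z) xs) (∑ₗ I xs)
        ∮-sum ∮f []       = (λ _ → 0ᶜ) , (λ q → path-0 {γ = arc ε q}) , C.sym {∑ᶜ {4} (λ _ → 0ᶜ)} {0ᶜ} (∑ᶜ-0 4)
        ∮-sum {f = f} {I} ∮f (x ∷ xs) = ∮-+ {f x} {λ z → ∑ₗ (λ x → f x z) xs} {I x} {∑ₗ I xs} (∮f x) (∮-sum {f = f} {I} ∮f xs)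

  open Linearity

  -- Iterated integrals of Laurent polynomials

  module LaurentIntegrals (t : ℕ) where

    -- z^(a-t-1), split into two natural powers so that no negative exponents occur.
    monomial : ∀ {ε} → 0# < ε → ℕ → Circle ε → ℂ
    monomial 0<ε a z = pt z ^ᶜ a *ᶜ recip 0<ε z ^ᶜ suc t

    -- The residue at 0 of z^(a-t-1), with the factor 2πi included.
    residue : ℕ → ℂ
    residue a = if does (a ℕ.≟ t) then 2π𝕚 else 0ᶜ

    abstract
      cancelʳ : ∀ {z w} → z *ᶜ w ≈ᶜ 1ᶜ → ∀ a b → z ^ᶜ a *ᶜ w ^ᶜ (a ℕ.+ b) ≈ᶜ w ^ᶜ b
      cancelʳ {z} {w} zw≈1 a b = C.trans (C.*-congˡ (XC.^-homo-* w a b)) (C.trans (C.sym (C.*-assoc (z ^ᶜ a) (w ^ᶜ a) (w ^ᶜ b)))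
        (C.trans (C.*-congʳ (power-inverse zw≈1 a)) (C.*-identityˡ _)))

      cancelˡ : ∀ {z w} → z *ᶜ w ≈ᶜ 1ᶜ → ∀ a b → z ^ᶜ (a ℕ.+ b) *ᶜ w ^ᶜ a ≈ᶜ z ^ᶜ b
      cancelˡ zw≈1 a b = C.trans (C.*-comm _ _) (cancelʳ (C.trans (C.*-comm _ _) zw≈1) a b)

      residue-≡ : residue t ≡ 2π𝕚
      residue-≡ = ≡.cong (if_then 2π𝕚 else 0ᶜ) (dec-true (t ℕ.≟ t) ≡.refl)

      residue-≢ : ∀ {a} → a ≢ t → residue a ≡ 0ᶜ
      residue-≢ {a} a≢t = ≡.cong (if_then 2π𝕚 else 0ᶜ) (dec-false (a ℕ.≟ t) a≢t)

      ∮-monomial : ∀ {ε} (0<ε : 0# < ε) a → IsCircleIntegral ε (monomial 0<ε a) (residue a)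
      ∮-monomial {ε} 0<ε a = cases (ℕ.<-cmp a t)
        where
        cases : Tri (a ℕ.< t) (a ≡ t) (t ℕ.< a) → IsCircleIntegral ε (monomial 0<ε a) (residue a)
        cases (tri≈ _ ≡.refl _) = ∮-cong
          (λ z → C.sym (C.trans (C.*-congˡ (C.reflexive (≡.cong (recip 0<ε z ^ᶜ_) (≡.sym (ℕ.+-comm t 1)))))
            (C.trans (cancelʳ (recip-inverse 0<ε z) t 1) (C.*-identityʳ _))))
          (C.reflexive (≡.sym residue-≡)) (∮-recip 0<ε)
        cases (tri< a<t a≢t _) = ∮-cong
          (λ z → C.sym (C.trans (C.*-congˡ (C.reflexive (≡.cong (recip 0<ε z ^ᶜ_) exponent))) (cancelʳ (recip-inverse 0<ε z) a (suc (suc k)))))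
          (C.reflexive (≡.sym (residue-≢ a≢t))) (∮-recip-power 0<ε k)
          where
          -- For a < t the exponent a - t - 1 is at most -2; it equals -(k + 2) with k = t - a - 1.
          k : ℕ
          k = t ℕ.∸ suc a
          exponent : suc t ≡ a ℕ.+ suc (suc k)
          exponent = ≡.trans (≡.cong suc (≡.sym (ℕ.m+[n∸m]≡n a<t))) (≡.sym (≡.trans (ℕ.+-suc a (suc k)) (≡.cong suc (ℕ.+-suc a k))))
        cases (tri> _ a≢t t<a) = ∮-cong
          (λ z → C.sym (C.trans (C.*-congʳ (C.reflexive (≡.cong (pt z ^ᶜ_) (≡.sym (ℕ.m+[n∸m]≡n t<a))))) (cancelˡ (recip-inverse 0<ε z) (suc t) (a ℕ.∸ suc t))))
          (C.reflexive (≡.sym (residue-≢ a≢t))) (∮-power 0<ε (a ℕ.∸ suc t))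

      -- The coefficients are arbitrary for the sake of the induction: the outermost variable is
      -- fixed during the inner integrations, so its monomial is absorbed into the coefficient.
      iterated-integral : ∀ {n} {ε : Vector ℝ n} (0<ε : ∀ k → 0# < ε k) {x} {X : Set x} (xs : List X)
        (coeff : X → ℂ) (exponent : X → Fin n → ℕ) {F : Torus ε → ℂ} →
        (∀ z → F z ≈ᶜ ∑ₗ (λ x → coeff x *ᶜ ∏ᶜ (λ k → monomial (0<ε k) (exponent x k) (z k))) xs) →
        IsIteratedIntegral ε F (∑ₗ (λ x → coeff x *ᶜ ∏ᶜ (residue ∘ exponent x)) xs)
      iterated-integral {zero} 0<ε xs coeff exponent F≈ = lift (C.sym (F≈ (λ ())))
      iterated-integral {suc n} {ε} 0<ε {X = X} xs coeff exponent {F} F≈ = G , inner-integral ,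
        ∮-cong {ε zero} {λ z → ∑ₗ (λ x → (coeff x *ᶜ rest x) *ᶜ monomial (0<ε zero) (exponent x zero) z) xs} {G}
          {∑ₗ (λ x → (coeff x *ᶜ rest x) *ᶜ residue (exponent x zero)) xs} {∑ₗ (λ x → coeff x *ᶜ ∏ᶜ (residue ∘ exponent x)) xs}
          (λ z → ∑ₗ-cong (λ x → swapʳ (coeff x) (rest x) (monomial (0<ε zero) (exponent x zero) z)) xs)
          (∑ₗ-cong (λ x → C.trans (swapʳ (coeff x) (rest x) (residue (exponent x zero))) (C.*-assoc (coeff x) (residue (exponent x zero)) (rest x))) xs)
          (∮-sum {ε zero} {f = λ x z → (coeff x *ᶜ rest x) *ᶜ monomial (0<ε zero) (exponent x zero) z}
            {λ x → (coeff x *ᶜ rest x) *ᶜ residue (exponent x zero)}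
            (λ x → ∮-* {ε zero} {monomial (0<ε zero) (exponent x zero)} {residue (exponent x zero)} (coeff x *ᶜ rest x)
              (∮-monomial (0<ε zero) (exponent x zero))) xs)
        where
        inner : Circle (ε zero) → X → ℂ
        inner z x = coeff x *ᶜ monomial (0<ε zero) (exponent x zero) z
        rest : X → ℂ
        rest x = ∏ᶜ (residue ∘ tail (exponent x))
        G : Circle (ε zero) → ℂ
        G z = ∑ₗ (λ x → inner z x *ᶜ rest x) xs
        swapʳ : ∀ a r m → (a *ᶜ r) *ᶜ m ≈ᶜ (a *ᶜ m) *ᶜ r
        swapʳ a r m = solveᶜ 3 (λ a r m → (a :*ᶜ r) :*ᶜ m :=ᶜ (a :*ᶜ m) :*ᶜ r) C.refl a r m
        tail-monomials : X → Torus (tail ε) → ℂ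
        tail-monomials x w = ∏ᶜ (λ k → monomial (0<ε (suc k)) (exponent x (suc k)) (w k))
        inner-integral : ∀ z → IsIteratedIntegral (tail ε) (λ w → F (z ∷ᵗ w)) (G z)
        inner-integral z = iterated-integral {n} {tail ε} (λ k → 0<ε (suc k)) xs (inner z) (λ x → tail (exponent x)) {λ w → F (z ∷ᵗ w)} λ w →
          C.trans {F (z ∷ᵗ w)} {∑ₗ (λ x → coeff x *ᶜ (monomial (0<ε zero) (exponent x zero) z *ᶜ tail-monomials x w)) xs} (F≈ (z ∷ᵗ w))
            (∑ₗ-cong (λ x → C.sym (C.*-assoc (coeff x) (monomial (0<ε zero) (exponent x zero) z) (tail-monomials x w))) xs)

  -- The Lagrange form of a divided difference

  module LagrangeSum where

    open CompleteHomogeneous C.commutativeSemiring public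

    factor : ∀ {n} → Vector ℂ n → Fin n → Fin n → ℂ
    factor z k j = if does (j Fin.≟ k) then 1ᶜ else z k -ᶜ z j

    lagrangeDenominator : ∀ {n} → Vector ℂ n → Fin n → ℂ
    lagrangeDenominator z k = ∏ᶜ (factor z k)

    -- u stands for the reciprocals of the Lagrange denominators.
    lagrangeSum : ∀ {n} → ℕ → Vector ℂ n → Vector ℂ n → ℂ
    lagrangeSum m z u = ∑ᶜ (λ k → z k ^ᶜ m *ᶜ u k)

    Reciprocals : ∀ {n} → Vector ℂ n → Vector ℂ n → Set ℓ₁
    Reciprocals z u = ∀ k → lagrangeDenominator z k *ᶜ u k ≈ᶜ 1ᶜ

    -- Removing a node w from the list deletes the factor z_k - w from each remaining denominator,
    -- so the new reciprocal is u_k (z_k - w).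
    withoutFirst withoutSecond : ∀ {n} (z u : Vector ℂ (suc (suc n))) → Vector ℂ (suc n)
    withoutFirst z u k = u (suc k) *ᶜ (z (suc k) -ᶜ z zero)
    withoutSecond z u zero    = u zero *ᶜ (z zero -ᶜ z (suc zero))
    withoutSecond z u (suc k) = u (suc (suc k)) *ᶜ (z (suc (suc k)) -ᶜ z (suc zero))

    abstract
      reciprocals-withoutFirst : ∀ {n} (z u : Vector ℂ (suc (suc n))) → Reciprocals z u → Reciprocals (tail z) (withoutFirst z u)
      reciprocals-withoutFirst z u du≈1 k = C.trans
        (solveᶜ 3 (λ d e u → d :*ᶜ (u :*ᶜ e) :=ᶜ (e :*ᶜ d) :*ᶜ u) C.refl
          (lagrangeDenominator (tail z) k) (z (suc k) -ᶜ z zero) (u (suc k))) (du≈1 (suc k))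

      reciprocals-withoutSecond : ∀ {n} (z u : Vector ℂ (suc (suc n))) → Reciprocals z u → Reciprocals (dropSecond z) (withoutSecond z u)
      reciprocals-withoutSecond z u du≈1 zero = C.trans
        (solveᶜ 4 (λ w p e u → (w :*ᶜ p) :*ᶜ (u :*ᶜ e) :=ᶜ (w :*ᶜ (e :*ᶜ p)) :*ᶜ u) C.refl
          1ᶜ (∏ᶜ λ k → z zero -ᶜ z (suc (suc k))) (z zero -ᶜ z (suc zero)) (u zero)) (du≈1 zero)
      reciprocals-withoutSecond z u du≈1 (suc k) = C.trans
        (solveᶜ 4 (λ a p e u → (a :*ᶜ p) :*ᶜ (u :*ᶜ e) :=ᶜ (a :*ᶜ (e :*ᶜ p)) :*ᶜ u) C.refl
          (z (suc (suc k)) -ᶜ z zero) (∏ᶜ λ j → factor (tail (tail z)) k j) (z (suc (suc k)) -ᶜ z (suc zero)) (u (suc (suc k)))) (du≈1 (suc (suc k)))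

      -- The recursion (z₁ - z₀) S = S(without z₀) - S(without z₁) of divided differences, arranged
      -- so as to match what `h-recurrence` and `h-recurrence₂` give for h.
      divided-difference : ∀ {n} m (z u : Vector ℂ (suc (suc n))) →
        z (suc zero) *ᶜ lagrangeSum m z u +ᶜ lagrangeSum m (dropSecond z) (withoutSecond z u) ≈ᶜ
        z zero *ᶜ lagrangeSum m z u +ᶜ lagrangeSum m (tail z) (withoutFirst z u)
      divided-difference m z u = C.trans
        (C.+-congˡ {z₁ *ᶜ lagrangeSum m z u} {lagrangeSum m (dropSecond z) (withoutSecond z u)} (C.+-congˡ {p₀ *ᶜ (u₀ *ᶜ (z₀ -ᶜ z₁))} (split z₁)))
        (C.trans (solveᶜ 8 (λ z₀ z₁ p₀ p₁ u₀ u₁ T V →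
            z₁ :*ᶜ (p₀ :*ᶜ u₀ :+ᶜ (p₁ :*ᶜ u₁ :+ᶜ T)) :+ᶜ (p₀ :*ᶜ (u₀ :*ᶜ (z₀ :-ᶜ z₁)) :+ᶜ (V :-ᶜ z₁ :*ᶜ T))
            :=ᶜ z₀ :*ᶜ (p₀ :*ᶜ u₀ :+ᶜ (p₁ :*ᶜ u₁ :+ᶜ T)) :+ᶜ (p₁ :*ᶜ (u₁ :*ᶜ (z₁ :-ᶜ z₀)) :+ᶜ (V :-ᶜ z₀ :*ᶜ T)))
            C.refl z₀ z₁ p₀ p₁ u₀ u₁ T V)
          (C.+-congˡ {z₀ *ᶜ lagrangeSum m z u} (C.+-congˡ {p₁ *ᶜ (u₁ *ᶜ (z₁ -ᶜ z₀))} (C.sym (split z₀)))))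
        where
        z₀ z₁ p₀ p₁ u₀ u₁ T V : ℂ
        z₀ = z zero
        z₁ = z (suc zero)
        p₀ = z₀ ^ᶜ m
        p₁ = z₁ ^ᶜ m
        u₀ = u zero
        u₁ = u (suc zero)
        T = ∑ᶜ (λ k → z (suc (suc k)) ^ᶜ m *ᶜ u (suc (suc k)))
        V = ∑ᶜ (λ k → z (suc (suc k)) ^ᶜ m *ᶜ (u (suc (suc k)) *ᶜ z (suc (suc k))))
        -- Pulls the removed node w out of the sum over the common nodes. Both removals then involve
        -- the same T and V, and one ring identity remains.
        splitSum : ∀ {n} w (p u v : Vector ℂ n) →
          ∑ᶜ (λ k → p k *ᶜ (u k *ᶜ (v k -ᶜ w))) ≈ᶜ ∑ᶜ (λ k → p k *ᶜ (u k *ᶜ v k)) -ᶜ w *ᶜ ∑ᶜ (λ k → p k *ᶜ u k)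
        splitSum {zero}  w p u v = solveᶜ 1 (λ w → conᶜ ℤ.0ℤ :=ᶜ conᶜ ℤ.0ℤ :-ᶜ w :*ᶜ conᶜ ℤ.0ℤ) C.refl w
        splitSum {suc n} w p u v = C.trans (C.+-congˡ {p zero *ᶜ (u zero *ᶜ (v zero -ᶜ w))} (splitSum w (tail p) (tail u) (tail v)))
          (solveᶜ 6 (λ w p u v X Y → p :*ᶜ (u :*ᶜ (v :-ᶜ w)) :+ᶜ (X :-ᶜ w :*ᶜ Y)
            :=ᶜ (p :*ᶜ (u :*ᶜ v) :+ᶜ X) :-ᶜ w :*ᶜ (p :*ᶜ u :+ᶜ Y)) C.refl
            w (p zero) (u zero) (v zero) (∑ᶜ (λ k → p (suc k) *ᶜ (u (suc k) *ᶜ v (suc k)))) (∑ᶜ (λ k → p (suc k) *ᶜ u (suc k))))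
        split : ∀ w → ∑ᶜ (λ k → z (suc (suc k)) ^ᶜ m *ᶜ (u (suc (suc k)) *ᶜ (z (suc (suc k)) -ᶜ w))) ≈ᶜ V -ᶜ w *ᶜ T
        split w = splitSum w (λ k → z (suc (suc k)) ^ᶜ m) (λ k → u (suc (suc k))) (λ k → z (suc (suc k)))

      unit-cancel : ∀ {d e x y} → d *ᶜ e ≈ᶜ 1ᶜ → d *ᶜ x ≈ᶜ d *ᶜ y → x ≈ᶜ y
      unit-cancel {d} {e} {x} {y} de≈1 dx≈dy = C.trans (expand x) (C.trans (C.*-congˡ {e} dx≈dy) (C.sym (expand y)))
        where
        expand : ∀ x → x ≈ᶜ e *ᶜ (d *ᶜ x)
        expand x = C.sym (C.trans (solveᶜ 3 (λ d e x → e :*ᶜ (d :*ᶜ x) :=ᶜ (d :*ᶜ e) :*ᶜ x) C.refl d e x)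
          (C.trans (C.*-congʳ de≈1) (C.*-identityˡ x)))

      -- Lagrange sum and h solve the same equation z₁ X + B = z₀ X + A, where A and B agree by
      -- induction, and z₁ - z₀ is invertible. Fewer variables at the same power means a higher
      -- degree: t + (n + 1) = (t + 1) + n.
      lagrangeSum≈h : ∀ n t (z u : Vector ℂ (suc n)) → Reciprocals z u → lagrangeSum (t ℕ.+ n) z u ≈ᶜ h (suc n) t z
      lagrangeSum≈h zero t z u du≈1 = C.trans (C.+-congʳ {0ᶜ} (C.trans (C.*-congˡ {z zero ^ᶜ (t ℕ.+ 0)} u≈1)
          (C.trans (C.*-identityʳ _) (C.reflexive (≡.cong (z zero ^ᶜ_) (ℕ.+-identityʳ t)))))) (C.sym (h-single t))
        where
        u≈1 : u zero ≈ᶜ 1ᶜ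
        u≈1 = C.trans (C.sym (C.trans (C.*-congʳ {u zero} (C.*-identityˡ 1ᶜ)) (C.*-identityˡ (u zero)))) (du≈1 zero)
        h-single : ∀ t → h 1 t z ≈ᶜ z zero ^ᶜ t +ᶜ 0ᶜ
        h-single zero    = C.trans (h-0 1 z) (C.sym (C.+-identityʳ 1ᶜ))
        h-single (suc t) = C.trans (h-recurrence 0 t z) (C.+-congʳ {0ᶜ} (C.*-congˡ {z zero} (C.trans (h-single t) (C.+-identityʳ _))))
      -- z₁ - z₀ is a factor of the denominator at the second node, so its inverse is the remaining
      -- product times that reciprocal.
      lagrangeSum≈h (suc n) t z u du≈1 = unit-cancel {z₁ -ᶜ z₀} {P *ᶜ u (suc zero)}
        (C.trans (C.sym (C.*-assoc (z₁ -ᶜ z₀) P (u (suc zero)))) (du≈1 (suc zero)))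
        (subtract z₀ z₁ (C.trans (C.+-congˡ {z₁ *ᶜ S} (C.sym ih₂)) (C.trans step (C.+-congˡ {z₀ *ᶜ S} ih₁)))
          (C.trans (C.sym (h-recurrence₂ n t z)) (h-recurrence (suc n) t z)))
        where
        z₀ z₁ P S : ℂ
        z₀ = z zero
        z₁ = z (suc zero)
        P = ∏ᶜ (λ j → factor (tail z) zero j)
        S = lagrangeSum (t ℕ.+ suc n) z u
        exponent : t ℕ.+ suc n ≡ suc t ℕ.+ n
        exponent = ℕ.+-suc t n
        step : z₁ *ᶜ S +ᶜ lagrangeSum (t ℕ.+ suc n) (dropSecond z) (withoutSecond z u) ≈ᶜ
               z₀ *ᶜ S +ᶜ lagrangeSum (t ℕ.+ suc n) (tail z) (withoutFirst z u)
        step = divided-difference (t ℕ.+ suc n) z u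
        ih₁ : lagrangeSum (t ℕ.+ suc n) (tail z) (withoutFirst z u) ≈ᶜ h (suc n) (suc t) (tail z)
        ih₁ = C.trans (C.reflexive (≡.cong (λ m → lagrangeSum m (tail z) (withoutFirst z u)) exponent))
          (lagrangeSum≈h n (suc t) (tail z) (withoutFirst z u) (reciprocals-withoutFirst z u du≈1))
        ih₂ : lagrangeSum (t ℕ.+ suc n) (dropSecond z) (withoutSecond z u) ≈ᶜ h (suc n) (suc t) (dropSecond z)
        ih₂ = C.trans (C.reflexive (≡.cong (λ m → lagrangeSum m (dropSecond z) (withoutSecond z u)) exponent))
          (lagrangeSum≈h n (suc t) (dropSecond z) (withoutSecond z u) (reciprocals-withoutSecond z u du≈1))
        subtract : ∀ a b {S H A B} → b *ᶜ S +ᶜ B ≈ᶜ a *ᶜ S +ᶜ A → b *ᶜ H +ᶜ B ≈ᶜ a *ᶜ H +ᶜ A → (b -ᶜ a) *ᶜ S ≈ᶜ (b -ᶜ a) *ᶜ H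
        subtract a b {S} {H} {A} {B} p q = C.trans (isolate S p) (C.sym (isolate H q))
          where
          isolate : ∀ S → b *ᶜ S +ᶜ B ≈ᶜ a *ᶜ S +ᶜ A → (b -ᶜ a) *ᶜ S ≈ᶜ A -ᶜ B
          isolate S p = C.trans (solveᶜ 4 (λ a b S B → (b :-ᶜ a) :*ᶜ S :=ᶜ (b :*ᶜ S :+ᶜ B) :-ᶜ (a :*ᶜ S :+ᶜ B)) C.refl a b S B)
            (C.trans (C.+-congʳ { -ᶜ (a *ᶜ S +ᶜ B)} p)
              (solveᶜ 4 (λ a S A B → (a :*ᶜ S :+ᶜ A) :-ᶜ (a :*ᶜ S :+ᶜ B) :=ᶜ A :-ᶜ B) C.refl a S A B))

  -- Lattice points of the dilated Birkhoff polytope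

  module LatticePoints (n t : ℕ) .{{t≢0 : NonZero t}} where

    open MagicMatrices n t

    LatticePoint : Set _
    LatticePoint = Σ[ M ∈ Matrix ℤ n ] Dilate (ofℕ t) (Birkhoff n) (λ j k → ofℤ (M j k))

    abs : Matrix ℤ n → Matrix ℕ n
    abs M j k = ℤ.∣ M j k ∣

    abstract
      ofℕ-injective : ∀ {a b} → ofℕ a ≈ ofℕ b → a ≡ b
      ofℕ-injective {a} {b} e with ℕ.<-cmp a b
      ... | tri< a<b _ _ = ⊥-elim (<-irrefl e (ofℕ-mono-< a<b))
      ... | tri≈ _ a≡b _ = a≡b
      ... | tri> _ _ b<a = ⊥-elim (<-irrefl (sym e) (ofℕ-mono-< b<a))

      ∑-ofℕ : ∀ {m} (v : Vector ℕ m) → ∑ (ofℕ ∘ v) ≈ ofℕ (Vec.sum (Vec.tabulate v))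
      ∑-ofℕ {zero}  v = refl
      ∑-ofℕ {suc m} v = trans (+-congˡ (∑-ofℕ (tail v))) (sym (MP.×-homo-+ 1# (v zero) _))

      0≤ofℕ : ∀ m → 0# ≤ ofℕ m
      0≤ofℕ zero    = ≤-reflexive refl
      0≤ofℕ (suc m) = <⇒≤ (0<ofℕ-suc m)

      ofℤ-nonneg : ∀ i → 0# ≤ ofℤ i → i ≡ + ℤ.∣ i ∣
      ofℤ-nonneg (+ m)    0≤i = ≡.refl
      ofℤ-nonneg -[1+ m ] 0≤i = ⊥-elim (0≤i (pos-neg (0<ofℕ-suc m)))

      0<t : 0# < ofℕ t
      0<t = positive t
        where
        positive : ∀ t .{{_ : NonZero t}} → 0# < ofℕ t
        positive (suc t) = 0<ofℕ-suc t

      t#0 : ofℕ t # 0#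
      t#0 = #-sym (<⇒# 0<t)

    r : ℝ
    r = inv (ofℕ t) t#0

    abstract
      tr≈1 : ofℕ t * r ≈ 1#
      tr≈1 = inv-inverseʳ (ofℕ t) t#0

      entry-nonneg : ∀ ((M , _) : LatticePoint) j k → M j k ≡ + abs M j k
      entry-nonneg (M , y , (0≤y , _) , M≈ty) j k =
        ofℤ-nonneg (M j k) (≤-resp-≈ refl (sym (M≈ty j k)) (*-nonneg (<⇒≤ 0<t) (0≤y j k)))

      -- The identity ∑ N = t ∑ y = t holds in ℝ and descends to ℕ by `ofℕ-injective`.
      line-sum : ∀ (N : Vector ℕ n) (y : Vector ℝ n) → (∀ k → ofℕ (N k) ≈ ofℕ t * y k) → ∑ y ≈ 1# → Vec.sum (Vec.tabulate N) ≡ t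
      line-sum N y N≈ty ∑y≈1 = ofℕ-injective (trans (sym (∑-ofℕ N)) (trans (ΣR.sum-cong-≋ N≈ty)
        (trans (sym (ΣR.*-distribˡ-sum (ofℕ t) y)) (trans (*-congˡ ∑y≈1) (*-identityʳ (ofℕ t))))))

      abs-magic : ∀ (p : LatticePoint) → IsMagic (abs (proj₁ p))
      abs-magic p@(M , y , (_ , rows , cols) , M≈ty) =
        (λ j → line-sum (abs M j) (y j) (λ k → abs≈ j k) (rows j)) ,
        (λ k → line-sum (λ j → abs M j k) (λ j → y j k) (λ j → abs≈ j k) (cols k))
        where
        abs≈ : ∀ j k → ofℕ (abs M j k) ≈ ofℕ t * y j k
        abs≈ j k = trans (reflexive (≡.cong ofℤ (≡.sym (entry-nonneg p j k)))) (M≈ty j k)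

      normalised-line : ∀ (N : Vector ℕ n) → Vec.sum (Vec.tabulate N) ≡ t → ∑ (λ k → r * ofℕ (N k)) ≈ 1#
      normalised-line N N-sum = trans (sym (ΣR.*-distribˡ-sum r (ofℕ ∘ N)))
        (trans (*-congˡ (trans (∑-ofℕ N) (reflexive (≡.cong ofℕ N-sum)))) (trans (*-comm r (ofℕ t)) tr≈1))

      magic-dilate : ∀ N → IsMagic N → Dilate (ofℕ t) (Birkhoff n) (λ j k → ofℤ (+ N j k))
      magic-dilate N (rows , cols) = (λ j k → r * ofℕ (N j k)) ,
        ((λ j k → *-nonneg (<⇒≤ (inverse-pos 0<t tr≈1)) (0≤ofℕ (N j k))) ,
         (λ j → normalised-line (N j) (rows j)) , (λ k → normalised-line (λ j → N j k) (cols k))) ,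
        (λ j k → sym (trans (sym (*-assoc (ofℕ t) r (ofℕ (N j k)))) (trans (*-congʳ tr≈1) (*-identityˡ (ofℕ (N j k))))))

    -- Lattice points are compared by their integer entries alone, so the point of the polytope
    -- chosen as y does not have to survive the round trip; y = N/t is supplied anew. Entries are
    -- nonnegative, hence recovered from their absolute values.
    ehrhartCount : IsEhrhartCount n t (length magicMatrices)
    ehrhartCount = record
      { to        = λ p → encode (abs (proj₁ p)) (abs-magic p)
      ; from      = λ i → (λ j k → + decode i j k) , magic-dilate (decode i) (decode-magic i)
      ; to-cong   = λ {p} {q} p≈q → encode-cong (abs-magic p) (abs-magic q) (λ j k → ≡.cong ℤ.∣_∣ (p≈q j k))
      ; from-cong = λ { ≡.refl j k → ≡.refl }
      ; inverse   = (λ {i} {p} p≈i → ≡.trans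
                        (encode-cong (abs-magic p) (decode-magic i) (λ j k → ≡.cong ℤ.∣_∣ (p≈i j k)))
                        (encode-decode i (decode-magic i)))
                  , (λ { {p} ≡.refl j k → ≡.trans (≡.cong +_ (decode-encode (abs (proj₁ p)) (abs-magic p) j k)) (≡.sym (entry-nonneg p j k)) })
      }

  -- Products of residues and their count

  module Coefficients where

    abstract
      -- Splits the reciprocal of (z₁ ⋯ zₙ)^(t+1) into one factor for each variable, as the iterated
      -- integral requires.
      product-power-inverse : ∀ {n} {f g : Vector ℂ n} m → (∀ k → f k *ᶜ g k ≈ᶜ 1ᶜ) →
                              ∏ᶜ f ^ᶜ m *ᶜ ∏ᶜ (λ k → g k ^ᶜ m) ≈ᶜ 1ᶜ
      product-power-inverse {zero}  m fg≈1 = C.trans (C.*-identityʳ (1ᶜ ^ᶜ m)) (1^ m)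
      product-power-inverse {suc n} {f} {g} m fg≈1 = C.trans
        (C.*-congʳ {g zero ^ᶜ m *ᶜ ∏ᶜ (λ k → g (suc k) ^ᶜ m)} (XC.^-distrib-* (f zero) (∏ᶜ (tail f)) m))
        (C.trans (solveᶜ 4 (λ a b d e → (a :*ᶜ b) :*ᶜ (d :*ᶜ e) :=ᶜ (a :*ᶜ d) :*ᶜ (b :*ᶜ e)) C.refl
            (f zero ^ᶜ m) (∏ᶜ (tail f) ^ᶜ m) (g zero ^ᶜ m) (∏ᶜ (λ k → g (suc k) ^ᶜ m)))
          (C.trans (C.*-cong (power-inverse (fg≈1 zero) m) (product-power-inverse {f = tail f} {tail g} m (fg≈1 ∘ suc))) (C.*-identityˡ 1ᶜ)))

      ∑ₗ-count : ∀ {x p} {X : Set x} {P : X → Set p} (P? : ∀ x → Dec (P x)) {f : X → ℂ} {d : ℂ} →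
        (∀ x → P x → f x ≈ᶜ d) → (∀ x → ¬ P x → f x ≈ᶜ 0ᶜ) → ∀ xs → ∑ₗ f xs ≈ᶜ d *ᶜ ofℝ (ofℕ (length (filter P? xs)))
      ∑ₗ-count P? {d = d} f≈d f≈0 [] = C.sym (C.zeroʳ d)
      ∑ₗ-count P? {f} {d} f≈d f≈0 (x ∷ xs) with P? x
      ... | yes px = C.trans (C.+-cong (f≈d x px) (∑ₗ-count P? f≈d f≈0 xs))
        (C.sym (C.trans (C.*-congˡ {d} (ofℝ-+ 1# (ofℕ (length (filter P? xs))))) (C.trans (C.distribˡ d 1ᶜ _) (C.+-congʳ (C.*-identityʳ d)))))
      ... | no ¬px = C.trans (C.+-cong (f≈0 x ¬px) (∑ₗ-count P? f≈d f≈0 xs)) (C.+-identityˡ _)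

      ∏-indicator : ∀ {t} {ρ : ℕ → ℂ} {d} → ρ t ≈ᶜ d → ∀ {n} (a : Vec ℕ n) → a ≡ Vec.replicate n t → ∏ᶜ (λ k → ρ (Vec.lookup a k)) ≈ᶜ d ^ᶜ n
      ∏-indicator ρt≈d []      ≡.refl = C.refl
      ∏-indicator {ρ = ρ} ρt≈d (_ ∷ a) ≡.refl = C.*-cong ρt≈d (∏-indicator {ρ = ρ} ρt≈d a ≡.refl)

      ∏-indicator-0 : ∀ {t} {ρ : ℕ → ℂ} → (∀ {a} → a ≢ t → ρ a ≈ᶜ 0ᶜ) →
                      ∀ {n} (a : Vec ℕ n) → a ≢ Vec.replicate n t → ∏ᶜ (λ k → ρ (Vec.lookup a k)) ≈ᶜ 0ᶜ
      ∏-indicator-0 ρ≈0 [] a≢ = ⊥-elim (a≢ ≡.refl)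
      ∏-indicator-0 {t} {ρ} ρ≈0 (i ∷ a) a≢ with i ℕ.≟ t
      ... | yes ≡.refl = C.trans (C.*-congˡ {ρ i} (∏-indicator-0 {ρ = ρ} ρ≈0 a (λ a≡ → a≢ (≡.cong (i ∷_) a≡)))) (C.zeroʳ (ρ i))
      ... | no i≢t     = C.trans (C.*-congʳ (ρ≈0 i≢t)) (C.zeroˡ (∏ᶜ (λ k → ρ (Vec.lookup a k))))

      quotient-cancel : ∀ {w r I} (u : Unit w) → I ≈ᶜ w *ᶜ r → r ≈ᶜ 1ᶜ / w [ u ] *ᶜ I
      quotient-cancel {w} {r} {I} (v , _ , wv≈1) I≈wr = C.sym (C.trans (C.*-cong {1ᶜ *ᶜ v} {v} (C.*-identityˡ v) I≈wr)
        (C.trans (solveᶜ 3 (λ v w r → v :*ᶜ (w :*ᶜ r) :=ᶜ (w :*ᶜ v) :*ᶜ r) C.refl v w r)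
          (C.trans (C.*-congʳ {r} wv≈1) (C.*-identityˡ r))))

  open Coefficients

  -- The integrand as a Laurent polynomial, and its integral

  module IntegrandExpansion (n t : ℕ) where

    open LagrangeSum
    open LaurentIntegrals t
    open MagicMatrices (suc n) t

    columnMonomial : ∀ {ε : Vector ℝ (suc n)} → (∀ k → 0# < ε k) → Torus ε → Vec (Vec ℕ (suc n)) (suc n) → ℂ
    columnMonomial 0<ε z A = ∏ᶜ (λ k → monomial (0<ε k) (Vec.lookup (columnSums A) k) (z k))

    module _ {ε : Vector ℝ (suc n)} (0<ε : ∀ k → 0# < ε k) (ε-distinct : ∀ j k → j ≢ k → ε j # ε k) (z : Torus ε) where

      private
        module I = Integrand t ε 0<ε ε-distinct z

        Z : Vector ℂ (suc n)
        Z = pt ∘ z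

        W S : ℂ
        W = proj₁ I.Unit-monomial
        S = ∑ᶜ (λ k → Z k ^ᶜ (t ℕ.+ suc n ℕ.∸ 1) *ᶜ proj₁ (I.Unit-denominator k))

      abstract
        S≈h : S ≈ᶜ h (suc n) t Z
        -- There are n + 1 variables, so the truncated difference t + (n + 1) ∸ 1 is the true
        -- exponent t + n.
        S≈h = C.trans (C.reflexive (≡.cong (λ m → lagrangeSum m Z (λ k → proj₁ (I.Unit-denominator k))) (≡.cong (ℕ._∸ 1) (ℕ.+-suc t n))))
          (lagrangeSum≈h n t Z (λ k → proj₁ (I.Unit-denominator k)) (λ k → proj₂ (proj₂ (I.Unit-denominator k))))

        W≈ : W ≈ᶜ ∏ᶜ (λ k → recip (0<ε k) (z k) ^ᶜ suc t)
        W≈ = C.trans (inverse-unique {∏ᶜ Z ^ᶜ (t ℕ.+ 1)} (proj₂ (proj₂ I.Unit-monomial))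
            (product-power-inverse (t ℕ.+ 1) (λ k → recip-inverse (0<ε k) (z k))) (C.refl {∏ᶜ Z ^ᶜ (t ℕ.+ 1)}))
          (C.reflexive (≡.cong (λ m → ∏ᶜ (λ k → recip (0<ε k) (z k) ^ᶜ m)) (ℕ.+-comm t 1)))

        integrand-expansion : integrand t ε 0<ε ε-distinct z ≈ᶜ ∑ₗ (λ A → 1ᶜ *ᶜ columnMonomial 0<ε z A) rowChoices
        integrand-expansion = C.trans {W *ᶜ S ^ᶜ suc n} {W *ᶜ ∑ₗ (λ A → power-product Z (columnSums A)) rowChoices}
          (C.*-congˡ {W} (C.trans (XC.^-congˡ (suc n) S≈h) (h-power t Z (suc n))))
          (C.trans (*-distribˡ-∑ₗ W (λ A → power-product Z (columnSums A)) rowChoices) (∑ₗ-cong term rowChoices))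
          where
          term : ∀ A → W *ᶜ power-product Z (columnSums A) ≈ᶜ 1ᶜ *ᶜ columnMonomial 0<ε z A
          term A = C.trans (C.*-comm W (power-product Z (columnSums A))) (C.trans (C.*-congˡ {power-product Z (columnSums A)} W≈)
            (C.trans (C.sym (ΠC.∑-distrib-+ (λ k → Z k ^ᶜ Vec.lookup (columnSums A) k) (λ k → recip (0<ε k) (z k) ^ᶜ suc t)))
              (C.sym (C.*-identityˡ (columnMonomial 0<ε z A)))))

    totalResidue : ℂ
    totalResidue = ∑ₗ (λ A → 1ᶜ *ᶜ ∏ᶜ (λ k → residue (Vec.lookup (columnSums A) k))) rowChoices

    abstract
      integrand-integral : ∀ {ε : Vector ℝ (suc n)} (0<ε : ∀ k → 0# < ε k) (ε-distinct : ∀ j k → j ≢ k → ε j # ε k) →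
                           IsIteratedIntegral ε (integrand t ε 0<ε ε-distinct) totalResidue
      integrand-integral {ε} 0<ε ε-distinct = iterated-integral {suc n} {ε} 0<ε rowChoices (λ _ → 1ᶜ) (λ A → Vec.lookup (columnSums A))
        {integrand t ε 0<ε ε-distinct} (integrand-expansion 0<ε ε-distinct)

      -- A row choice contributes one factor 2πi per column if all column sums are t, and a
      -- vanishing factor otherwise. The filtered list that `∑ₗ-count` produces is `magicMatrices`
      -- itself.
      totalResidue≈ : totalResidue ≈ᶜ 2π𝕚 ^ᶜ suc n *ᶜ ofℝ (ofℕ (length magicMatrices))
      totalResidue≈ = ∑ₗ-count hasColumnSums? {λ A → 1ᶜ *ᶜ residues A} {2π𝕚 ^ᶜ suc n}
        (λ A e → C.trans (C.*-identityˡ (residues A)) (∏-indicator {ρ = residue} {2π𝕚} (C.reflexive residue-≡) (columnSums A) e))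
        (λ A ne → C.trans (C.*-identityˡ (residues A)) (∏-indicator-0 {ρ = residue} (λ a≢t → C.reflexive (residue-≢ a≢t)) (columnSums A) ne))
        rowChoices
        where
        residues : Vec (Vec ℕ (suc n)) (suc n) → ℂ
        residues A = ∏ᶜ (λ k → residue (Vec.lookup (columnSums A) k))

theorem2 : ∀ {c ℓ₁ ℓ₂} (reals : RealNumbers c ℓ₁ ℓ₂) → let open Analysis reals in
    (n t : ℕ) .{{_ : NonZero n}} .{{_ : NonZero t}}
    (ε : Vector ℝ n) (0<ε : ∀ k → 0# < ε k) (ε<1 : ∀ k → ε k < 1#)
    (ε-distinct : ∀ j k → j ≢ k → ε j # ε k) →
    ∃[ H ] IsEhrhartCount n t H ×
    ∃[ I ] IsIteratedIntegral ε (integrand t ε 0<ε ε-distinct) I ×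
    ofℝ (ofℕ H) ≈ᶜ 1ᶜ / 2π𝕚 ^ᶜ n [ Unit-^ n Unit-2π𝕚 ] *ᶜ I
theorem2 reals (suc n) t ε 0<ε ε<1 ε-distinct =
  length magicMatrices , ehrhartCount , totalResidue , integrand-integral 0<ε ε-distinct ,
  quotient-cancel (Unit-^ (suc n) Unit-2π𝕚) totalResidue≈
  where
  open Analysis reals
  open MagicMatrices (suc n) t
  open BirkhoffIntegral reals
  open Coefficients
  open LatticePoints (suc n) t
  open IntegrandExpansion n t
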